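{- Let $J$ be any 2-connected cubic graph, and let $C$ be a separating cut of a matching covered graph $G$. If $G$ is $K_4(J)$-free, then both $C$-contractions of $G$ are $K_4(J)$-free.
   Context: Graphs are finite and loopless; multiple edges are allowed. A graph is matchable if it has a perfect matching (the empty graph is matchable). A connected graph with at least two vertices is matching covered if each edge lies in some perfect matching. A graph is cubic if every vertex has degree three. The graph $\Theta$ (two vertices joined by three edges) counts as 2-connected; every 2-connected cubic graph is matching covered. For $X\subseteq V(G)$, $\partial(X)$ is the set of edges with exactly one end in $X$, and $\overline{X}=V(G)-X$. $G/X$ denotes the graph obtained by shrinking $X$ to a single vertex and deleting all edges with both ends in $X$. For a cut $C=\partial(X)$, the graphs $G/X$ and $G/\overline{X}$ are the $C$-contractions of $G$. A cut $C$ of a matching covered graph $G$ is separating if both $C$-contractions are matching covered. A subgraph $H$ of $G$ is conformal if $G-V(H)$ is matchable. A bi-subdivision of a graph $L$ is a graph obtained from $L$ by subdividing each edge of some subset of $E(L)$ with an even number of subdivision vertices. A matching covered graph $L$ is a conformal minor of a matching covered graph $G$ if $G$ has a conformal subgraph that is a bi-subdivision of $L$. For a finite set $\mathcal{J}$ of matching covered graphs, $G$ is $\mathcal{J}$-free if no member of $\mathcal{J}$ is a conformal minor of $G$. For a 2-connected cubic graph $J$ and $T\subseteq V(J)$ (possibly empty or all of $V(J)$), $J^T\odot K_4$ is the cubic graph obtained from $J$ by replacing each vertex $v\in T$ by a triangle, the three edges of $J$ incident with $v$ becoming incident with the three distinct vertices of the triangle. $K_4(J)=\{J^T\odot K_4: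 T\subseteq V(J)\}$ (up to isomorphism). -}

module Defs where

open import Data.Bool.Base using (Bool; true; false; not; _∧_; _xor_; T)
open import Data.Bool.Properties using (T-∧)
open import Data.Fin.Base using (Fin; zero; suc; toℕ; inject₁)
open import Data.Fin.Patterns using (0F; 1F; 2F)
open import Data.Fin.Properties using (+↔⊎; 0↔⊥; 1↔⊤; toℕ-inject₁)
import Data.Fin.Properties as Fin
open import Data.Fin.Relation.Unary.Top using (view; ‵fromℕ; ‵inject₁)
open import Data.Nat.Base using (ℕ; zero; suc; _+_)
open import Data.Nat.Divisibility using (_∣_)
open import Data.Nat.Properties using (1+n≢n)
open import Data.Product using (Σ; ∃; ∃₂; ∃!; _×_; _,_; proj₁; proj₂)
open import Data.Product.Function.Dependent.Propositional using (Σ-↔)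
open import Data.Sum.Base using (_⊎_; inj₁; inj₂; [_,_]′)
open import Data.Sum.Properties using (inj₁-injective; inj₂-injective)
open import Data.Sum.Function.Propositional using (_⊎-↔_)
open import Data.Unit.Base using (⊤; tt)
open import Function.Base using (_∘_; const)
open import Function.Bundles using (_↔_; _⇔_; Inverse; Equivalence; mk↔ₛ′)
open import Function.Properties.Inverse using (↔-refl; ↔-sym; ↔-trans; Inverse⇒Injection)
open import Level using (0ℓ)
open import Relation.Binary.Construct.Closure.ReflexiveTransitive using (Star)
open import Relation.Binary.Definitions using (DecidableEquality)
open import Relation.Binary.PropositionalEquality
  using (_≡_; _≢_; refl; sym; trans; cong)
open import Relation.Nullary using (¬_)
open import Relation.Nullary.Decidable using (⌊_⌋; via-injection)
open import Relation.Unary using (Pred)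

Finite : Set → Set
Finite A = ∃ λ n → A ↔ Fin n

finite-⊤ : Finite ⊤
finite-⊤ = 1 , ↔-sym 1↔⊤

finite-T : ∀ b → Finite (T b)
finite-T true  = finite-⊤
finite-T false = 0 , ↔-sym 0↔⊥

finite-⊎ : ∀ {A B} → Finite A → Finite B → Finite (A ⊎ B)
finite-⊎ (m , f) (n , g) = m + n , ↔-trans (f ⊎-↔ g) (↔-sym +↔⊎)

finite-ΣFin : ∀ n {B : Fin n → Set} → (∀ i → Finite (B i)) → Finite (Σ (Fin n) B)
finite-ΣFin zero    _ = 0 , mk↔ₛ′ (λ ()) (λ ()) (λ ()) (λ ())
finite-ΣFin (suc n) {B} f =
  let m , g = finite-⊎ (f zero) (finite-ΣFin n (f ∘ suc)) in m , ↔-trans uncons g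
  where
  uncons : Σ (Fin (suc n)) B ↔ (B zero ⊎ Σ (Fin n) (B ∘ suc))
  uncons = mk↔ₛ′
    (λ { (zero , b) → inj₁ b ; (suc i , b) → inj₂ (i , b) })
    (λ { (inj₁ b) → zero , b ; (inj₂ (i , b)) → suc i , b })
    (λ { (inj₁ b) → refl ; (inj₂ (i , b)) → refl })
    (λ { (zero , b) → refl ; (suc i , b) → refl })

finite-Σ : ∀ {A} {B : A → Set} → Finite A → (∀ a → Finite (B a)) → Finite (Σ A B)
finite-Σ {A} {B} (n , f) g =
  let m , h = finite-ΣFin n (g ∘ Inverse.from f)
  in  m , ↔-trans (↔-sym (Σ-↔ (↔-sym f) ↔-refl)) h

finite⇒≟ : ∀ {A} → Finite A → DecidableEquality A
finite⇒≟ (_ , f) = via-injection (Inverse⇒Injection f) Fin._≟_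

------------------------------------------------------------------------
-- Subsets (all types of vertices and edges below are finite, so nothing
-- is lost by taking subsets to be decidable)

Subset : Set → Set
Subset A = A → Bool

infix 4 _∈_ _∉_

_∈_ : ∀ {A} → A → Subset A → Set
a ∈ X = T (X a)

∁ : ∀ {A} → Subset A → Subset A
∁ X a = not (X a)

_∉_ : ∀ {A} → A → Subset A → Set
a ∉ X = a ∈ ∁ X

∈⊎∉ : ∀ {A} (X : Subset A) a → a ∈ X ⊎ a ∉ X
∈⊎∉ X a with X a
... | true  = inj₁ tt
... | false = inj₂ tt

------------------------------------------------------------------------
-- Graphs

-- The order of the two ends of an edge carries no meaning: every notion
-- below, isomorphism included, is invariant under exchanging them.
record Graph : Set₁ where
  field
    V E       : Set
    finite-V  : Finite V
    finite-E  : Finite E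
    end₁ end₂ : E → V
    loopless  : ∀ e → end₁ e ≢ end₂ e

  Incident : V → E → Set
  Incident v e = end₁ e ≡ v ⊎ end₂ e ≡ v

  Adjacent : V → V → Set
  Adjacent u v = ∃ λ e → (end₁ e ≡ u × end₂ e ≡ v) ⊎ (end₁ e ≡ v × end₂ e ≡ u)

  -- Since the graph is loopless, Incident v e has at most one proof, so
  -- the pairs counted here correspond to the edges at v.
  HasDegree : V → ℕ → Set
  HasDegree v d = (∃ λ e → Incident v e) ↔ Fin d

  -- Connectedness in the sense that also admits the empty graph.
  Connected : Set
  Connected = ∀ u v → Star Adjacent u v

  AtLeastTwoVertices : Set
  AtLeastTwoVertices = ∃₂ λ (u v : V) → u ≢ v

  PerfectMatching : Subset E → Set
  PerfectMatching M = ∀ v → ∃! _≡_ λ e → e ∈ M × Incident v e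

  Matchable : Set
  Matchable = ∃ PerfectMatching

  MatchingCovered : Set
  MatchingCovered =
    Connected × AtLeastTwoVertices × (∀ e → ∃ λ M → PerfectMatching M × e ∈ M)

  Cubic : Set
  Cubic = ∀ v → HasDegree v 3

  ∂ : Subset V → Subset E
  ∂ X e = X (end₁ e) xor X (end₂ e)

  ⁅_⁆ : V → Subset V
  ⁅ v ⁆ u = ⌊ finite⇒≟ finite-V u v ⌋

open Graph public using
  ( MatchingCovered; Matchable; Connected; AtLeastTwoVertices; Cubic )

-- For loopless graphs, preserving and reflecting incidence is the same as
-- preserving the unordered pair of ends of each edge.
infix 4 _≅_

record _≅_ (G H : Graph) : Set where
  private
    module G = Graph G
    module H = Graph H
  field
    V↔ : G.V ↔ H.V
    E↔ : G.E ↔ H.E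
    incident : ∀ v e → G.Incident v e ⇔ H.Incident (Inverse.to V↔ v) (Inverse.to E↔ e)

------------------------------------------------------------------------
-- Subgraphs and deletion

record Subgraph (G : Graph) : Set where
  open Graph G
  field
    vertices : Subset V
    edges    : Subset E
    closed   : ∀ e → e ∈ edges → end₁ e ∈ vertices × end₂ e ∈ vertices

  graph : Graph
  graph = record
    { V        = Σ V (_∈ vertices)
    ; E        = Σ E (_∈ edges)
    ; finite-V = finite-Σ finite-V (finite-T ∘ vertices)
    ; finite-E = finite-Σ finite-E (finite-T ∘ edges)
    ; end₁     = λ (e , e∈) → end₁ e , proj₁ (closed e e∈)
    ; end₂     = λ (e , e∈) → end₂ e , proj₂ (closed e e∈)
    ; loopless = λ (e , _) → loopless e ∘ cong proj₁
    }

induced : ∀ G → Subset (Graph.V G) → Subgraph G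
induced G X = record
  { vertices = X
  ; edges    = λ e → X (end₁ e) ∧ X (end₂ e)
  ; closed   = λ _ → Equivalence.to T-∧
  }
  where open Graph G

infixl 6 _-_

_-_ : ∀ G → Subset (Graph.V G) → Graph
G - X = Subgraph.graph (induced G (∁ X))

-- Connected, with at least two vertices and no cut vertex.  Among loopless
-- cubic graphs, the only one on two vertices satisfying this is Θ.
TwoConnected : Graph → Set
TwoConnected G =
  Connected G × AtLeastTwoVertices G × (∀ v → Connected (G - Graph.⁅_⁆ G v))

Conformal : ∀ {G} → Subgraph G → Set
Conformal {G} H = Matchable (G - Subgraph.vertices H)

------------------------------------------------------------------------
-- Contraction and cuts

infixl 7 _/_

-- inj₁ tt is the vertex to which X is shrunk.
_/_ : ∀ G → Subset (Graph.V G) → Graph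
G / X = record
  { V        = ⊤ ⊎ Σ V (_∉ X)
  ; E        = Σ E (_∉ inside)
  ; finite-V = finite-⊎ finite-⊤ (finite-Σ finite-V (finite-T ∘ ∁ X))
  ; finite-E = finite-Σ finite-E (finite-T ∘ ∁ inside)
  ; end₁     = shrink ∘ end₁ ∘ proj₁
  ; end₂     = shrink ∘ end₂ ∘ proj₁
  ; loopless = λ (e , e∉) → no-loop (end₁ e) (end₂ e) (loopless e) e∉
  }
  where
  open Graph G

  inside : Subset E
  inside e = X (end₁ e) ∧ X (end₂ e)

  shrink : V → ⊤ ⊎ Σ V (_∉ X)
  shrink v = [ const (inj₁ tt) , (λ v∉ → inj₂ (v , v∉)) ]′ (∈⊎∉ X v)

  not-both : ∀ a b → T a → T b → ¬ T (not (a ∧ b))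
  not-both true true _ _ ()

  no-loop : ∀ u v → u ≢ v → T (not (X u ∧ X v)) → shrink u ≢ shrink v
  no-loop u v u≢v ∉ eq with ∈⊎∉ X u | ∈⊎∉ X v
  ... | inj₁ u∈ | inj₁ v∈ = not-both (X u) (X v) u∈ v∈ ∉
  ... | inj₂ _  | inj₂ _  = u≢v (cong proj₁ (inj₂-injective eq))
  no-loop u v u≢v ∉ () | inj₁ _ | inj₂ _
  no-loop u v u≢v ∉ () | inj₂ _ | inj₁ _

-- A cut is presented by one of its shores.  In a connected graph the edge
-- set of a cut determines its shore up to complementation, and everything
-- said about cuts below is symmetric in the two shores.
record Cut (G : Graph) : Set where
  field
    shore : Subset (Graph.V G)

  edges : Subset (Graph.E G)
  edges = Graph.∂ G shore

  contraction₁ contraction₂ : Graph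
  contraction₁ = G / shore
  contraction₂ = G / ∁ shore

  Separating : Set
  Separating = MatchingCovered contraction₁ × MatchingCovered contraction₂

------------------------------------------------------------------------
-- Conformal minors

-- Edge e of L becomes a path with s e interior vertices (e , 0), …,
-- (e , s e - 1) and s e + 1 edges, numbered from end₁ e towards end₂ e.
subdivide : ∀ L → (Graph.E L → ℕ) → Graph
subdivide L s = record
  { V        = V′
  ; E        = E′
  ; finite-V = finite-⊎ finite-V (finite-Σ finite-E λ e → s e , ↔-refl)
  ; finite-E = finite-Σ finite-E λ e → suc (s e) , ↔-refl
  ; end₁     = start
  ; end₂     = finish
  ; loopless = no-loop
  }
  where
  open Graph L

  V′ E′ : Set
  V′ = V ⊎ (Σ E λ e → Fin (s e))
  E′ = Σ E λ e → Fin (suc (s e))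

  start : E′ → V′
  start (e , zero)  = inj₁ (end₁ e)
  start (e , suc i) = inj₂ (e , i)

  finish : E′ → V′
  finish (e , i) with view i
  ... | ‵fromℕ     = inj₁ (end₂ e)
  ... | ‵inject₁ j = inj₂ (e , j)

  index : V′ → ℕ
  index (inj₁ _)       = 0
  index (inj₂ (_ , i)) = toℕ i

  start≢end₂ : ∀ e i → start (e , i) ≢ inj₁ (end₂ e)
  start≢end₂ e zero    eq = loopless e (inj₁-injective eq)
  start≢end₂ e (suc i) ()

  start≢next : ∀ e i j → i ≡ inject₁ j → start (e , i) ≢ inj₂ (e , j)
  start≢next e zero    j _  ()
  start≢next e (suc i) j eq eq′ =
    1+n≢n (trans (trans (cong toℕ eq) (toℕ-inject₁ j)) (sym (cong index eq′)))

  no-loop : ∀ e → start e ≢ finish e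
  no-loop (e , i) eq with view i
  ... | ‵fromℕ     = start≢end₂ e _ eq
  ... | ‵inject₁ j = start≢next e _ j refl eq

BiSubdivision : Graph → Graph → Set
BiSubdivision L H = ∃ λ s → (∀ e → 2 ∣ s e) × H ≅ subdivide L s

ConformalMinor : Graph → Graph → Set
ConformalMinor L G =
  ∃ λ (H : Subgraph G) → Conformal H × BiSubdivision L (Subgraph.graph H)

Free : Pred Graph 0ℓ → Graph → Set₁
Free 𝒥 G = ∀ L → 𝒥 L → ¬ ConformalMinor L G

------------------------------------------------------------------------
-- Replacing vertices of a cubic graph by triangles

-- The cubic structure numbers the three edges at each v ∈ X by Fin 3; the
-- i-th of them is attached to vertex (v , i) of the triangle replacing v.
-- Any other numbering gives an isomorphic graph.
_^_⊙K₄ : ((J , _) : Σ Graph Cubic) → Subset (Graph.V J) → Graph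
(J , cubic) ^ X ⊙K₄ = record
  { V        = V′
  ; E        = E′
  ; finite-V = finite-⊎ (finite-Σ finite-V (finite-T ∘ ∁ X)) finite-triangles
  ; finite-E = finite-⊎ finite-E finite-triangles
  ; end₁     = start
  ; end₂     = finish
  ; loopless = no-loop
  }
  where
  open Graph J

  V′ E′ : Set
  V′ = Σ V (_∉ X) ⊎ (Σ V (_∈ X) × Fin 3)
  E′ = E ⊎ (Σ V (_∈ X) × Fin 3)

  finite-triangles : Finite (Σ V (_∈ X) × Fin 3)
  finite-triangles = finite-Σ (finite-Σ finite-V (finite-T ∘ X)) λ _ → 3 , ↔-refl

  attach : ∀ v → (∃ λ e → Incident v e) → V′
  attach v i =
    [ (λ v∈ → inj₂ ((v , v∈) , Inverse.to (cubic v) i)) , (λ v∉ → inj₁ (v , v∉)) ]′ (∈⊎∉ X v)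

  next : Fin 3 → Fin 3
  next 0F = 1F
  next 1F = 2F
  next 2F = 0F

  start finish : E′ → V′
  start  (inj₁ e)       = attach (end₁ e) (e , inj₁ refl)
  start  (inj₂ (v , i)) = inj₂ (v , i)
  finish (inj₁ e)       = attach (end₂ e) (e , inj₂ refl)
  finish (inj₂ (v , i)) = inj₂ (v , next i)

  next-≢ : ∀ i → i ≢ next i
  next-≢ 0F ()
  next-≢ 1F ()
  next-≢ 2F ()

  origin : V′ → V
  origin = [ proj₁ , proj₁ ∘ proj₁ ]′

  origin-attach : ∀ v i → origin (attach v i) ≡ v
  origin-attach v i with ∈⊎∉ X v
  ... | inj₁ _ = refl
  ... | inj₂ _ = refl

  no-loop : ∀ e → start e ≢ finish e
  no-loop (inj₁ e) eq = loopless e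
    (trans (sym (origin-attach (end₁ e) (e , inj₁ refl)))
      (trans (cong origin eq) (origin-attach (end₂ e) (e , inj₂ refl))))
  no-loop (inj₂ (v , i)) eq = next-≢ i (cong proj₂ (inj₂-injective eq))

K₄ : Σ Graph Cubic → Pred Graph 0ℓ
K₄ J L = ∃ λ X → L ≅ J ^ X ⊙K₄

{-# OPTIONS --safe #-}

-- Let X be a shore of C.  A conformal bi-subdivision in G / X uses the contracted
-- vertex either not at all, or inside a path, or as a branch vertex.  In the last
-- case one needs, for the ends x, y, z in X of the three edges used, a "gadget" on X:
-- either a claw with even legs ending in x, y, z, or a triangle of odd paths with such
-- legs at its corners, the rest of X being matched.  A gadget yields the (weaker)
-- structures for the other two cases by dropping parts of it.  Replacing a vertex of
-- J by a claw changes nothing, replacing it by a triangle inserts a triangle, and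
-- a triangle put in place of a corner of a triangle contains a claw, so the result
-- is again a member of K₄ (J).
--
-- Gadgets are found as in Edmonds' matching algorithm.  Since G / (V − X) is matching
-- covered, each such end of an edge of C is missed by some near-perfect matching
-- of X.  Fix one of these, N, missing r; then all the ends are reached from r by even
-- N-alternating paths.  Grow a set R ∋ r such that N matches R − r, together with a
-- set U ⊆ R such that any three vertices of U have a gadget on R: either
-- along an N-alternating path u a a′ with u in U, adding a′ to U, or, if some end is
-- reached through a′ a instead, along the odd cycle closed by its path in G / R.
-- Both steps reduce to odd cycles and paths on three vertices, since gadgets can be
-- lifted along a contraction of R.

module Submission where

import Defs
open import Defs hiding (_∈_; _∉_)
import Algebra.Properties.CommutativeMonoid.Sum as Sum
import Algebra.Solver.CommutativeMonoid as CommutativeMonoidSolver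
open import Data.Bool.Base using (Bool; true; false; not; _xor_; T; _∧_)
open import Data.Bool.Properties using (not-distribˡ-xor; not-involutive; T-irrelevant; T-∧)
open import Data.Fin.Base using (Fin; zero; suc; splitAt; inject₁; fromℕ; toℕ)
open import Data.Fin.Patterns using (0F; 1F; 2F)
open import Data.Fin.Properties
  using (injective⇒≤; any?; toℕ-fromℕ; toℕ-inject₁; toℕ<n; toℕ-injective)
open import Data.Fin.Relation.Unary.Top
  using (view; view-fromℕ; view-inject₁; ‵fromℕ; ‵inject₁)
open import Data.List.Base
  using (List; []; _∷_; _++_; [_]; concatMap; map; length; lookup; tabulate)
import Data.List.Membership.DecPropositional as DecMembership
open import Data.List.Membership.Propositional using (_∈_; _∉_)
open import Data.List.Membership.Propositional.Properties
  using (∈-++⁻; ∈-++⁺ˡ; ∈-++⁺ʳ; ∈-∃++; ∈-map⁺; ∈-lookup)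
open import Data.List.Properties
  using (++-assoc; concatMap-++; ++-identityʳ; length-++; tabulate-lookup; map-tabulate;
    tabulate-cong; map-++; map-id)
import Data.List.Relation.Binary.Permutation.Propositional as Perm
open import Data.List.Relation.Binary.Permutation.Propositional
  using (_↭_; ↭-refl; ↭-sym; ↭-trans; prep; ↭-reflexive; swap; ↭⇒↭ₛ)
open import Data.List.Relation.Binary.Permutation.Propositional.Properties
  using (++-commutativeMonoid; ++⁺; ++⁺ˡ; ++⁺ʳ; ++-comm; drop-∷; ∈-resp-↭; shifts; shift;
    ↭-length; map⁺)
import Data.List.Relation.Binary.Permutation.Setoid.Properties as PermSetoid
import Data.List.Relation.Unary.All as All
open import Data.List.Relation.Unary.All using (All; []; _∷_)
import Data.List.Relation.Unary.All.Properties as All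
open import Data.List.Relation.Unary.AllPairs using ([]; _∷_)
open import Data.List.Relation.Unary.Any using (here; there)
open import Data.List.Relation.Unary.Unique.Propositional using (Unique)
open import Data.List.Relation.Unary.Unique.Propositional.Properties using (tabulate⁺)
open import Data.Nat.Base using (ℕ; zero; suc; _+_; _<_; _≤_; s≤s; _*_)
open import Data.Nat.Divisibility using (_∣_; divides; ∣m∣n⇒∣m+n; _∣0)
open import Data.Nat.Properties
  using (≤-trans; ≤-refl; m≤n+m; +-suc; +-identityʳ; <-irrefl; <-≤-trans; ≤-reflexive; n<1+n;
    m<n⇒m<1+n; _≟_; n≢0⇒n>0)
open import Data.Product.Base using (∃; ∃₂; _×_; _,_; proj₁; proj₂; Σ)
open import Data.Product.Function.Dependent.Propositional using (Σ-↔)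
open import Data.Sum.Base using (_⊎_; inj₁; inj₂; [_,_]′)
open import Data.Sum.Properties using (inj₁-injective; inj₂-injective)
open import Data.Unit.Base using (⊤; tt)
open import Function.Base using (_∘_; id; const)
open import Function.Bundles using (_↔_; Inverse; mk↔ₛ′; Equivalence; mk⇔)
open import Function.Properties.Equivalence using () renaming (refl to ⇔-refl)
open import Function.Properties.Inverse using (↔-refl; ↔-sym; ↔-trans)
open import Relation.Binary.Construct.Closure.ReflexiveTransitive using (Star; ε; _◅_)
open import Relation.Binary.Definitions using (Symmetric; DecidableEquality)
open import Relation.Binary.PropositionalEquality
  using (_≡_; refl; sym; trans; cong; subst; _≢_; setoid; subst₂)
open import Relation.Nullary using (¬_; yes; no; contradiction; Dec)
open import Relation.Nullary.Decidable
  using (⌊_⌋; toWitness; fromWitness; toWitnessFalse; fromWitnessFalse; map′)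

-- Paths, matchings and gadgets

-- Lists of vertices do not tell parallel edges apart, and `J` may have some, as Θ does. So only the
-- vertices of a subdivision are kept as lists, their disjointness being contained in a permutation
-- of the repetition-free list of all vertices, and besides, each edge of `J` keeps one actual edge
-- of `G`. Contraction does not rename edges, so these stay distinct when it is undone.
--
-- Gadgets are demanded for all triples of exits, repetitions included: edges of the cut may share
-- ends, and a repeated terminal is what reduces a gadget on `R` to a path through `R`, or to a
-- matching of `R` minus one vertex. The second kind of gadget is forced by odd cycles whose three
-- arcs are all odd; this is where the triangles of `K₄ (J)` come from. One lifting argument,
-- `Contraction`, serves twice: for growing `R` within a shore, and for putting the shore back in
-- place of the contracted vertex.

module _ {A : Set} where
  open CommutativeMonoidSolver (++-commutativeMonoid {A = A}) public
    using (solve; _⊜_; _⊕_) renaming (id to ∅)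

++-cancelˡ-↭ : ∀ {A : Set} (K : List A) {L R} → K ++ L ↭ K ++ R → L ↭ R
++-cancelˡ-↭ []      p = p
++-cancelˡ-↭ (_ ∷ K) p = ++-cancelˡ-↭ K (drop-∷ p)

-- Linear algebra of multisets: from K = M and L − R = K − M follows L = R,
-- and the second hypothesis is a monoid identity.
exchange : ∀ {A : Set} {K M L R : List A} → K ↭ M → L ++ M ↭ R ++ K → L ↭ R
exchange {K = K} {M} {L} {R} K↭M L+M↭R+K =
  ++-cancelˡ-↭ M (↭-trans (++-comm M L) (↭-trans L+M↭R+K
    (↭-trans (++-comm R K) (++⁺ʳ R K↭M))))

pattern even = false
pattern odd  = true

-- Path p x y l: a walk of parity p whose vertices other than its origin x
-- are listed by l.  It is used only within lists without repetitions.
data Path {V : Set} (_∼_ : V → V → Set) : Bool → V → V → List V → Set where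
  []  : ∀ {x} → Path _∼_ even x x []
  _∷_ : ∀ {p x a y l} → x ∼ a → Path _∼_ (not p) a y l → Path _∼_ p x y (a ∷ l)

data Matched {V : Set} (_∼_ : V → V → Set) : List V → Set where
  []   : Matched _∼_ []
  pair : ∀ {a b l} → a ∼ b → Matched _∼_ l → Matched _∼_ (a ∷ b ∷ l)

-- What a conformal bi-subdivision of Θ or K₄ leaves on R when a vertex outside R,
-- adjacent to the terminals x, y and z, is removed.
data Gadget {V : Set} (_∼_ : V → V → Set) (x y z : V) (R : List V) : Set where
  claw : ∀ {q k₁ k₂ k₃ m} →
    Path _∼_ even q x k₁ → Path _∼_ even q y k₂ → Path _∼_ even q z k₃ →
    Matched _∼_ m → q ∷ k₁ ++ k₂ ++ k₃ ++ m ↭ R → Gadget _∼_ x y z R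
  triangle : ∀ {a b c k₁ k₂ k₃ s₁ s₂ s₃ m} →
    Path _∼_ even a x k₁ → Path _∼_ even b y k₂ → Path _∼_ even c z k₃ →
    Path _∼_ odd a b s₁ → Path _∼_ odd b c s₂ → Path _∼_ odd c a s₃ →
    Matched _∼_ m → k₁ ++ k₂ ++ k₃ ++ s₁ ++ s₂ ++ s₃ ++ m ↭ R →
    Gadget _∼_ x y z R

module _ {V : Set} {_∼_ : V → V → Set} where

  cast : ∀ {p q x y l} → p ≡ q → Path _∼_ p x y l → Path _∼_ q x y l
  cast refl f = f

  infixr 5 _◅◅_

  _◅◅_ : ∀ {p q x y z k l} → Path _∼_ p x y k → Path _∼_ q y z l →
         Path _∼_ (p xor q) x z (k ++ l)
  [] ◅◅ g = g
  _◅◅_ {p} {q} (e ∷ f) g =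
    e ∷ cast (sym (not-distribˡ-xor p q)) (f ◅◅ g)

  Matched-++ : ∀ {k l} → Matched _∼_ k → Matched _∼_ l → Matched _∼_ (k ++ l)
  Matched-++ []         n = n
  Matched-++ (pair e m) n = pair e (Matched-++ m n)

  -- Discarding a leg leaves its origin behind and pairs off its other vertices along the leg.
  even⇒Matched : ∀ {x y l} → Path _∼_ even x y l → Matched _∼_ l
  even⇒Matched []          = []
  even⇒Matched (_ ∷ e ∷ f) = pair e (even⇒Matched f)

  unsnoc : ∀ {p x y a l} → Path _∼_ p x y (a ∷ l) →
           ∃₂ λ b k → Path _∼_ (not p) x b k × b ∼ y × a ∷ l ≡ k ++ [ y ]
  unsnoc {even} (e ∷ f ∷ g) with unsnoc (f ∷ g)
  ... | _ , _ , h , d , eq = _ , _ , e ∷ h , d , cong (_ ∷_) eq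
  unsnoc {odd} (e ∷ [])    = _ , _ , [] , e , refl
  unsnoc {odd} (e ∷ f ∷ g) with unsnoc (f ∷ g)
  ... | _ , _ , h , d , eq = _ , _ , e ∷ h , d , cong (_ ∷_) eq

  -- For dropping a side between two corners, or an arc between two terminals: both ends stay, and
  -- the inner vertices, even in number, pair off.
  odd⇒Matched : ∀ {x y l} → Path _∼_ odd x y l → ∃ λ i → Matched _∼_ i × l ↭ y ∷ i
  odd⇒Matched {y = y} f@(_ ∷ _) with unsnoc f
  ... | _ , k , h , _ , eq rewrite eq = k , even⇒Matched h , ++-comm k [ y ]

  split : ∀ {p x y w l} → Path _∼_ p x y l → w ∈ x ∷ l →
          ∃ λ q → ∃₂ λ j k → Path _∼_ q x w j × Path _∼_ (q xor p) w y k × l ≡ j ++ k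
  split f (here refl) = even , _ , _ , [] , f , refl
  split {p} (e ∷ f) (there w∈) with split f w∈
  ... | q , _ , _ , g , h , eq =
    not q , _ , _ , e ∷ cast (sym (not-involutive q)) g ,
    cast (xor-not q p) h , cong (_ ∷_) eq
    where
    xor-not : ∀ q p → q xor not p ≡ not q xor p
    xor-not even p = refl
    xor-not odd  p = not-involutive p

  module _ (∼-sym : Symmetric _∼_) where

    reverse : ∀ {p x y l} → Path _∼_ p x y l →
              ∃ λ k → Path _∼_ p y x k × x ∷ l ↭ y ∷ k
    reverse [] = _ , [] , ↭-refl
    reverse {p} {x} {y} (_∷_ {a = a} {l = l} e f) with reverse f
    ... | k , g , eq =
      k ++ [ x ] , cast (xor-odd p) (g ◅◅ ∼-sym e ∷ []) ,
      exchange eq (solve 5 (λ x a l y k → (x ⊕ a ⊕ l) ⊕ (y ⊕ k) ⊜ (y ⊕ k ⊕ x) ⊕ (a ⊕ l))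
        ↭-refl [ x ] [ a ] l [ y ] k)
      where
      xor-odd : ∀ p → not p xor odd ≡ p
      xor-odd even = refl
      xor-odd odd  = refl

-- The origin `x` is left out because a span continues a leg that ends at `x`.
Span : {V : Set} (_∼_ : V → V → Set) → Bool → V → V → List V → Set
Span _∼_ p x y R = ∃₂ λ k m → Path _∼_ p x y k × Matched _∼_ m × k ++ m ↭ R

-- Unlike in `Span`, `x` is counted: this takes the place of a contracted vertex that lies inside a
-- path.
Through : {V : Set} (_∼_ : V → V → Set) → V → V → List V → Set
Through _∼_ x y R = ∃₂ λ k m → Path _∼_ even x y k × Matched _∼_ m × x ∷ k ++ m ↭ R

module _ {V : Set} {_∼_ : V → V → Set} where

  rotate : ∀ {x y z R} → Gadget _∼_ x y z R → Gadget _∼_ y z x R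
  rotate (claw {q} {k₁} {k₂} {k₃} {m} f₁ f₂ f₃ n eq) = claw f₂ f₃ f₁ n
    (↭-trans (solve 5 (λ q a b c m → q ⊕ b ⊕ c ⊕ a ⊕ m ⊜ q ⊕ a ⊕ b ⊕ c ⊕ m)
      ↭-refl [ q ] k₁ k₂ k₃ m) eq)
  rotate (triangle {k₁ = k₁} {k₂} {k₃} {s₁} {s₂} {s₃} {m} f₁ f₂ f₃ g₁ g₂ g₃ n eq) =
    triangle f₂ f₃ f₁ g₂ g₃ g₁ n
      (↭-trans (solve 7 (λ a b c s t u m → b ⊕ c ⊕ a ⊕ t ⊕ u ⊕ s ⊕ m ⊜ a ⊕ b ⊕ c ⊕ s ⊕ t ⊕ u ⊕ m)
        ↭-refl k₁ k₂ k₃ s₁ s₂ s₃ m) eq)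

  resp : ∀ {x y z R S} → R ↭ S → Gadget _∼_ x y z R → Gadget _∼_ x y z S
  resp eq (claw f₁ f₂ f₃ n h)              = claw f₁ f₂ f₃ n (↭-trans h eq)
  resp eq (triangle f₁ f₂ f₃ g₁ g₂ g₃ n h) = triangle f₁ f₂ f₃ g₁ g₂ g₃ n (↭-trans h eq)

  Through⇒Matched : ∀ {x y R} → Through _∼_ x y R → ∃ λ m → Matched _∼_ m × x ∷ m ↭ R
  Through⇒Matched (k , m , f , n , eq) = k ++ m , Matched-++ (even⇒Matched f) n , eq

  extend : ∀ {x y z w R K} → Gadget _∼_ x y z R → Span _∼_ even z w K → Gadget _∼_ x y w (R ++ K)
  extend {R = R} {K} (claw {q} {k₁} {k₂} {k₃} {m} f₁ f₂ f₃ n eq) (k , m′ , f , n′ , eq′) =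
    claw f₁ f₂ (f₃ ◅◅ f) (Matched-++ n n′) (exchange (++⁺ eq eq′)
      (solve 9 (λ q a b c m k m′ R K →
          (q ⊕ a ⊕ b ⊕ (c ⊕ k) ⊕ (m ⊕ m′)) ⊕ (R ⊕ K)
        ⊜ (R ⊕ K) ⊕ ((q ⊕ a ⊕ b ⊕ c ⊕ m) ⊕ (k ⊕ m′)))
        ↭-refl [ q ] k₁ k₂ k₃ m k m′ R K))
  extend {R = R} {K} (triangle {k₁ = k₁} {k₂} {k₃} {s₁} {s₂} {s₃} {m} f₁ f₂ f₃ g₁ g₂ g₃ n eq)
    (k , m′ , f , n′ , eq′) =
    triangle f₁ f₂ (f₃ ◅◅ f) g₁ g₂ g₃ (Matched-++ n n′) (exchange (++⁺ eq eq′)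
      (solve 11 (λ a b c s t u m k m′ R K →
          (a ⊕ b ⊕ (c ⊕ k) ⊕ s ⊕ t ⊕ u ⊕ (m ⊕ m′)) ⊕ (R ⊕ K)
        ⊜ (R ⊕ K) ⊕ ((a ⊕ b ⊕ c ⊕ s ⊕ t ⊕ u ⊕ m) ⊕ (k ⊕ m′)))
        ↭-refl k₁ k₂ k₃ s₁ s₂ s₃ m k m′ R K))

module _ {V : Set} {_∼_ : V → V → Set} (∼-sym : Symmetric _∼_) where

  -- In a triangle the path goes the long way round, through the corner of `z`: two odd sides keep
  -- it even, and the inner vertices of the third side are matched.
  Gadget⇒Through : ∀ {x y z R} → Gadget _∼_ x y z R → Through _∼_ x y R
  Gadget⇒Through {x} {R = R} (claw {q} {k₁} {k₂} {k₃} {m} f₁ f₂ f₃ n eq) with reverse ∼-sym f₁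
  ... | j , g , rev = j ++ k₂ , k₃ ++ m , g ◅◅ f₂ , Matched-++ (even⇒Matched f₃) n ,
    exchange (++⁺ (↭-sym rev) eq) (solve 8 (λ x q j a b c m R →
        (x ⊕ (j ⊕ b) ⊕ c ⊕ m) ⊕ ((q ⊕ a) ⊕ R) ⊜ R ⊕ ((x ⊕ j) ⊕ (q ⊕ a ⊕ b ⊕ c ⊕ m)))
        ↭-refl [ x ] [ q ] j k₁ k₂ k₃ m R)
  Gadget⇒Through {x} {R = R}
    (triangle {a} {b} {c} {k₁} {k₂} {k₃} {s₁} {s₂} {s₃} {m} f₁ f₂ f₃ g₁ g₂ g₃ n eq)
    with reverse ∼-sym f₁ | reverse ∼-sym g₃ | reverse ∼-sym g₂ | odd⇒Matched g₁
  ... | j , h , rev | t₃ , h₃ , rev₃ | t₂ , h₂ , rev₂ | i , n′ , eq′ =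
    j ++ t₃ ++ t₂ ++ k₂ , k₃ ++ i ++ m ,
    h ◅◅ h₃ ◅◅ h₂ ◅◅ f₂ , Matched-++ (even⇒Matched f₃) (Matched-++ n′ n) ,
    exchange (++⁺ (++⁺ (++⁺ (↭-sym rev) (↭-sym rev₃)) (++⁺ (↭-sym rev₂) (↭-sym eq′))) eq)
      (solve 16 (λ x a b c j t₃ t₂ k₁ k₂ k₃ s₁ s₂ s₃ i m R →
          (x ⊕ (j ⊕ t₃ ⊕ t₂ ⊕ k₂) ⊕ k₃ ⊕ i ⊕ m)
            ⊕ ((((a ⊕ k₁) ⊕ (c ⊕ s₃)) ⊕ ((b ⊕ s₂) ⊕ s₁)) ⊕ R)
        ⊜ R ⊕ ((((x ⊕ j) ⊕ (a ⊕ t₃)) ⊕ ((c ⊕ t₂) ⊕ (b ⊕ i)))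
            ⊕ (k₁ ⊕ k₂ ⊕ k₃ ⊕ s₁ ⊕ s₂ ⊕ s₃ ⊕ m)))
        ↭-refl [ x ] [ a ] [ b ] [ c ] j t₃ t₂ k₁ k₂ k₃ s₁ s₂ s₃ i m R)

  Through-sym : ∀ {x y R} → Through _∼_ x y R → Through _∼_ y x R
  Through-sym {x} {y} {R} (k , m , f , n , eq) with reverse ∼-sym f
  ... | j , g , rev = j , m , g , n , exchange (++⁺ (↭-sym rev) eq)
    (solve 6 (λ x y k j m R → (y ⊕ j ⊕ m) ⊕ ((x ⊕ k) ⊕ R) ⊜ R ⊕ ((y ⊕ j) ⊕ (x ⊕ k ⊕ m)))
      ↭-refl [ x ] [ y ] k j m R)

  -- The three arcs of an odd cycle: either all are odd, or exactly one is, and then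
  -- it is dropped and the terminal opposite to it becomes the centre of a claw.
  arcs⇒Gadget : ∀ {x y z k i j} p q → Path _∼_ p x y k → Path _∼_ q y z i →
                Path _∼_ (q xor (p xor odd)) z x j → Gadget _∼_ x y z (k ++ i ++ j)
  arcs⇒Gadget {x} {y} {z} {k} {i} {j} even even f g h with reverse ∼-sym f | odd⇒Matched h
  ... | k′ , f′ , rev | j′ , n , eq = claw f′ [] g n
    (exchange (++⁺ (↭-sym rev) (↭-sym eq)) (solve 7 (λ x y k i j k′ j′ →
        (y ⊕ k′ ⊕ i ⊕ j′) ⊕ ((x ⊕ k) ⊕ j) ⊜ (k ⊕ i ⊕ j) ⊕ ((y ⊕ k′) ⊕ (x ⊕ j′)))
        ↭-refl [ x ] [ y ] k i j k′ j′))
  arcs⇒Gadget {x} {y} {z} {k} {i} {j} even odd f g h with reverse ∼-sym h | odd⇒Matched g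
  ... | j′ , h′ , rev | i′ , n , eq = claw [] f h′ n
    (exchange (++⁺ (↭-sym rev) (↭-sym eq)) (solve 7 (λ x z k i j j′ i′ →
        (x ⊕ k ⊕ j′ ⊕ i′) ⊕ ((z ⊕ j) ⊕ i) ⊜ (k ⊕ i ⊕ j) ⊕ ((x ⊕ j′) ⊕ (z ⊕ i′)))
        ↭-refl [ x ] [ z ] k i j j′ i′))
  arcs⇒Gadget {x} {y} {z} {k} {i} {j} odd even f g h with reverse ∼-sym g | odd⇒Matched f
  ... | i′ , g′ , rev | k′ , n , eq = claw h g′ [] n
    (exchange (++⁺ (↭-sym rev) (↭-sym eq)) (solve 7 (λ y z k i j i′ k′ →
        (z ⊕ j ⊕ i′ ⊕ k′) ⊕ ((y ⊕ i) ⊕ k) ⊜ (k ⊕ i ⊕ j) ⊕ ((z ⊕ i′) ⊕ (y ⊕ k′)))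
        ↭-refl [ y ] [ z ] k i j i′ k′))
  arcs⇒Gadget {k = k} {i} {j} odd odd f g h = triangle [] [] [] f g h []
    (solve 3 (λ k i j → k ⊕ i ⊕ j ⊕ ∅ ⊜ k ⊕ i ⊕ j) ↭-refl k i j)

  -- Opened at `x`, the cycle is cut by `y` and `z` into three arcs, whose parities add up to odd,
  -- as `arcs⇒Gadget` requires.
  oddCycle⇒Gadget : ∀ {w x y z l} → Path _∼_ odd w w l → x ∈ l → y ∈ l → z ∈ l → Gadget _∼_ x y z l
  oddCycle⇒Gadget {w} {x} {y} {z} cycle x∈ y∈ z∈ with split cycle (there x∈)
  ... | p , l₁ , l₂ , f , g , refl with split (x→x p f g) (there (∈-resp-↭ (++-comm l₁ l₂) y∈))
    where
    x→x : ∀ p → Path _∼_ p w x l₁ → Path _∼_ (p xor odd) x w l₂ → Path _∼_ odd x x (l₂ ++ l₁)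
    x→x even f g = g ◅◅ f
    x→x odd  f g = g ◅◅ f
  ... | q , k₁ , k₂ , g₁ , g₂ , eq
    with ∈-++⁻ k₁ (subst (z ∈_) eq (∈-resp-↭ (++-comm l₁ l₂) z∈))
  ... | inj₂ z∈k₂ with split g₂ (there z∈k₂)
  ...   | r , i , j , h₁ , h₂ , refl =
    resp (↭-trans (↭-reflexive (sym eq)) (++-comm l₂ l₁)) (arcs⇒Gadget q r g₁ h₁ h₂)
  -- Here `z` comes before `y`; going round backwards from `x` meets `y` first.
  oddCycle⇒Gadget {w} {x} {y} {z} cycle x∈ y∈ z∈
      | p , l₁ , l₂ , f , g , refl | q , k₁ , k₂ , g₁ , g₂ , eq | inj₁ z∈k₁
    with reverse ∼-sym g₁ | reverse ∼-sym g₂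
  ... | k₁′ , g₁′ , rev₁ | k₂′ , g₂′ , rev₂ with split g₁′ (∈-resp-↭ rev₁ (there z∈k₁))
  ...   | r , i , j , h₁ , h₂ , refl =
    resp (exchange (++⁺ (++⁺ (↭-sym rev₁) (↭-sym rev₂)) (↭-reflexive (sym eq)))
      (solve 8 (λ x y k₁ k₂ k₂′ k₁′ l₁ l₂ →
           (k₂′ ⊕ k₁′) ⊕ (((x ⊕ k₁) ⊕ (y ⊕ k₂)) ⊕ (l₂ ⊕ l₁))
         ⊜ (l₁ ⊕ l₂) ⊕ (((y ⊕ k₁′) ⊕ (x ⊕ k₂′)) ⊕ (k₁ ⊕ k₂)))
         ↭-refl [ x ] [ y ] k₁ k₂ k₂′ (i ++ j) l₁ l₂))
      (arcs⇒Gadget (q xor odd) r g₂′ h₁ (cast (cong (r xor_) (flip² q)) h₂))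
    where
    flip² : ∀ q → q ≡ (q xor odd) xor odd
    flip² even = refl
    flip² odd  = refl

  -- A triangle blown up at the corner where another triangle sits contains a
  -- claw centred at the corner of the inner triangle that looks outwards.
  nested : ∀ {a₁ b₁ x₁ a₂ x₂ b₃ x₃ a b c k₁ k₂ k₃ s₁ s₂ s₃ m R₂ R₃} →
    Path _∼_ even a a₁ k₁ → Path _∼_ even b b₁ k₂ → Path _∼_ even c x₁ k₃ →
    Path _∼_ odd a b s₁ → Path _∼_ odd b c s₂ → Path _∼_ odd c a s₃ → Matched _∼_ m →
    b₁ ∼ a₂ → b₃ ∼ a₁ → Through _∼_ a₂ x₂ R₂ → Through _∼_ b₃ x₃ R₃ →
    Gadget _∼_ x₁ x₂ x₃ ((k₁ ++ k₂ ++ k₃ ++ s₁ ++ s₂ ++ s₃ ++ m) ++ R₂ ++ R₃)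
  nested {a₂ = a₂} {b₃ = b₃} {a = a} {b} {c} {k₁} {k₂} {k₃} {s₁} {s₂} {s₃} {m} {R₂} {R₃}
    f₁ f₂ f₃ g₁ g₂ g₃ n d₁₂ d₃₁ (j₂ , m₂ , h₂ , n₂ , eq₂) (j₃ , m₃ , h₃ , n₃ , eq₃)
    with reverse ∼-sym g₂ | odd⇒Matched g₁
  ... | t , g₂′ , rev | i , n′ , eq =
    claw f₃ (g₂′ ◅◅ f₂ ◅◅ (d₁₂ ∷ h₂)) (g₃ ◅◅ f₁ ◅◅ (∼-sym d₃₁ ∷ h₃))
      (Matched-++ n′ (Matched-++ n (Matched-++ n₂ n₃)))
      (exchange (++⁺ (++⁺ (↭-sym rev) (↭-sym eq)) (++⁺ eq₂ eq₃))
        (solve 19 (λ a₂ b₃ b c k₁ k₂ k₃ s₁ s₂ s₃ m R₂ R₃ j₂ m₂ j₃ m₃ t i →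
            (c ⊕ k₃ ⊕ (t ⊕ k₂ ⊕ a₂ ⊕ j₂) ⊕ (s₃ ⊕ k₁ ⊕ b₃ ⊕ j₃) ⊕ (i ⊕ m ⊕ m₂ ⊕ m₃))
              ⊕ (((b ⊕ s₂) ⊕ s₁) ⊕ (R₂ ⊕ R₃))
          ⊜ ((k₁ ⊕ k₂ ⊕ k₃ ⊕ s₁ ⊕ s₂ ⊕ s₃ ⊕ m) ⊕ R₂ ⊕ R₃)
              ⊕ (((c ⊕ t) ⊕ (b ⊕ i)) ⊕ ((a₂ ⊕ j₂ ⊕ m₂) ⊕ (b₃ ⊕ j₃ ⊕ m₃))))
          ↭-refl [ a₂ ] [ b₃ ] [ b ] [ c ] k₁ k₂ k₃ s₁ s₂ s₃ m R₂ R₃ j₂ m₂ j₃ m₃ t i))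

  -- Three claws make a triangle with their centres as corners. As soon as one gadget is a triangle,
  -- `nested` finds a claw centred inside it and asks only for paths through the other two.
  ring : ∀ {a₁ b₁ x₁ R₁ a₂ b₂ x₂ R₂ a₃ b₃ x₃ R₃} →
    Gadget _∼_ a₁ b₁ x₁ R₁ → Gadget _∼_ a₂ b₂ x₂ R₂ → Gadget _∼_ a₃ b₃ x₃ R₃ →
    b₁ ∼ a₂ → b₂ ∼ a₃ → b₃ ∼ a₁ → Gadget _∼_ x₁ x₂ x₃ (R₁ ++ R₂ ++ R₃)
  ring {R₂ = R₂} {R₃ = R₃} (triangle f₁ f₂ f₃ g₁ g₂ g₃ n eq) C₂ C₃ d₁₂ d₂₃ d₃₁ =
    resp (++⁺ʳ (R₂ ++ R₃) eq) (nested f₁ f₂ f₃ g₁ g₂ g₃ n d₁₂ d₃₁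
      (Through-sym (Gadget⇒Through (rotate (rotate C₂)))) (Gadget⇒Through (rotate C₃)))
  ring {R₁ = R₁} {R₂ = R₂} {R₃ = R₃} C₁@(claw _ _ _ _ _) (triangle f₁ f₂ f₃ g₁ g₂ g₃ n eq) C₃ d₁₂ d₂₃ d₃₁ =
    rotate (rotate (resp
      (↭-trans (++⁺ʳ (R₃ ++ R₁) eq) (solve 3 (λ a b c → b ⊕ c ⊕ a ⊜ a ⊕ b ⊕ c) ↭-refl R₁ R₂ R₃))
      (nested f₁ f₂ f₃ g₁ g₂ g₃ n d₂₃ d₁₂
        (Through-sym (Gadget⇒Through (rotate (rotate C₃)))) (Gadget⇒Through (rotate C₁)))))
  ring {R₁ = R₁} {R₂ = R₂} {R₃ = R₃} C₁@(claw _ _ _ _ _) C₂@(claw _ _ _ _ _)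
    (triangle f₁ f₂ f₃ g₁ g₂ g₃ n eq) d₁₂ d₂₃ d₃₁ =
    rotate (resp
      (↭-trans (++⁺ʳ (R₁ ++ R₂) eq) (solve 3 (λ a b c → c ⊕ a ⊕ b ⊜ a ⊕ b ⊕ c) ↭-refl R₁ R₂ R₃))
      (nested f₁ f₂ f₃ g₁ g₂ g₃ n d₃₁ d₂₃
        (Through-sym (Gadget⇒Through (rotate (rotate C₁)))) (Gadget⇒Through (rotate C₂))))
  ring {a₁} {b₁} {R₁ = R₁} {a₂} {b₂} {R₂ = R₂} {a₃} {b₃} {R₃ = R₃}
    (claw {q₁} {A₁} {B₁} {X₁} {m₁} f₁ g₁ h₁ n₁ eq₁)
    (claw {q₂} {A₂} {B₂} {X₂} {m₂} f₂ g₂ h₂ n₂ eq₂)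
    (claw {q₃} {A₃} {B₃} {X₃} {m₃} f₃ g₃ h₃ n₃ eq₃) d₁₂ d₂₃ d₃₁
    with reverse ∼-sym f₁ | reverse ∼-sym f₂ | reverse ∼-sym f₃
  ... | A₁′ , f₁′ , rev₁ | A₂′ , f₂′ , rev₂ | A₃′ , f₃′ , rev₃ =
    triangle h₁ h₂ h₃ (g₁ ◅◅ (d₁₂ ∷ f₂′)) (g₂ ◅◅ (d₂₃ ∷ f₃′)) (g₃ ◅◅ (d₃₁ ∷ f₁′))
      (Matched-++ n₁ (Matched-++ n₂ n₃))
      (↭-trans
        (solve 12 (λ a₁ a₂ a₃ B₁ B₂ B₃ X₁ X₂ X₃ m₁ m₂ m₃ →
            X₁ ⊕ X₂ ⊕ X₃ ⊕ (B₁ ⊕ a₂) ⊕ (B₂ ⊕ a₃) ⊕ (B₃ ⊕ a₁) ⊕ (m₁ ⊕ m₂ ⊕ m₃)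
          ⊜ (a₁ ⊕ B₁ ⊕ X₁ ⊕ m₁) ⊕ (a₂ ⊕ B₂ ⊕ X₂ ⊕ m₂) ⊕ (a₃ ⊕ B₃ ⊕ X₃ ⊕ m₃))
          ↭-refl (a₁ ∷ A₁′) (a₂ ∷ A₂′) (a₃ ∷ A₃′) B₁ B₂ B₃ X₁ X₂ X₃ m₁ m₂ m₃)
        (++⁺ (↭-trans (++⁺ʳ (B₁ ++ X₁ ++ m₁) (↭-sym rev₁)) eq₁)
          (++⁺ (↭-trans (++⁺ʳ (B₂ ++ X₂ ++ m₂) (↭-sym rev₂)) eq₂)
               (↭-trans (++⁺ʳ (B₃ ++ X₃ ++ m₃) (↭-sym rev₃)) eq₃))))

-- Contractions

concatMap-↭ : ∀ {A B : Set} (f : A → List B) {xs ys} → xs ↭ ys → concatMap f xs ↭ concatMap f ys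
concatMap-↭ f Perm.refl          = ↭-refl
concatMap-↭ f (prep x p)         = ++⁺ˡ (f x) (concatMap-↭ f p)
concatMap-↭ f (swap x y p)       = ↭-trans (shifts (f x) (f y)) (++⁺ˡ (f y) (++⁺ˡ (f x) (concatMap-↭ f p)))
concatMap-↭ f (Perm.trans p₁ p₂) = ↭-trans (concatMap-↭ f p₁) (concatMap-↭ f p₂)

module _ {V : Set} {_∼_ : V → V → Set} where

  extend₃ : ∀ {x y z x′ y′ z′ R K₁ K₂ K₃} → Gadget _∼_ x y z R →
    Span _∼_ even x x′ K₁ → Span _∼_ even y y′ K₂ → Span _∼_ even z z′ K₃ →
    Gadget _∼_ x′ y′ z′ (R ++ K₁ ++ K₂ ++ K₃)
  extend₃ {R = R} {K₁} {K₂} {K₃} g f₁ f₂ f₃ = resp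
    (solve 4 (λ R a b c → ((R ⊕ c) ⊕ a) ⊕ b ⊜ R ⊕ a ⊕ b ⊕ c) ↭-refl R K₁ K₂ K₃)
    (rotate (extend (rotate (extend (rotate (extend g f₃)) f₁)) f₂))

  trivialSpan : ∀ {x} → Span _∼_ even x x []
  trivialSpan = [] , [] , [] , [] , ↭-refl

  addMatched : ∀ {x y z R m} → Gadget _∼_ x y z R → Matched _∼_ m → Gadget _∼_ x y z (R ++ m)
  addMatched g n = extend g ([] , _ , [] , n , ↭-refl)

-- W is a quotient of V: the class w has the vertices fibre w, and edges leaving the
-- class may use only those satisfying U w.
module Contraction {V W : Set} {_∼_ : V → V → Set} (∼-sym : Symmetric _∼_)
  (fibre : W → List V) (U : W → V → Set)
  (good : ∀ w {x y z} → U w x → U w y → U w z → Gadget _∼_ x y z (fibre w)) where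

  record _≈_ (a b : W) : Set where
    constructor via
    field
      {exit₁ exit₂} : V
      usable₁ : U a exit₁
      usable₂ : U b exit₂
      edge    : exit₁ ∼ exit₂

  ≈-sym : Symmetric _≈_
  ≈-sym (via u v e) = via v u (∼-sym e)

  expand : List W → List V
  expand = concatMap fibre

  through : ∀ w {x y} → U w x → U w y → Through _∼_ x y (fibre w)
  through w u v = Gadget⇒Through ∼-sym (good w u v v)

  -- The exit from `a` is determined by the path and so is part of the result, while the exit `y` at
  -- the far end can be prescribed. The class of `a` itself is left to the gadget placed there.
  liftPath : ∀ {p a b l y} → Path _≈_ p a b l → U b y →
             ∃ λ x → U a x × Span _∼_ p x y (expand l)
  liftPath [] u = _ , u , trivialSpan
  liftPath {l = a ∷ l} (via {x} {x₁} u u₁ e ∷ f) v with liftPath f v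
  ... | x₂ , u₂ , k , m , g , n , eq with through a u₁ u₂
  ...   | k′ , m′ , g′ , n′ , eq′ = x , u , x₁ ∷ k′ ++ k , m′ ++ m , e ∷ (g′ ◅◅ g) , Matched-++ n′ n ,
    ↭-trans (solve 5 (λ x₁ k′ k m′ m → (x₁ ⊕ k′ ⊕ k) ⊕ m′ ⊕ m ⊜ (x₁ ⊕ k′ ⊕ m′) ⊕ k ⊕ m)
      ↭-refl [ x₁ ] k′ k m′ m) (++⁺ eq′ eq)

  liftMatched : ∀ {l} → Matched _≈_ l → ∃ λ m → Matched _∼_ m × m ↭ expand l
  liftMatched [] = [] , [] , ↭-refl
  liftMatched {a ∷ b ∷ l} (pair (via {x} {y} u v e) n)
    -- With both terminals at the exit, all of the class but the exit is matched within it.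
    with liftMatched n | Through⇒Matched (through a u u) | Through⇒Matched (through b v v)
  ... | m , h , eq | m₁ , h₁ , eq₁ | m₂ , h₂ , eq₂ =
    x ∷ y ∷ m₁ ++ m₂ ++ m , pair e (Matched-++ h₁ (Matched-++ h₂ h)) ,
    ↭-trans (solve 5 (λ x y m₁ m₂ m → x ⊕ y ⊕ m₁ ⊕ m₂ ⊕ m ⊜ (x ⊕ m₁) ⊕ (y ⊕ m₂) ⊕ m)
      ↭-refl [ x ] [ y ] m₁ m₂ m) (++⁺ eq₁ (++⁺ eq₂ eq))

  expand-++ : ∀ k l → expand (k ++ l) ↭ expand k ++ expand l
  expand-++ k l = ↭-reflexive (concatMap-++ fibre k l)

  expand-++₄ : ∀ k₁ k₂ k₃ l → expand (k₁ ++ k₂ ++ k₃ ++ l) ↭ expand k₁ ++ expand k₂ ++ expand k₃ ++ expand l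
  expand-++₄ k₁ k₂ k₃ l = ↭-trans (expand-++ k₁ _) (++⁺ˡ (expand k₁)
    (↭-trans (expand-++ k₂ _) (++⁺ˡ (expand k₂) (expand-++ k₃ l))))

  -- The side is lifted only up to the edge entering the class of `b`, where `ring` places a gadget
  -- of its own. Without that edge its length is even, so the lift can prolong a leg of the gadget
  -- at `a`.
  liftSide : ∀ {a b s} → Path _≈_ odd a b s →
    ∃ λ K → expand s ↭ K ++ fibre b ×
    ∃₂ λ x y → ∃ λ z → U a x × Span _∼_ even x y K × y ∼ z × U b z
  liftSide {b = b} {s = _ ∷ _} f with unsnoc f
  ... | c , k , g , via {y} {z} v w d , eq with liftPath g v
  ...   | x , u , h = expand k ,
    ↭-trans (↭-reflexive (cong expand eq)) (↭-trans (expand-++ k [ b ])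
      (↭-reflexive (cong (expand k ++_) (++-identityʳ (fibre b))))) ,
    x , y , z , u , h , d , w

  -- A branch vertex becomes the gadget on its class, prolonged along the lifted legs. For a
  -- triangle, `ring` then joins the three gadgets into one of the two allowed shapes.
  liftGadget : ∀ {a b c l x y z} → Gadget _≈_ a b c l → U a x → U b y → U c z →
               Gadget _∼_ x y z (expand l)
  liftGadget (claw {q} {k₁} {k₂} {k₃} {m} f₁ f₂ f₃ n eq) u v w
    with liftPath f₁ u | liftPath f₂ v | liftPath f₃ w | liftMatched n
  ... | _ , u′ , h₁ | _ , v′ , h₂ | _ , w′ , h₃ | m′ , n′ , eq′ = resp
    (↭-trans (exchange (++⁺ eq′ (↭-sym (expand-++₄ k₁ k₂ k₃ m)))
      (solve 7 (λ Q a b c m M L →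
          ((Q ⊕ a ⊕ b ⊕ c) ⊕ m) ⊕ (M ⊕ L) ⊜ (Q ⊕ L) ⊕ (m ⊕ (a ⊕ b ⊕ c ⊕ M)))
        ↭-refl (fibre q) (expand k₁) (expand k₂) (expand k₃) m′ (expand m)
          (expand (k₁ ++ k₂ ++ k₃ ++ m))))
      (concatMap-↭ fibre eq))
    (addMatched (extend₃ (good q u′ v′ w′) h₁ h₂ h₃) n′)
  liftGadget (triangle {a} {b} {c} {k₁} {k₂} {k₃} {s₁} {s₂} {s₃} {m} f₁ f₂ f₃ g₁ g₂ g₃ n eq) u v w
    with liftPath f₁ u | liftPath f₂ v | liftPath f₃ w | liftSide g₁ | liftSide g₂ | liftSide g₃ | liftMatched n
  ... | _ , u₁ , h₁ | _ , u₂ , h₂ | _ , u₃ , h₃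
      | S₁ , eq₁ , _ , _ , _ , v₁ , h₁′ , d₁ , w₂
      | S₂ , eq₂ , _ , _ , _ , v₂ , h₂′ , d₂ , w₃
      | S₃ , eq₃ , _ , _ , _ , v₃ , h₃′ , d₃ , w₁
      | m′ , n′ , eq′ = resp
    (↭-trans (exchange
      (++⁺ (++⁺ (++⁺ (↭-sym eq₁) (↭-sym eq₂)) (++⁺ (↭-sym eq₃) eq′))
        (++⁺ (↭-sym (expand-++₄ k₁ k₂ k₃ _)) (↭-sym (expand-++₄ s₁ s₂ s₃ m))))
      (solve 16 (λ A B C a b c S₁ S₂ S₃ m s₁ s₂ s₃ M L′ L →
          (((A ⊕ ∅ ⊕ S₁ ⊕ a) ⊕ (B ⊕ ∅ ⊕ S₂ ⊕ b) ⊕ (C ⊕ ∅ ⊕ S₃ ⊕ c)) ⊕ m)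
            ⊕ (((s₁ ⊕ s₂) ⊕ (s₃ ⊕ M)) ⊕ (L ⊕ L′))
        ⊜ L ⊕ ((((S₁ ⊕ B) ⊕ (S₂ ⊕ C)) ⊕ ((S₃ ⊕ A) ⊕ m)) ⊕ ((a ⊕ b ⊕ c ⊕ L′) ⊕ (s₁ ⊕ s₂ ⊕ s₃ ⊕ M))))
        ↭-refl (fibre a) (fibre b) (fibre c) (expand k₁) (expand k₂) (expand k₃) S₁ S₂ S₃ m′
          (expand s₁) (expand s₂) (expand s₃) (expand m) (expand (s₁ ++ s₂ ++ s₃ ++ m))
          (expand (k₁ ++ k₂ ++ k₃ ++ s₁ ++ s₂ ++ s₃ ++ m))))
      (concatMap-↭ fibre eq))
    -- At each corner the terminals are, in this order, the entry from the preceding side, the exit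
    -- to the next side and the exit to the leg.
    (addMatched (ring ∼-sym
      (extend₃ (good a w₁ v₁ u₁) trivialSpan h₁′ h₁)
      (extend₃ (good b w₂ v₂ u₂) trivialSpan h₂′ h₂)
      (extend₃ (good c w₃ v₃ u₃) trivialSpan h₃′ h₃) d₁ d₂ d₃) n′)

-- Lists without repetitions

∈-∃↭ : ∀ {A : Set} {x : A} {xs} → x ∈ xs → ∃ λ ys → xs ↭ x ∷ ys
∈-∃↭ x∈ with ∈-∃++ x∈
... | as , bs , refl = as ++ bs , shift _ as bs

Unique-resp-↭ : ∀ {A : Set} {xs ys : List A} → xs ↭ ys → Unique xs → Unique ys
Unique-resp-↭ {A} p = PermSetoid.Unique-resp-↭ (setoid A) (↭⇒↭ₛ p)

Unique⇒lookup-injective : ∀ {A : Set} {xs : List A} → Unique xs → ∀ i j → lookup xs i ≡ lookup xs j → i ≡ j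
Unique⇒lookup-injective (h ∷ u) zero    zero    eq = refl
Unique⇒lookup-injective (h ∷ u) zero    (suc j) eq = contradiction eq (All.lookup h (∈-lookup j))
Unique⇒lookup-injective (h ∷ u) (suc i) zero    eq = contradiction (sym eq) (All.lookup h (∈-lookup i))
Unique⇒lookup-injective (h ∷ u) (suc i) (suc j) eq = cong suc (Unique⇒lookup-injective u i j eq)

Unique-head : ∀ {A : Set} {x : A} {xs} → Unique (x ∷ xs) → x ∉ xs
Unique-head (h ∷ _) x∈ = All.lookup h x∈ refl

Unique-tail : ∀ {A : Set} {x : A} {xs} → Unique (x ∷ xs) → Unique xs
Unique-tail (_ ∷ u) = u

Unique-∷ : ∀ {A : Set} {x : A} {xs} → x ∉ xs → Unique xs → Unique (x ∷ xs)
Unique-∷ x∉ u = All.¬Any⇒All¬ _ x∉ ∷ u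

Unique-++ʳ : ∀ {A : Set} (xs : List A) {ys} → Unique (xs ++ ys) → Unique ys
Unique-++ʳ []       u       = u
Unique-++ʳ (_ ∷ xs) (_ ∷ u) = Unique-++ʳ xs u

Unique-++ˡ : ∀ {A : Set} (xs : List A) {ys} → Unique (xs ++ ys) → Unique xs
Unique-++ˡ []       u       = []
Unique-++ˡ (_ ∷ xs) (h ∷ u) = All.++⁻ˡ xs h ∷ Unique-++ˡ xs u

Unique-disjoint : ∀ {A : Set} (xs : List A) {ys x} → Unique (xs ++ ys) → x ∈ xs → x ∉ ys
Unique-disjoint (_ ∷ xs) (h ∷ _) (here refl) x∈ys = All.lookup (All.++⁻ʳ xs h) x∈ys refl
Unique-disjoint (_ ∷ xs) (_ ∷ u) (there x∈)  x∈ys = Unique-disjoint xs u x∈ x∈ys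

⊆⇒∃↭ : ∀ {A : Set} {xs ys : List A} → Unique xs → (∀ {x} → x ∈ xs → x ∈ ys) → ∃ λ zs → ys ↭ xs ++ zs
⊆⇒∃↭ {xs = []}     {ys} u s = ys , ↭-refl
⊆⇒∃↭ {xs = x ∷ xs} {ys} u s with ∈-∃↭ (s (here refl))
... | ys′ , eq with ⊆⇒∃↭ {ys = ys′} (Unique-tail u) xs⊆
  where
  xs⊆ : ∀ {y} → y ∈ xs → y ∈ ys′
  xs⊆ y∈ with ∈-resp-↭ eq (s (there y∈))
  ... | here refl = contradiction y∈ (Unique-head u)
  ... | there y∈′ = y∈′
... | zs , eq′ = zs , ↭-trans eq (prep x eq′)

Unique⇒length≤ : ∀ {A : Set} {n} → A ↔ Fin n → ∀ {xs : List A} → Unique xs → length xs ≤ n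
Unique⇒length≤ f u = injective⇒≤ λ {i} {j} eq →
  Unique⇒lookup-injective u i j (trans (sym (Inverse.strictlyInverseʳ f _))
    (trans (cong (Inverse.from f) eq) (Inverse.strictlyInverseʳ f _)))

module _ {V : Set} {_∼_ : V → V → Set} (f : V → V) where

  matchPairs : ∀ O → Unique O → (∀ {w} → w ∈ O → f w ∈ O × f (f w) ≡ w × f w ≢ w × w ∼ f w) →
               ∃ λ m → Matched _∼_ m × m ↭ O
  matchPairs O = go (length O) O ≤-refl
    where
    go : ∀ n O → length O ≤ n → Unique O →
         (∀ {w} → w ∈ O → f w ∈ O × f (f w) ≡ w × f w ≢ w × w ∼ f w) → ∃ λ m → Matched _∼_ m × m ↭ O
    go n       []      _       u c = [] , [] , ↭-refl
    go (suc n) (w ∷ O) (s≤s b) u c with c (here refl)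
    ... | here eq , _ , fw≢w , _ = contradiction eq fw≢w
    ... | there fw∈O , ffw , _ , w∼fw with ∈-∃↭ fw∈O
    ...   | O′ , eq with go n O′ (≤-trans (≤-trans (m≤n+m _ 1) (≤-reflexive (sym (↭-length eq)))) b)
                         (Unique-tail u′) c′
      where
      u′ : Unique (f w ∷ O′)
      u′ = Unique-resp-↭ eq (Unique-tail u)
      c′ : ∀ {v} → v ∈ O′ → f v ∈ O′ × f (f v) ≡ v × f v ≢ v × v ∼ f v
      c′ {v} v∈ with c (there (∈-resp-↭ (↭-sym eq) (there v∈)))
      ... | here fv≡w , ffv , _ =
        contradiction (subst (_∈ O′) (trans (sym ffv) (cong f fv≡w)) v∈) (Unique-head u′)
      ... | there fv∈ , ffv , rest with ∈-resp-↭ eq fv∈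
      ...   | here fv≡fw = contradiction
        (∈-resp-↭ (↭-sym eq) (there (subst (_∈ O′) (trans (sym ffv) (trans (cong f fv≡fw) ffw)) v∈)))
        (Unique-head u)
      ...   | there fv∈′ = fv∈′ , ffv , rest
    ...     | m , n′ , eq′ = w ∷ f w ∷ m , pair w∼fw n′ ,
      prep w (↭-trans (prep (f w) eq′) (↭-sym eq))

-- Alternating paths and blossoms

-- A matching that misses exactly `r`, as an involution: the exposed vertex is its own mate, which
-- keeps `mate` total.
record NearMatching {V : Set} (_∼_ : V → V → Set) (r : V) : Set where
  field
    mate       : V → V
    involutive : ∀ w → mate (mate w) ≡ w
    exposed    : mate r ≡ r
    covered    : ∀ {w} → mate w ≡ w → w ≡ r
    adjacent   : ∀ {w} → w ≢ r → w ∼ mate w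

-- The exits `x`, `y` and `z` may coincide.
Good : {V : Set} (_∼_ : V → V → Set) → (V → Set) → List V → Set
Good _∼_ U R = ∀ {x y z} → U x → U y → U z → Gadget _∼_ x y z R

concatMap-[] : ∀ {A B : Set} {f : A → List B} {g : B → A} → (∀ b → f (g b) ≡ [ b ]) →
               ∀ l → concatMap f (map g l) ≡ l
concatMap-[] eq []      = refl
concatMap-[] {f = f} {g} eq (b ∷ l) = trans (cong (_++ concatMap f (map g l)) (eq b)) (cong (b ∷_) (concatMap-[] eq l))

-- The centre is the end, `b` or `c`, that carries at least two of the three terminals; at most one
-- leg is then nonempty.
pendant⇒Gadget : ∀ {W : Set} {_∼_ : W → W → Set} → Symmetric _∼_ → ∀ {b a c} → b ∼ a → a ∼ c →
  ∀ {x y z} → x ≡ b ⊎ x ≡ c → y ≡ b ⊎ y ≡ c → z ≡ b ⊎ z ≡ c → Gadget _∼_ x y z (b ∷ a ∷ c ∷ [])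
pendant⇒Gadget {_∼_ = _∼_} ∼-sym {b} {a} {c} b∼a a∼c = cases
  where
  f : Path _∼_ even b c (a ∷ c ∷ [])
  f = b∼a ∷ a∼c ∷ []
  g : Path _∼_ even c b (a ∷ b ∷ [])
  g = ∼-sym a∼c ∷ ∼-sym b∼a ∷ []
  at-b : Matched _∼_ (a ∷ c ∷ [])
  at-b = pair a∼c []
  at-c : Matched _∼_ (a ∷ b ∷ [])
  at-c = pair (∼-sym b∼a) []
  turn : c ∷ a ∷ b ∷ [] ↭ b ∷ a ∷ c ∷ []
  turn = solve 3 (λ a b c → c ⊕ a ⊕ b ⊜ b ⊕ a ⊕ c) ↭-refl [ a ] [ b ] [ c ]
  cases : ∀ {x y z} → x ≡ b ⊎ x ≡ c → y ≡ b ⊎ y ≡ c → z ≡ b ⊎ z ≡ c → Gadget _∼_ x y z (b ∷ a ∷ c ∷ [])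
  cases (inj₁ refl) (inj₁ refl) (inj₁ refl) = claw [] [] [] at-b ↭-refl
  cases (inj₂ refl) (inj₁ refl) (inj₁ refl) = claw f [] [] [] ↭-refl
  cases (inj₁ refl) (inj₂ refl) (inj₁ refl) = claw [] f [] [] ↭-refl
  cases (inj₁ refl) (inj₁ refl) (inj₂ refl) = claw [] [] f [] ↭-refl
  cases (inj₁ refl) (inj₂ refl) (inj₂ refl) = claw g [] [] [] turn
  cases (inj₂ refl) (inj₁ refl) (inj₂ refl) = claw [] g [] [] turn
  cases (inj₂ refl) (inj₂ refl) (inj₁ refl) = claw [] [] g [] turn
  cases (inj₂ refl) (inj₂ refl) (inj₂ refl) = claw [] [] [] at-c turn

module Blossom {V : Set} {_∼_ : V → V → Set} (∼-sym : Symmetric _∼_) (_≟_ : DecidableEquality V)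
  {n} (size : V ↔ Fin n) {r} (N : NearMatching _∼_ r) where

  open NearMatching N
  open DecMembership _≟_ using (_∈?_)

  -- The matching edges are implicit: `adjacent` supplies the one from `a` to `mate a` once `r` is
  -- known to be avoided.
  data Alt : V → V → List V → Set where
    []  : ∀ {x} → Alt x x []
    _∷_ : ∀ {x a t l} → x ∼ a → Alt (mate a) t l → Alt x t (a ∷ mate a ∷ l)

  Closed : List V → Set
  Closed O = ∀ {w} → w ∈ O → mate w ∈ O

  Alt-closed : ∀ {x t l} → Alt x t l → Closed l
  Alt-closed (_ ∷ f)          (here refl)         = there (here refl)
  Alt-closed (_∷_ {a = a} _ f) (there (here refl)) = here (involutive a)
  Alt-closed (_ ∷ f)          (there (there w∈))  = there (there (Alt-closed f w∈))

  Alt-end : ∀ {x t l} → Alt x t l → t ∈ x ∷ l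
  Alt-end []      = here refl
  Alt-end (_ ∷ f) = there (there (Alt-end f))

  -- Follow the symmetric difference of the two matchings from t to r.
  alternating : ∀ {t} → NearMatching _∼_ t → ∃ λ l → Alt r t l × Unique (r ∷ l)
  alternating {t} M = walk n [] ([] ∷ []) start ≤-refl
    where
    module M = NearMatching M
    start : ∀ {w} → w ∈ t ∷ [] → M.mate w ∈ t ∷ []
    start (here refl) = here M.exposed
    -- `l` is closed under `mate` and `x ∷ l` under `M.mate`. So, unless `x` is `r`, both `mate x`
    -- and its partner in `M` are new, and the path grows at its front.
    walk : ∀ fuel {x l} → Alt x t l → Unique (x ∷ l) → (∀ {w} → w ∈ x ∷ l → M.mate w ∈ x ∷ l) →
           n < length (x ∷ l) + fuel → ∃ λ l → Alt r t l × Unique (r ∷ l)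
    -- Without fuel there would be more than `n` distinct vertices.
    walk zero {x} {l} f u c b = contradiction
      (<-≤-trans (≤-trans b (≤-reflexive (+-identityʳ _))) (Unique⇒length≤ size u)) (<-irrefl refl)
    walk (suc fuel) {x} {l} f u c b with x ≟ r
    ... | yes refl = l , f , u
    ... | no x≢r   = walk fuel g u′ c′ (≤-trans b (≤-trans (≤-reflexive (+-suc _ fuel)) (m≤n+m _ 1)))
      where
      y = mate x
      z = M.mate y
      y∉ : y ∉ x ∷ l
      y∉ (here y≡x)  = x≢r (covered y≡x)
      y∉ (there y∈l) = Unique-head u (subst (_∈ l) (involutive x) (Alt-closed f y∈l))
      y≢t : y ≢ t
      y≢t y≡t = y∉ (subst (_∈ x ∷ l) (sym y≡t) (Alt-end f))
      z∉ : z ∉ y ∷ x ∷ l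
      z∉ (here z≡y) = y≢t (M.covered z≡y)
      z∉ (there z∈) = y∉ (subst (_∈ x ∷ l) (M.involutive y) (c z∈))
      g : Alt z t (y ∷ x ∷ l)
      g = subst (λ v → Alt z t (y ∷ v ∷ l)) (involutive x)
        (∼-sym (M.adjacent y≢t) ∷ subst (λ v → Alt v t l) (sym (involutive x)) f)
      u′ : Unique (z ∷ y ∷ x ∷ l)
      u′ = Unique-∷ z∉ (Unique-∷ y∉ u)
      c′ : ∀ {w} → w ∈ z ∷ y ∷ x ∷ l → M.mate w ∈ z ∷ y ∷ x ∷ l
      c′ (here refl)         = there (here (M.involutive y))
      c′ (there (here refl)) = here refl
      c′ (there (there w∈))  = there (there (c w∈))

  -- As `e` is closed under `mate`, each matching edge of the path lies inside or outside `e`.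
  -- Cutting after the last one inside leaves a path that avoids `e`; its start `x` records in which
  -- direction that edge was passed.
  lastVisit : ∀ {v t k} e → Closed e → Alt v t k →
    (∀ {w} → w ∈ k → w ∉ e) ⊎
    (∃ λ x → ∃₂ λ j k′ → x ∈ e × Alt v x j × x ∈ j × Alt x t k′ × k ≡ j ++ k′ × (∀ {w} → w ∈ k′ → w ∉ e))
  lastVisit e c [] = inj₁ λ ()
  lastVisit e c (_∷_ {a = a} d f) with lastVisit e c f
  ... | inj₂ (x , j , k′ , x∈e , g , x∈j , h , eq , k′∉e) =
    inj₂ (x , a ∷ mate a ∷ j , k′ , x∈e , d ∷ g , there (there x∈j) , h , cong (λ l → a ∷ mate a ∷ l) eq , k′∉e)
  ... | inj₁ k∉e with a ∈? e
  ...   | yes a∈e = inj₂ (mate a , _ , _ , c a∈e , d ∷ [] , there (here refl) , f , refl , k∉e)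
  ...   | no a∉e  = inj₁ λ where
    (here refl)         → a∉e
    (there (here refl)) → λ a′∈e → a∉e (subst (_∈ e) (involutive a) (c a′∈e))
    (there (there w∈))  → k∉e w∈

  module Grow {R U} (good : Good _∼_ U R) where

    fibre : ⊤ ⊎ V → List V
    fibre (inj₁ tt) = R
    fibre (inj₂ v)  = [ v ]

    Exit : ⊤ ⊎ V → V → Set
    Exit (inj₁ tt) v = U v
    Exit (inj₂ w)  v = v ≡ w

    fibre-good : ∀ w → Good _∼_ (Exit w) (fibre w)
    fibre-good (inj₁ tt) = good
    fibre-good (inj₂ v) refl refl refl = claw [] [] [] [] ↭-refl

    open Contraction ∼-sym fibre Exit (λ w → fibre-good w)

    pendant : ∀ {u a} → U u → u ∼ a → a ∼ mate a →
              Good _∼_ (λ v → U v ⊎ v ≡ mate a) (R ++ a ∷ mate a ∷ [])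
    pendant {a = a} u∈ u∼a a∼a′ x∈ y∈ z∈
      with node x∈ | node y∈ | node z∈
      where
      node : ∀ {v} → U v ⊎ v ≡ mate a → ∃ λ w → (w ≡ inj₁ tt ⊎ w ≡ inj₂ (mate a)) × Exit w v
      node (inj₁ v∈) = _ , inj₁ refl , v∈
      node (inj₂ eq) = _ , inj₂ refl , eq
    ... | _ , c₁ , x∈′ | _ , c₂ , y∈′ | _ , c₃ , z∈′ = liftGadget
      (pendant⇒Gadget ≈-sym {a = inj₂ a} (via u∈ refl u∼a) (via refl refl a∼a′) c₁ c₂ c₃) x∈′ y∈′ z∈′

    project : ∀ {v x j w} → Exit w v → r ∉ j → Alt v x j →
              ∃ λ w′ → Exit w′ x × Path _≈_ even w w′ (map inj₂ j)
    project v∈ r∉ [] = _ , v∈ , []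
    project v∈ r∉ (e ∷ f) with project refl (r∉ ∘ there ∘ there) f
    ... | w′ , x∈ , g = w′ , x∈ ,
      via v∈ refl e ∷ via refl refl (adjacent (λ a≡r → r∉ (here (sym a≡r)))) ∷ g

    -- All of `j` becomes usable, whichever way its matching edges were passed, because an odd cycle
    -- has a gadget for any three of its vertices.
    ear : ∀ {v x u j} → U v → Alt v x j → r ∉ j → x ∼ u → U u →
          Good _∼_ (λ w → U w ⊎ w ∈ j) (R ++ j)
    ear {j = j} v∈ f r∉ x∼u u∈ x∈ y∈ z∈ with project v∈ r∉ f
    ... | w′ , x∈′ , g with node x∈ | node y∈ | node z∈
      where
      node : ∀ {v} → U v ⊎ v ∈ j → ∃ λ w → w ∈ map inj₂ j ++ [ inj₁ tt ] × Exit w v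
      node (inj₁ v∈) = _ , ∈-++⁺ʳ (map inj₂ j) (here refl) , v∈
      node (inj₂ v∈) = _ , ∈-++⁺ˡ (∈-map⁺ inj₂ v∈) , refl
    ... | _ , c₁ , e₁ | _ , c₂ , e₂ | _ , c₃ , e₃ = resp
      (↭-trans (expand-++ (map inj₂ j) [ inj₁ tt ])
        (↭-trans (↭-reflexive (cong (_++ R ++ []) (concatMap-[] (λ _ → refl) j)))
          (solve 2 (λ j R → j ⊕ R ⊕ ∅ ⊜ R ⊕ j) ↭-refl j R)))
      (liftGadget (oddCycle⇒Gadget ≈-sym (g ◅◅ via x∈′ u∈ x∼u ∷ []) c₁ c₂ c₃) e₁ e₂ e₃)

  -- The invariant for a terminal `t`, with `O` the vertices not yet in `R`; when the path is empty,
  -- `t` is itself an exit.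
  Reaches : (V → Set) → List V → V → Set
  Reaches U O t = ∃₂ λ u l → U u × Alt u t l × Unique l × (∀ {w} → w ∈ l → w ∈ O)

  All-split : ∀ {P Q : V → Set} {S : Set} {ts} → (∀ {t} → P t → Q t ⊎ S) → All P ts → All Q ts ⊎ S
  All-split h []       = inj₁ []
  All-split h (p ∷ ps) with h p | All-split h ps
  ... | inj₂ s | _      = inj₂ s
  ... | inj₁ _ | inj₂ s = inj₂ s
  ... | inj₁ q | inj₁ qs = inj₁ (q ∷ qs)

  module _ {L : List V} (L-unique : Unique L) (L-complete : ∀ v → v ∈ L) {ts : List V} where

    record State (U : V → Set) (R O : List V) : Set where
      field
        good    : Good _∼_ U R
        cover   : R ++ O ↭ L
        closed  : Closed O
        r∉      : r ∉ O
        reaches : All (Reaches U O) ts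

      O-unique : Unique O
      O-unique = Unique-++ʳ R (Unique-resp-↭ (↭-sym cover) L-unique)

      adjacent-O : ∀ {w} → w ∈ O → w ∼ mate w
      adjacent-O w∈ = adjacent λ { refl → r∉ w∈ }

    -- Shared by both ways of growing. The new paths have to avoid `e` because they must lie in what
    -- remains of `O`.
    absorb : ∀ {U U′ R O e} → State U R O → Unique e → (∀ {w} → w ∈ e → w ∈ O) → Closed e →
      Good _∼_ U′ (R ++ e) → All (λ t → ∃₂ λ u l → U′ u × Alt u t l × Unique l × (∀ {w} → w ∈ l → w ∈ O × w ∉ e)) ts →
      ∃ λ O′ → O ↭ e ++ O′ × State U′ (R ++ e) O′
    absorb {R = R} {O} {e} s e! e⊆ e-closed good′ reaches′ with ⊆⇒∃↭ e! e⊆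
    ... | O′ , eq = O′ , eq , record
      { good    = good′
      ; cover   = ↭-trans (↭-reflexive (++-assoc R e O′)) (↭-trans (++⁺ˡ R (↭-sym eq)) cover)
      ; closed  = λ {w} w∈ → rest (closed (O′⊆ w∈)) λ w′∈e →
          Unique-disjoint e eO′! (subst (_∈ e) (involutive w) (e-closed w′∈e)) w∈
      ; r∉      = r∉ ∘ O′⊆
      ; reaches = All.map (λ (u , l , u∈ , f , l! , l⊆) →
          u , l , u∈ , f , l! , λ {_} w∈ → rest (proj₁ (l⊆ w∈)) (proj₂ (l⊆ w∈))) reaches′
      }
      where
      open State s
      O′⊆ : ∀ {w} → w ∈ O′ → w ∈ O
      O′⊆ w∈ = ∈-resp-↭ (↭-sym eq) (∈-++⁺ʳ e w∈)
      eO′! : Unique (e ++ O′)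
      eO′! = Unique-resp-↭ eq O-unique
      rest : ∀ {w} → w ∈ O → w ∉ e → w ∈ O′
      rest w∈ w∉e with ∈-++⁻ e (∈-resp-↭ eq w∈)
      ... | inj₁ w∈e = contradiction w∈e w∉e
      ... | inj₂ w∈′ = w∈′

    -- While some terminal t is not yet usable, its path enters O through an
    -- edge u a.  If no other path runs through the matching edge a (mate a)
    -- backwards, then mate a can be made usable; otherwise the initial part of
    -- such a path closes up through u to an odd cycle.
    step : ∀ {U R O} → State U R O → All U ts ⊎ (∃₂ λ U′ e → ∃ λ O′ → O ↭ e ++ O′ × e ≢ [] × State U′ (R ++ e) O′)
    step {U} {R} {O} s with All-split start (State.reaches s)
      where
      start : ∀ {t} → Reaches U O t → U t ⊎ (∃₂ λ u a → U u × u ∼ a × a ∈ O)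
      start (u , _ , u∈ , [] , _)         = inj₁ u∈
      start (u , _ , u∈ , (e ∷ f) , _ , l⊆) = inj₂ (u , _ , u∈ , e , l⊆ (here refl))
    ... | inj₁ all = inj₁ all
    ... | inj₂ (u , a , u∈ , u∼a , a∈) = inj₂ (advance (All-split visit reaches))
      where
      open State s
      open Grow good
      e : List V
      e = a ∷ mate a ∷ []
      e-closed : Closed e
      e-closed (here refl)         = there (here refl)
      e-closed (there (here refl)) = here (involutive a)
      e! : Unique e
      e! = Unique-∷ (λ { (here a≡a′) → r∉ (subst (_∈ O) (covered (sym a≡a′)) a∈) }) ([] ∷ [])
      e⊆ : ∀ {w} → w ∈ e → w ∈ O
      e⊆ (here refl)         = a∈
      e⊆ (there (here refl)) = closed a∈

      Reaches′ : (V → Set) → List V → V → Set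
      Reaches′ U′ e t = ∃₂ λ u l → U′ u × Alt u t l × Unique l × (∀ {w} → w ∈ l → w ∈ O × w ∉ e)

      Backwards : Set
      Backwards = ∃₂ λ v j → U v × Alt v a j × a ∈ j × Unique j × (∀ {w} → w ∈ j → w ∈ O)

      visit : ∀ {t} → Reaches U O t → Reaches′ (λ v → U v ⊎ v ≡ mate a) e t ⊎ Backwards
      visit (v , k , v∈ , f , k! , k⊆) with lastVisit e e-closed f
      ... | inj₁ k∉e = inj₁ (v , k , inj₁ v∈ , f , k! , λ {_} w∈ → k⊆ w∈ , k∉e w∈)
      -- The last matching edge in `e` is passed from `mate a` to `a`, that is, backwards.
      ... | inj₂ (_ , j , k′ , here refl , g , x∈j , _ , refl , _) =
        inj₂ (v , j , v∈ , g , x∈j , Unique-++ˡ j k! , λ {_} → k⊆ ∘ ∈-++⁺ˡ)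
      -- The edge is left at `mate a`, an exit after the growth, so the rest of the path starts
      -- there.
      ... | inj₂ (x , j , k′ , there (here x≡a′) , g , _ , h , refl , k′∉e) =
        inj₁ (x , k′ , inj₂ x≡a′ , h , Unique-++ʳ j k! , λ {_} w∈ → k⊆ (∈-++⁺ʳ j w∈) , k′∉e w∈)

      advance : All (Reaches′ (λ v → U v ⊎ v ≡ mate a) e) ts ⊎ Backwards →
                ∃₂ λ U′ e → ∃ λ O′ → O ↭ e ++ O′ × e ≢ [] × State U′ (R ++ e) O′
      advance (inj₁ reaches′) with absorb s e! e⊆ e-closed (pendant u∈ u∼a (adjacent-O a∈)) reaches′
      ... | O′ , eq , s′ = _ , e , O′ , eq , (λ ()) , s′
      advance (inj₂ (v , j , v∈ , g , a∈j , j! , j⊆))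
        -- `g` arrives at `a` from its mate, so the edge from `a` to `u` closes an odd cycle through
        -- the contracted `R`.
        with absorb s j! j⊆ (Alt-closed g) (ear v∈ g (r∉ ∘ j⊆) (∼-sym u∼a) u∈) (All.map revisit reaches)
        where
        revisit : ∀ {t} → Reaches U O t → Reaches′ (λ v → U v ⊎ v ∈ j) j t
        revisit (v , k , v∈ , f , k! , k⊆) with lastVisit j (Alt-closed g) f
        ... | inj₁ k∉j = v , k , inj₁ v∈ , f , k! , λ {_} w∈ → k⊆ w∈ , k∉j w∈
        ... | inj₂ (x , i , k′ , x∈j , _ , _ , h , refl , k′∉j) =
          x , k′ , inj₂ x∈j , h , Unique-++ʳ i k! , λ {_} w∈ → k⊆ (∈-++⁺ʳ i w∈) , k′∉j w∈
      ... | O′ , eq , s′ = _ , j , O′ , eq , (λ { refl → case-[] a∈j }) , s′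
        where
        case-[] : a ∉ []
        case-[] ()

    exhaust : ∀ n {U R O} → length O ≤ n → State U R O → ∃ λ U′ → Good _∼_ U′ L × All U′ ts
    exhaust n {U} {R} {O} b s with step s
    -- The matching on the vertices left outside `R` joins the matched part of every gadget.
    ... | inj₁ all with matchPairs {_∼_ = _∼_} mate O O-unique
                          (λ {w} w∈ → closed w∈ , involutive w ,
                            (λ eq → r∉ (subst (_∈ O) (covered eq) w∈)) , adjacent-O w∈)
      where open State s
    ...   | m , n′ , eq = U ,
      (λ x y z → resp (↭-trans (++⁺ˡ R eq) (State.cover s)) (addMatched (State.good s x y z) n′)) , all
    exhaust n b s | inj₂ (_ , [] , _ , _ , e≢[] , _) = contradiction refl e≢[]
    exhaust zero b s | inj₂ (_ , x ∷ e , O′ , eq , _ , s′) with ≤-trans (≤-reflexive (sym (↭-length eq))) b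
    ... | ()
    exhaust (suc n) b s | inj₂ (_ , x ∷ e , O′ , eq , _ , s′) with ≤-trans (≤-reflexive (sym (↭-length eq))) b
    ... | s≤s b′ = exhaust n
      (≤-trans (m≤n+m (length O′) (length e)) (≤-trans (≤-reflexive (sym (length-++ e))) b′)) s′

    terminals-good : All (NearMatching _∼_) ts → ∃ λ U → Good _∼_ U L × All U ts
    terminals-good Ms with ∈-∃↭ (L-complete r)
    ... | O , eq = exhaust (length O) ≤-refl record
      -- Initially `R` is `r` alone, its only exit, and the claw is reduced to its centre.
      { good    = λ { refl refl refl → claw [] [] [] [] ↭-refl }
      ; cover   = ↭-sym eq
      ; closed  = λ {w} w∈ → in-O λ w′≡r → r∉
          (subst (_∈ O) (trans (sym (involutive w)) (trans (cong mate w′≡r) exposed)) w∈)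
      ; r∉      = r∉
      ; reaches = All.map reach Ms
      }
      where
      r∉ : r ∉ O
      r∉ = Unique-head (Unique-resp-↭ eq L-unique)
      in-O : ∀ {w} → w ≢ r → w ∈ O
      in-O {w} w≢r with ∈-resp-↭ eq (L-complete w)
      ... | here w≡r = contradiction w≡r w≢r
      ... | there w∈ = w∈
      reach : ∀ {t} → NearMatching _∼_ t → Reaches (_≡ r) O t
      reach M with alternating M
      ... | l , f , u = r , l , refl , f , Unique-tail u , λ {_} w∈ → in-O λ { refl → Unique-head u w∈ }

-- Multiset unions over finite types

module _ {V : Set} where
  open Sum (++-commutativeMonoid {A = V}) using (sum; sum-cong-≋; sum-cong-≗; sum-permute; ∑-distrib-+)

  ⨄ : ∀ {A} → Finite A → (A → List V) → List V
  ⨄ (_ , φ) f = sum (f ∘ Inverse.from φ)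

  ⨄-cong : ∀ {A} (F : Finite A) {f g : A → List V} → (∀ a → f a ↭ g a) → ⨄ F f ↭ ⨄ F g
  ⨄-cong (_ , φ) eq = sum-cong-≋ (eq ∘ Inverse.from φ)

  ⨄-↔ : ∀ {A B} (F : Finite A) (G : Finite B) (φ : A ↔ B) (f : B → List V) →
         ⨄ G f ↭ ⨄ F (f ∘ Inverse.to φ)
  ⨄-↔ (m , α) (n , β) φ f = ↭-trans
    (sum-permute {m} {n} (f ∘ Inverse.from β) (↔-trans (↔-sym α) (↔-trans φ β)))
    (↭-reflexive (sum-cong-≗ λ i → cong f (Inverse.strictlyInverseʳ β (Inverse.to φ (Inverse.from α i)))))

  ⨄-++ : ∀ {A} (F : Finite A) (f g : A → List V) → ⨄ F (λ a → f a ++ g a) ↭ ⨄ F f ++ ⨄ F g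
  ⨄-++ (_ , φ) f g = ∑-distrib-+ (f ∘ Inverse.from φ) (g ∘ Inverse.from φ)

  private
    sum-splitAt : ∀ m {n} (f : Fin m → List V) (g : Fin n → List V) →
      sum {m + n} (λ i → [ f , g ]′ (splitAt m i)) ↭ sum f ++ sum g
    sum-splitAt zero    f g = ↭-refl
    sum-splitAt (suc m) f g = ↭-trans
      (++⁺ˡ (f zero) (↭-trans (↭-reflexive (sum-cong-≗ shift′)) (sum-splitAt m (f ∘ suc) g)))
      (solve 3 (λ a b c → a ⊕ b ⊕ c ⊜ (a ⊕ b) ⊕ c) ↭-refl (f zero) (sum (f ∘ suc)) (sum g))
      where
      shift′ : ∀ i → [ f , g ]′ (splitAt (suc m) (suc i)) ≡ [ f ∘ suc , g ]′ (splitAt m i)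
      shift′ i with splitAt m i
      ... | inj₁ _ = refl
      ... | inj₂ _ = refl

  ⨄-⊎ : ∀ {A B} (F : Finite A) (G : Finite B) (H : Finite (A ⊎ B)) (f : A ⊎ B → List V) →
         ⨄ H f ↭ ⨄ F (f ∘ inj₁) ++ ⨄ G (f ∘ inj₂)
  ⨄-⊎ F@(m , α) G@(_ , β) H f = ↭-trans (⨄-↔ (finite-⊎ F G) H ↔-refl f)
    (↭-trans (↭-reflexive (sum-cong-≗ cases)) (sum-splitAt m _ _))
    where
    cases : ∀ i → f (Inverse.from (proj₂ (finite-⊎ F G)) i) ≡
                  [ f ∘ inj₁ ∘ Inverse.from α , f ∘ inj₂ ∘ Inverse.from β ]′ (splitAt m i)
    cases i with splitAt m i
    ... | inj₁ _ = refl
    ... | inj₂ _ = refl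

  private
    ⨄-ΣFin : ∀ n {B : Fin n → Set} (G : ∀ i → Finite (B i)) (f : Σ (Fin n) B → List V) →
      ⨄ (finite-ΣFin n G) f ↭ sum (λ i → ⨄ (G i) (λ b → f (i , b)))
    ⨄-ΣFin zero    G f = ↭-refl
    ⨄-ΣFin (suc n) {B} G f =
      let F = finite-ΣFin n (G ∘ suc) ; H = finite-⊎ (G zero) F in ↭-trans
      (⨄-↔ H (finite-ΣFin (suc n) G) cons f)
      (↭-trans (⨄-⊎ (G zero) F H (f ∘ Inverse.to cons))
        (++⁺ˡ (⨄ (G zero) (λ b → f (zero , b))) (⨄-ΣFin n (G ∘ suc) (λ { (i , b) → f (suc i , b) }))))
      where
      cons : (B zero ⊎ Σ (Fin n) (B ∘ suc)) ↔ Σ (Fin (suc n)) B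
      cons = mk↔ₛ′
        (λ { (inj₁ b) → zero , b ; (inj₂ (i , b)) → suc i , b })
        (λ { (zero , b) → inj₁ b ; (suc i , b) → inj₂ (i , b) })
        (λ { (zero , b) → refl ; (suc i , b) → refl })
        (λ { (inj₁ b) → refl ; (inj₂ (i , b)) → refl })

  ⨄-Σ : ∀ {A} {B : A → Set} (F : Finite A) (G : ∀ a → Finite (B a)) (H : Finite (Σ A B))
        (f : Σ A B → List V) → ⨄ H f ↭ ⨄ F (λ a → ⨄ (G a) (λ b → f (a , b)))
  ⨄-Σ (n , α) G H f = ↭-trans
    (⨄-↔ (finite-ΣFin n (G ∘ Inverse.from α)) H (Σ-↔ (↔-sym α) ↔-refl) f)
    (⨄-ΣFin n (G ∘ Inverse.from α) (λ { (i , b) → f (Inverse.from α i , b) }))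

  ∈-⨄ : ∀ {A} (F : Finite A) (f : A → List V) {v} a → v ∈ f a → v ∈ ⨄ F f
  ∈-⨄ {A} (n , φ) f {v} a v∈ = go (f ∘ Inverse.from φ) (Inverse.to φ a)
    (subst (λ b → v ∈ f b) (sym (Inverse.strictlyInverseʳ φ a)) v∈)
    where
    go : ∀ {n} (g : Fin n → List V) i → v ∈ g i → v ∈ sum g
    go g zero    v∈ = ∈-++⁺ˡ v∈
    go g (suc i) v∈ = ∈-++⁺ʳ (g zero) (go (g ∘ suc) i v∈)

  ∈-⨄⁻ : ∀ {A} (F : Finite A) (f : A → List V) {v} → v ∈ ⨄ F f → ∃ λ a → v ∈ f a
  ∈-⨄⁻ {A} (n , φ) f {v} v∈ = let i , v∈′ = go (f ∘ Inverse.from φ) v∈ in Inverse.from φ i , v∈′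
    where
    go : ∀ {n} (g : Fin n → List V) → v ∈ sum g → ∃ λ i → v ∈ g i
    go {suc n} g v∈ with ∈-++⁻ (g zero) v∈
    ... | inj₁ v∈₀ = zero , v∈₀
    ... | inj₂ v∈₁ = let i , v∈ᵢ = go (g ∘ suc) v∈₁ in suc i , v∈ᵢ

  ⨄-singletons : ∀ {A} (F : Finite A) (φ : A → V) → ⨄ F ([_] ∘ φ) ≡ tabulate (φ ∘ Inverse.from (proj₂ F))
  ⨄-singletons (n , α) φ = go (φ ∘ Inverse.from α)
    where
    go : ∀ {n} (g : Fin n → V) → sum ([_] ∘ g) ≡ tabulate g
    go {zero}  g = refl
    go {suc n} g = cong (g zero ∷_) (go (g ∘ suc))

  -- A cover of `G` is a permutation of a list without repetitions; this extracts from it that the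
  -- embedding of the vertices is injective.
  ⨄-Unique⇒injective : ∀ {A} (F : Finite A) (φ : A → V) → Unique (⨄ F ([_] ∘ φ)) →
                       ∀ {a b} → φ a ≡ φ b → a ≡ b
  ⨄-Unique⇒injective F@(n , α) φ u {a} {b} eq = trans (sym (Inverse.strictlyInverseʳ α a))
    (trans (cong (Inverse.from α) (go (φ ∘ Inverse.from α) (subst Unique (⨄-singletons F φ) u)
      (trans (cong φ (Inverse.strictlyInverseʳ α a)) (trans eq (sym (cong φ (Inverse.strictlyInverseʳ α b)))))))
      (Inverse.strictlyInverseʳ α b))
    where
    go : ∀ {n} (g : Fin n → V) → Unique (tabulate g) → ∀ {i j} → g i ≡ g j → i ≡ j
    go g (h ∷ u) {zero}  {zero}  eq = refl
    go g (h ∷ u) {zero}  {suc j} eq = contradiction eq (All.tabulate⁻ h j)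
    go g (h ∷ u) {suc i} {zero}  eq = contradiction (sym eq) (All.tabulate⁻ h i)
    go g (h ∷ u) {suc i} {suc j} eq = cong suc (go (g ∘ suc) u eq)

concatMap-⨄ : ∀ {A U V : Set} (h : U → List V) (F : Finite A) (f : A → List U) →
              concatMap h (⨄ F f) ≡ ⨄ F (concatMap h ∘ f)
concatMap-⨄ {U = U} {V} h (n , α) f = go (f ∘ Inverse.from α)
  where
  open Sum (++-commutativeMonoid {A = U}) using () renaming (sum to sumᵤ)
  open Sum (++-commutativeMonoid {A = V}) using (sum)
  go : ∀ {n} (g : Fin n → List U) → concatMap h (sumᵤ g) ≡ sum (concatMap h ∘ g)
  go {zero}  g = refl
  go {suc n} g = trans (concatMap-++ h (g zero) (sumᵤ (g ∘ suc))) (cong (concatMap h (g zero) ++_) (go (g ∘ suc)))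

elements : ∀ {A} → Finite A → List A
elements F = ⨄ F [_]

elements-complete : ∀ {A} (F : Finite A) a → a ∈ elements F
elements-complete F a = ∈-⨄ F [_] a (here refl)

elements-unique : ∀ {A} (F : Finite A) → Unique (elements F)
elements-unique F@(n , α) = subst Unique (sym (⨄-singletons F (λ a → a)))
  (tabulate⁺ λ eq → trans (sym (Inverse.strictlyInverseˡ α _))
    (trans (cong (Inverse.to α) eq) (Inverse.strictlyInverseˡ α _)))

-- Graphs expanding a given graph

∈⊎∉-∈ : ∀ {A} (X : Subset A) {a} (p : a Defs.∈ X) → ∈⊎∉ X a ≡ inj₁ p
∈⊎∉-∈ X {a} p with X a
... | true = refl

∈⊎∉-∉ : ∀ {A} (X : Subset A) {a} (p : a Defs.∉ X) → ∈⊎∉ X a ≡ inj₂ p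
∈⊎∉-∉ X {a} p with X a
... | false = refl

split↔ : ∀ {A} (X : Subset A) → (Σ A (Defs._∈ X) ⊎ Σ A (Defs._∉ X)) ↔ A
split↔ {A} X = mk↔ₛ′ [ proj₁ , proj₁ ]′ from to∘from from∘to
  where
  classify : ∀ {a} → a Defs.∈ X ⊎ a Defs.∉ X → Σ A (Defs._∈ X) ⊎ Σ A (Defs._∉ X)
  classify (inj₁ p) = inj₁ (_ , p)
  classify (inj₂ p) = inj₂ (_ , p)
  from : A → Σ A (Defs._∈ X) ⊎ Σ A (Defs._∉ X)
  from a = classify (∈⊎∉ X a)
  to∘from : ∀ a → [ proj₁ , proj₁ ]′ (from a) ≡ a
  to∘from a with ∈⊎∉ X a
  ... | inj₁ _ = refl
  ... | inj₂ _ = refl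
  from∘to : ∀ s → from ([ proj₁ , proj₁ ]′ s) ≡ s
  from∘to (inj₁ (a , p)) = cong classify (∈⊎∉-∈ X p)
  from∘to (inj₂ (a , p)) = cong classify (∈⊎∉-∉ X p)

module _ {A : Set} (F : Finite A) (X : Subset A) where

  finite-∈ : Finite (Σ A (Defs._∈ X))
  finite-∈ = finite-Σ F (finite-T ∘ X)

  finite-∉ : Finite (Σ A (Defs._∉ X))
  finite-∉ = finite-Σ F (finite-T ∘ ∁ X)

  ⨄-split : ∀ {V : Set} (f : A → List V) → ⨄ F f ↭ ⨄ finite-∈ (f ∘ proj₁) ++ ⨄ finite-∉ (f ∘ proj₁)
  ⨄-split f = ↭-trans (⨄-↔ (finite-⊎ finite-∈ finite-∉) F (split↔ X) f)
    (⨄-⊎ finite-∈ finite-∉ (finite-⊎ finite-∈ finite-∉) (f ∘ Inverse.to (split↔ X)))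

mapMatched : ∀ {V W : Set} {_∼_ : V → V → Set} {_≈_ : W → W → Set} (f : V → W) →
             (∀ {a b} → a ∼ b → f a ≈ f b) → ∀ {m} → Matched _∼_ m → Matched _≈_ (map f m)
mapMatched f h []         = []
mapMatched f h (pair e n) = pair (h e) (mapMatched f h n)

map-⨄ : ∀ {A U V : Set} (h : U → V) (F : Finite A) (φ : A → U) → map h (⨄ F ([_] ∘ φ)) ≡ ⨄ F ([_] ∘ h ∘ φ)
map-⨄ h F φ = trans (cong (map h) (⨄-singletons F φ))
  (trans (map-tabulate (φ ∘ Inverse.from (proj₂ F)) h) (sym (⨄-singletons F (h ∘ φ))))

module _ (G : Graph) where
  open Graph G

  Joins : E → V → V → Set
  Joins e u v = (end₁ e ≡ u × end₂ e ≡ v) ⊎ (end₁ e ≡ v × end₂ e ≡ u)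

  Parallel : E → E → Set
  Parallel e f = ∃₂ λ u v → Joins e u v × Joins f u v

module _ {G : Graph} where
  open Graph G using (V; E; end₁; end₂; finite-V; loopless; Incident; Adjacent; PerfectMatching)

  Joins-sym : ∀ {e u v} → Joins G e u v → Joins G e v u
  Joins-sym (inj₁ j) = inj₂ j
  Joins-sym (inj₂ j) = inj₁ j

  Adjacent-sym : Symmetric Adjacent
  Adjacent-sym (e , j) = e , Joins-sym j

  Joins-functional : ∀ {e u v w} → Joins G e u v → Joins G e u w → v ≡ w
  Joins-functional (inj₁ (refl , refl)) (inj₁ (_ , refl))   = refl
  Joins-functional {e} (inj₁ (refl , refl)) (inj₂ (_ , eq)) = contradiction (sym eq) (loopless e)
  Joins-functional {e} (inj₂ (refl , refl)) (inj₁ (eq , _)) = contradiction eq (loopless e)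
  Joins-functional (inj₂ (refl , refl)) (inj₂ (refl , _))   = refl

  Joins-distinct : ∀ {e u v} → Joins G e u v → u ≢ v
  Joins-distinct {e} (inj₁ (refl , refl)) eq = loopless e eq
  Joins-distinct {e} (inj₂ (refl , refl)) eq = loopless e (sym eq)

  Incident⇒Joins : ∀ {e u v} → u ≢ v → Incident u e → Incident v e → Joins G e u v
  Incident⇒Joins u≢v (inj₁ p) (inj₁ q) = contradiction (trans (sym p) q) u≢v
  Incident⇒Joins u≢v (inj₁ p) (inj₂ q) = inj₁ (p , q)
  Incident⇒Joins u≢v (inj₂ p) (inj₁ q) = inj₂ (q , p)
  Incident⇒Joins u≢v (inj₂ p) (inj₂ q) = contradiction (trans (sym p) q) u≢v

  Joins⇒Incident : ∀ {e u v} → Joins G e u v → Incident u e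
  Joins⇒Incident (inj₁ (p , _)) = inj₁ p
  Joins⇒Incident (inj₂ (_ , q)) = inj₂ q

  parallel-ends : ∀ {e f} → Parallel G e f →
    end₁ e ≡ end₁ f × end₂ e ≡ end₂ f ⊎ end₁ e ≡ end₂ f × end₂ e ≡ end₁ f
  parallel-ends (_ , _ , inj₁ (p , q) , inj₁ (r , s)) = inj₁ (trans p (sym r) , trans q (sym s))
  parallel-ends (_ , _ , inj₁ (p , q) , inj₂ (r , s)) = inj₂ (trans p (sym s) , trans q (sym r))
  parallel-ends (_ , _ , inj₂ (p , q) , inj₁ (r , s)) = inj₂ (trans p (sym s) , trans q (sym r))
  parallel-ends (_ , _ , inj₂ (p , q) , inj₂ (r , s)) = inj₁ (trans p (sym r) , trans q (sym s))

  Parallel-sym : ∀ {e f} → Parallel G e f → Parallel G f e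
  Parallel-sym (u , v , j , k) = u , v , k , j

  Parallel-incident : ∀ {e f u} → Parallel G e f → Incident u e → Incident u f
  Parallel-incident p i with parallel-ends p | i
  ... | inj₁ (q , _) | inj₁ eq = inj₁ (trans (sym q) eq)
  ... | inj₁ (_ , r) | inj₂ eq = inj₂ (trans (sym r) eq)
  ... | inj₂ (q , _) | inj₁ eq = inj₂ (trans (sym q) eq)
  ... | inj₂ (_ , r) | inj₂ eq = inj₁ (trans (sym r) eq)

  module Mates {M : Subset E} (pm : PerfectMatching M) where

    private
      opposite : ∀ {v e} → Incident v e → ∃ (Joins G e v)
      opposite (inj₁ p) = _ , inj₁ (p , refl)
      opposite (inj₂ q) = _ , inj₂ (refl , q)

    edgeAt : V → E
    edgeAt v = proj₁ (pm v)

    edgeAt∈ : ∀ v → edgeAt v Defs.∈ M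
    edgeAt∈ v = proj₁ (proj₁ (proj₂ (pm v)))

    mate : V → V
    mate v = proj₁ (opposite (proj₂ (proj₁ (proj₂ (pm v)))))

    joins : ∀ v → Joins G (edgeAt v) v (mate v)
    joins v = proj₂ (opposite (proj₂ (proj₁ (proj₂ (pm v)))))

    mate-unique : ∀ {e v w} → e Defs.∈ M → Joins G e v w → mate v ≡ w
    mate-unique {v = v} e∈ j with proj₂ (proj₂ (pm v)) (e∈ , Joins⇒Incident j)
    ... | refl = Joins-functional (joins v) j

    involutive : ∀ v → mate (mate v) ≡ v
    involutive v = mate-unique (edgeAt∈ v) (Joins-sym (joins v))

    irreflexive : ∀ v → mate v ≢ v
    irreflexive v eq = Joins-distinct (joins v) (sym eq)

  Matchable⇒Matched : Matchable G → ∃ λ m → Matched Adjacent m × m ↭ elements finite-V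
  Matchable⇒Matched (M , pm) = matchPairs mate (elements finite-V) (elements-unique finite-V)
    λ {w} _ → elements-complete finite-V (mate w) , involutive w , irreflexive w , edgeAt w , joins w
    where open Mates pm

module _ {G H : Graph} (iso : G ≅ H) where
  private
    module G = Graph G
    module H = Graph H
  open _≅_ iso

  from-joins : ∀ {e u v} → Joins H e u v → Joins G (Inverse.from E↔ e) (Inverse.from V↔ u) (Inverse.from V↔ v)
  from-joins {e} {u} {v} j = Incident⇒Joins {G = G} u′≢v′ (pull (Joins⇒Incident {G = H} j))
    (pull (Joins⇒Incident {G = H} (Joins-sym {G = H} j)))
    where
    pull : ∀ {w} → H.Incident w e → G.Incident (Inverse.from V↔ w) (Inverse.from E↔ e)
    pull {w} i = Equivalence.from (incident _ _)
      (subst₂ H.Incident (sym (Inverse.strictlyInverseˡ V↔ w)) (sym (Inverse.strictlyInverseˡ E↔ e)) i)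
    u′≢v′ : Inverse.from V↔ u ≢ Inverse.from V↔ v
    u′≢v′ eq = Joins-distinct {G = H} j (trans (sym (Inverse.strictlyInverseˡ V↔ u))
      (trans (cong (Inverse.to V↔) eq) (Inverse.strictlyInverseˡ V↔ v)))

-- The path replacing an edge of L, cut at one of its edges into two even legs.
record Link (G : Graph) (a b : Graph.V G) : Set where
  open Graph G
  field
    edge            : E
    {τ₁ τ₂}         : V
    {κ₁ κ₂}         : List V
    leg₁            : Path Adjacent even a τ₁ κ₁
    leg₂            : Path Adjacent even b τ₂ κ₂
    joins           : Joins G edge τ₁ τ₂

  interior : List V
  interior = κ₁ ++ κ₂

Link-sym : ∀ {G a b} → Link G a b → Link G b a
Link-sym {G} k = record { edge = edge ; leg₁ = leg₂ ; leg₂ = leg₁ ; joins = Joins-sym {G = G} joins }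
  where open Link k

record Expansion (L G : Graph) : Set where
  private
    module L = Graph L
    module G = Graph G
  field
    port     : L.V → G.V
    link     : ∀ e → Link G (port (L.end₁ e)) (port (L.end₂ e))
    {rest}   : List G.V
    matched  : Matched G.Adjacent rest
    cover    : ⨄ L.finite-V ([_] ∘ port) ++ ⨄ L.finite-E (Link.interior ∘ link) ++ rest ↭ elements G.finite-V

-- The cover does not imply this: links of parallel edges of `L` that have no interior vertices
-- could use the same edge of `G`.
EdgeInjective : ∀ {L G} → Expansion L G → Set
EdgeInjective X = ∀ {e f} → Link.edge (link e) ≡ Link.edge (link f) → e ≡ f
  where open Expansion X

transport : ∀ {L K G} → L ≅ K → ∃ (EdgeInjective {L} {G}) → ∃ (EdgeInjective {K} {G})
transport {L} {K} {G} iso (X , injective) = record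
  { port     = port ∘ Inverse.from V↔
  ; link     = λ e → along (ends e)
  ; matched  = matched
  ; cover    = ↭-trans (++⁺ (↭-sym (⨄-↔ K.finite-V L.finite-V (↔-sym V↔) ([_] ∘ port)))
      (++⁺ʳ rest (↭-trans (⨄-cong K.finite-E (along-interior ∘ ends))
        (↭-sym (⨄-↔ K.finite-E L.finite-E (↔-sym E↔) (Link.interior ∘ link)))))) cover
  } , λ {e} {f} eq → trans (sym (Inverse.strictlyInverseˡ E↔ e)) (trans
      (cong (Inverse.to E↔) (injective (trans (sym (along-edge (ends e))) (trans eq (along-edge (ends f))))))
      (Inverse.strictlyInverseˡ E↔ f))
  where
  module L = Graph L
  module K = Graph K
  open Expansion X
  open _≅_ iso
  ends : ∀ e → Joins L (Inverse.from E↔ e) (Inverse.from V↔ (K.end₁ e)) (Inverse.from V↔ (K.end₂ e))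
  ends e = from-joins iso {e} (inj₁ (refl , refl))
  -- The isomorphism may exchange the ends of an edge; its link is then reversed.
  along : ∀ {e u v} → Joins L e u v → Link G (port u) (port v)
  along {e} (inj₁ (refl , refl)) = link e
  along {e} (inj₂ (refl , refl)) = Link-sym (link e)
  along-edge : ∀ {e u v} (j : Joins L e u v) → Link.edge (along j) ≡ Link.edge (link e)
  along-edge (inj₁ (refl , refl)) = refl
  along-edge (inj₂ (refl , refl)) = refl
  along-interior : ∀ {e u v} (j : Joins L e u v) → Link.interior (along j) ↭ Link.interior (link e)
  along-interior (inj₁ (refl , refl)) = ↭-refl
  along-interior {e} (inj₂ (refl , refl)) = ++-comm (Link.κ₂ (link e)) (Link.κ₁ (link e))

parity : ℕ → Bool
parity zero    = even
parity (suc n) = not (parity n)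

2∣⇒even : ∀ {n} → 2 ∣ n → parity n ≡ even
2∣⇒even (divides q refl) = go q
  where
  go : ∀ q → parity (q * 2) ≡ even
  go zero    = refl
  go (suc q) = trans (not-involutive _) (go q)

tabulatePath : ∀ {V : Set} {_∼_ : V → V → Set} n (g : Fin (suc n) → V) → (∀ i → g (inject₁ i) ∼ g (suc i)) →
               Path _∼_ (parity n) (g zero) (g (fromℕ n)) (tabulate (g ∘ suc))
tabulatePath zero    g h = []
tabulatePath (suc n) g h = h zero ∷
  cast (sym (not-involutive _)) (tabulatePath n (g ∘ suc) (h ∘ suc))

tabulate-last : ∀ {V : Set} n (g : Fin (suc n) → V) → tabulate g ↭ g (fromℕ n) ∷ tabulate (g ∘ inject₁)
tabulate-last zero    g = ↭-refl
tabulate-last (suc n) g = ↭-trans (prep (g zero) (tabulate-last n (g ∘ suc))) (shift (g (suc (fromℕ n))) [ g zero ] _)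

module _ (L : Graph) (s : Graph.E L → ℕ) where
  private
    module L = Graph L
    module S = Graph (subdivide L s)

  finish-last : ∀ e → S.end₂ (e , fromℕ (s e)) ≡ inj₁ (L.end₂ e)
  finish-last e rewrite view-fromℕ (s e) = refl

  finish-inject₁ : ∀ e i → S.end₂ (e , inject₁ i) ≡ inj₂ (e , i)
  finish-inject₁ e i rewrite view-inject₁ i = refl

Σ-≡ : ∀ {A : Set} {X : Subset A} {p q : Σ A (Defs._∈ X)} → proj₁ p ≡ proj₁ q → p ≡ q
Σ-≡ {p = a , p} {.a , q} refl = cong (a ,_) (T-irrelevant p q)

ConformalMinor⇒Expansion : ∀ {L G} → ConformalMinor L G → ∃ (EdgeInjective {L} {G})
ConformalMinor⇒Expansion {L} {G} (H , conformal , s , s-even , iso) = record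
  { port     = φ ∘ inj₁
  ; link     = λ e → proj₁ (links e)
  ; matched  = mapMatched proj₁ (λ { (e , j) → proj₁ e , lower j }) (proj₁ (proj₂ rest))
  ; cover    = ↭-sym (↭-trans (⨄-split G.finite-V X [_]) (↭-trans (++⁺
      (↭-trans (⨄-↔ S.finite-V (finite-∈ G.finite-V X) (↔-sym V↔) ([_] ∘ proj₁))
      (↭-trans (⨄-⊎ L.finite-V (finite-Σ L.finite-E λ e → s e , ↔-refl) S.finite-V ([_] ∘ φ))
        (++⁺ˡ (⨄ L.finite-V ([_] ∘ φ ∘ inj₁)) (↭-trans
          (⨄-Σ L.finite-E (λ e → s e , ↔-refl) (finite-Σ L.finite-E λ e → s e , ↔-refl) ([_] ∘ φ ∘ inj₂))
          (⨄-cong L.finite-E λ e → ↭-sym (proj₂ (proj₂ (links e))))))))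
      (↭-trans (↭-reflexive (sym (map-⨄ proj₁ (finite-∉ G.finite-V X) (λ v → v))))
        (map⁺ proj₁ (↭-sym (proj₂ (proj₂ rest))))))
      (solve 3 (λ a b c → (a ⊕ b) ⊕ c ⊜ a ⊕ b ⊕ c) ↭-refl
        (⨄ L.finite-V ([_] ∘ φ ∘ inj₁)) (⨄ L.finite-E (λ e → Link.interior (proj₁ (links e)))) (map proj₁ (proj₁ rest)))))
  } , λ {e} {f} eq → edge-injective (trans (sym (proj₁ (proj₂ (links e)))) (trans eq (proj₁ (proj₂ (links f)))))
  where
  module L = Graph L
  module G = Graph G
  S = subdivide L s
  module S = Graph S
  open _≅_ iso
  X = Subgraph.vertices H
  φ : S.V → G.V
  φ = proj₁ ∘ Inverse.from V↔
  ψ : S.E → G.E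
  ψ = proj₁ ∘ Inverse.from E↔
  ψ-joins : ∀ {e u v} → Joins S e u v → Joins G (ψ e) (φ u) (φ v)
  ψ-joins j with from-joins iso j
  ... | inj₁ (p , q) = inj₁ (cong proj₁ p , cong proj₁ q)
  ... | inj₂ (p , q) = inj₂ (cong proj₁ p , cong proj₁ q)
  rest = Matchable⇒Matched {G = G - X} conformal
  lower : ∀ {e u v} → Joins (G - X) e u v → Joins G (proj₁ e) (proj₁ u) (proj₁ v)
  lower (inj₁ (p , q)) = inj₁ (cong proj₁ p , cong proj₁ q)
  lower (inj₂ (p , q)) = inj₂ (cong proj₁ p , cong proj₁ q)

  edge-injective : ∀ {e f} → ψ (e , zero) ≡ ψ (f , zero) → e ≡ f
  edge-injective {e} {f} eq = cong proj₁ (trans (sym (Inverse.strictlyInverseˡ E↔ (e , zero)))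
    (trans (cong (Inverse.to E↔) (Σ-≡ {X = Subgraph.edges H} eq)) (Inverse.strictlyInverseˡ E↔ (f , zero))))

  walk : ∀ e i → G.Adjacent (φ (S.end₂ (e , inject₁ i))) (φ (S.end₂ (e , suc i)))
  walk e i = ψ (e , suc i) , ψ-joins (inj₁ (sym (finish-inject₁ L s e i) , refl))

  -- The first edge of the subdivided path is the distinguished one. The first leg is then empty,
  -- and the second, read backwards from the far port, holds all the subdivision vertices, which are
  -- even in number.
  links : ∀ e → Σ (Link G (φ (inj₁ (L.end₁ e))) (φ (inj₁ (L.end₂ e)))) λ k →
          Link.edge k ≡ ψ (e , zero) × Link.interior k ↭ ⨄ (s e , ↔-refl) (λ i → [ φ (inj₂ (e , i)) ])
  links e with reverse (Adjacent-sym {G}) (cast (2∣⇒even (s-even e))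
      (tabulatePath (s e) (λ i → φ (S.end₂ (e , i))) (walk e)))
  ... | k , f , rev =
    record { edge = ψ (e , zero) ; leg₁ = []
           ; leg₂ = subst (λ v → Path G.Adjacent even v (φ (S.end₂ (e , zero))) k) (cong φ (finish-last L s e)) f
           ; joins = ψ-joins (inj₁ (refl , refl)) } , refl ,
    drop-∷ (↭-trans (↭-sym rev) (↭-trans (tabulate-last (s e) (λ i → φ (S.end₂ (e , i))))
      (↭-reflexive (cong (φ (S.end₂ (e , fromℕ (s e))) ∷_)
        (trans (tabulate-cong (λ i → cong φ (finish-inject₁ L s e i)))
          (sym (⨄-singletons (s e , ↔-refl) (λ i → φ (inj₂ (e , i))))))))))

-- Models of the members of K₄ (J)

finite-Fin3 : Finite (Fin 3)
finite-Fin3 = 3 , ↔-refl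

module _ (J : Graph) (cubic : Cubic J) where
  private module J = Graph J

  HalfEdge : J.V → Set
  HalfEdge v = ∃ λ e → J.Incident v e

  halfEdge : ∀ v → Fin 3 → HalfEdge v
  halfEdge v = Inverse.from (cubic v)

  finite-HalfEdge : ∀ v → Finite (HalfEdge v)
  finite-HalfEdge v = 3 , cubic v

  half₁ : ∀ e → HalfEdge (J.end₁ e)
  half₁ e = e , inj₁ refl

  half₂ : ∀ e → HalfEdge (J.end₂ e)
  half₂ e = e , inj₂ refl

  -- Legs belong to edges of `J` in an expansion and to vertices of `J` in a model; counting
  -- half-edges in two ways converts one indexing into the other.
  handshake : ∀ {V : Set} (κ : ∀ v → HalfEdge v → List V) →
    ⨄ J.finite-E (λ e → κ _ (half₁ e) ++ κ _ (half₂ e)) ↭ ⨄ J.finite-V (λ v → ⨄ (finite-HalfEdge v) (κ v))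
  handshake κ = ↭-trans (⨄-++ J.finite-E (λ e → κ _ (half₁ e)) (λ e → κ _ (half₂ e))) (↭-sym
    (↭-trans (↭-sym (⨄-Σ J.finite-V finite-HalfEdge finite-halves (λ { (v , h) → κ v h })))
    (↭-trans (⨄-↔ (finite-⊎ J.finite-E J.finite-E) finite-halves halves (λ { (v , h) → κ v h }))
      (⨄-⊎ J.finite-E J.finite-E (finite-⊎ J.finite-E J.finite-E)
        (λ s → κ _ (proj₂ (Inverse.to halves s)))))))
    where
    finite-halves = finite-Σ J.finite-V finite-HalfEdge
    halves : (J.E ⊎ J.E) ↔ Σ J.V HalfEdge
    halves = mk↔ₛ′
      (λ { (inj₁ e) → _ , half₁ e ; (inj₂ e) → _ , half₂ e })
      (λ { (_ , e , inj₁ refl) → inj₁ e ; (_ , e , inj₂ refl) → inj₂ e })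
      (λ { (_ , e , inj₁ refl) → refl ; (_ , e , inj₂ refl) → refl })
      (λ { (inj₁ e) → refl ; (inj₂ e) → refl })

  module Triangles (X : Subset J.V) where

    L : Graph
    L = (J , cubic) ^ X ⊙K₄

    private module L = Graph L

    -- The attachment map of the triangle replacement, with the decision `s` as an argument so that
    -- proofs can branch on it.
    attach : ∀ {v} → v Defs.∈ X ⊎ v Defs.∉ X → HalfEdge v → L.V
    attach {v} s h = [ (λ v∈ → inj₂ ((v , v∈) , Inverse.to (cubic v) h)) , (λ v∉ → inj₁ (v , v∉)) ]′ s

    module _ {V : Set} (port : L.V → V) (side : (Σ J.V (Defs._∈ X) × Fin 3) → List V)
             (κ : ∀ v → HalfEdge v → List V) where

      core : ∀ {v} → v Defs.∈ X ⊎ v Defs.∉ X → List V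
      core {v} (inj₁ v∈) = ⨄ finite-Fin3 (λ i → [ port (inj₂ ((v , v∈) , i)) ]) ++ ⨄ finite-Fin3 (λ i → side ((v , v∈) , i))
      core {v} (inj₂ v∉) = [ port (inj₁ (v , v∉)) ]

      -- Sorts an expansion by the vertices of `J`, for passing between expansions and models in
      -- either direction.
      regroup : (f : L.E → List V) → (∀ e → f (inj₁ e) ≡ κ _ (half₁ e) ++ κ _ (half₂ e)) → (∀ t → f (inj₂ t) ≡ side t) →
        ⨄ L.finite-V ([_] ∘ port) ++ ⨄ L.finite-E f ↭
        ⨄ J.finite-V (λ v → core (∈⊎∉ X v) ++ ⨄ (finite-HalfEdge v) (κ v))
      regroup f f₁ f₂ = ↭-trans (++⁺
        (↭-trans (⨄-⊎ (finite-∉ J.finite-V X) finite-triangles L.finite-V ([_] ∘ port))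
          (++⁺ˡ _ (⨄-Σ (finite-∈ J.finite-V X) (λ _ → finite-Fin3) finite-triangles ([_] ∘ port ∘ inj₂))))
        (↭-trans (⨄-⊎ J.finite-E finite-triangles L.finite-E f)
          (++⁺ (↭-trans (⨄-cong J.finite-E (↭-reflexive ∘ f₁)) (handshake κ))
            (↭-trans (⨄-cong finite-triangles (↭-reflexive ∘ f₂))
              (⨄-Σ (finite-∈ J.finite-V X) (λ _ → finite-Fin3) finite-triangles side)))))
        (↭-sym (↭-trans (⨄-++ J.finite-V (λ v → core (∈⊎∉ X v)) (λ v → ⨄ (finite-HalfEdge v) (κ v)))
          (↭-trans (++⁺ʳ _ (↭-trans (⨄-split J.finite-V X (λ v → core (∈⊎∉ X v)))
            (++⁺ (↭-trans (⨄-cong (finite-∈ J.finite-V X) (λ { (v , v∈) → ↭-reflexive (cong core (∈⊎∉-∈ X v∈)) }))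
                   (⨄-++ (finite-∈ J.finite-V X) ports sides))
                 (⨄-cong (finite-∉ J.finite-V X) (λ { (v , v∉) → ↭-reflexive (cong core (∈⊎∉-∉ X v∉)) })))))
            (solve 4 (λ p s q k → ((p ⊕ s) ⊕ q) ⊕ k ⊜ (q ⊕ p) ⊕ (k ⊕ s)) ↭-refl
              (⨄ (finite-∈ J.finite-V X) ports) (⨄ (finite-∈ J.finite-V X) sides)
              (⨄ (finite-∉ J.finite-V X) ([_] ∘ port ∘ inj₁))
              (⨄ J.finite-V (λ v → ⨄ (finite-HalfEdge v) (κ v)))))))
        where
        finite-triangles = finite-Σ (finite-∈ J.finite-V X) (λ _ → finite-Fin3)
        ports sides : Σ J.V (Defs._∈ X) → List V
        ports v = ⨄ finite-Fin3 (λ i → [ port (inj₂ (v , i)) ])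
        sides v = ⨄ finite-Fin3 (λ i → side (v , i))

Link⇒Path : ∀ {G a b} (k : Link G a b) → ∃ λ s → Path (Graph.Adjacent G) odd a b s × s ↭ b ∷ Link.interior k
Link⇒Path {G} {a} {b} k with reverse (Adjacent-sym {G}) (Link.leg₂ k)
... | j , f , rev = κ₁ ++ τ₂ ∷ j , leg₁ ◅◅ ((edge , joins) ∷ f) ,
  exchange (↭-sym rev) (solve 5 (λ κ₁ κ₂ t j b → (κ₁ ⊕ t ⊕ j) ⊕ (b ⊕ κ₂) ⊜ (b ⊕ κ₁ ⊕ κ₂) ⊕ (t ⊕ j))
    ↭-refl κ₁ κ₂ [ τ₂ ] j [ b ])
  where open Link k

-- Every edge of J is represented by a single edge of G: the subdivision vertices
-- lie on the legs of the gadgets, which stand for the vertices of J.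
record Model (J : Graph) (cubic : Cubic J) (G : Graph) : Set where
  private
    module J = Graph J
    module G = Graph G
  field
    edge           : J.E → G.E
    edge-injective : ∀ {e f} → edge e ≡ edge f → e ≡ f
    terminal       : ∀ v → HalfEdge J cubic v → G.V
    joins          : ∀ e → Joins G (edge e) (terminal _ (half₁ J cubic e)) (terminal _ (half₂ J cubic e))

  terminals : ∀ v → Fin 3 → G.V
  terminals v i = terminal v (halfEdge J cubic v i)

  field
    node    : J.V → List G.V
    gadget  : ∀ v → Gadget G.Adjacent (terminals v 0F) (terminals v 1F) (terminals v 2F) (node v)
    {rest}  : List G.V
    matched : Matched G.Adjacent rest
    cover   : ⨄ J.finite-V node ++ rest ↭ elements G.finite-V

Expansion⇒Model : ∀ {J cubic X G} → ∃ (EdgeInjective {(J , cubic) ^ X ⊙K₄} {G}) → Model J cubic G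
Expansion⇒Model {J} {cubic} {X} {G} (E , injective) = record
  { edge           = Link.edge ∘ link ∘ inj₁
  ; edge-injective = inj₁-injective ∘ injective
  ; terminal       = terminal
  ; joins          = λ e → Link.joins (link (inj₁ e))
  ; node           = λ v → core port side κ (∈⊎∉ X v) ++ ⨄ (finite-HalfEdge J cubic v) (κ v)
  ; gadget         = λ v → gadget (∈⊎∉ X v) leg
  ; matched        = matched
  ; cover          = ↭-trans (++⁺ʳ rest (↭-sym (regroup port side κ (Link.interior ∘ link) (λ _ → refl) (λ _ → refl))))
      (↭-trans (solve 3 (λ a b c → (a ⊕ b) ⊕ c ⊜ a ⊕ b ⊕ c) ↭-refl
        (⨄ L.finite-V ([_] ∘ port)) (⨄ L.finite-E (Link.interior ∘ link)) rest) cover)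
  }
  where
  open Expansion E
  module J = Graph J
  module G = Graph G
  open Triangles J cubic X
  module L = Graph L
  terminal : ∀ v → HalfEdge J cubic v → G.V
  terminal _ (e , inj₁ refl) = Link.τ₁ (link (inj₁ e))
  terminal _ (e , inj₂ refl) = Link.τ₂ (link (inj₁ e))
  κ : ∀ v → HalfEdge J cubic v → List G.V
  κ _ (e , inj₁ refl) = Link.κ₁ (link (inj₁ e))
  κ _ (e , inj₂ refl) = Link.κ₂ (link (inj₁ e))
  side : Σ J.V (Defs._∈ X) × Fin 3 → List G.V
  side t = Link.interior (link (inj₂ t))
  leg : ∀ {v} h → Path G.Adjacent even (port (attach (∈⊎∉ X v) h)) (terminal v h) (κ v h)
  leg (e , inj₁ refl) = Link.leg₁ (link (inj₁ e))
  leg (e , inj₂ refl) = Link.leg₂ (link (inj₁ e))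
  gadget : ∀ {v} (s : v Defs.∈ X ⊎ v Defs.∉ X) →
    (∀ h → Path G.Adjacent even (port (attach s h)) (terminal v h) (κ v h)) →
    Gadget G.Adjacent (terminal v (halfEdge J cubic v 0F)) (terminal v (halfEdge J cubic v 1F))
      (terminal v (halfEdge J cubic v 2F)) (core port side κ s ++ ⨄ (finite-HalfEdge J cubic v) (κ v))
  gadget {v} (inj₂ v∉) leg = claw (leg (h 0F)) (leg (h 1F)) (leg (h 2F)) [] ↭-refl
    where h = halfEdge J cubic v
  gadget {v} (inj₁ v∈) leg with Link⇒Path (link (inj₂ ((v , v∈) , 0F))) | Link⇒Path (link (inj₂ ((v , v∈) , 1F)))
                              | Link⇒Path (link (inj₂ ((v , v∈) , 2F)))
  ... | s₀ , g₀ , eq₀ | s₁ , g₁ , eq₁ | s₂ , g₂ , eq₂ = triangle (leg′ 0F) (leg′ 1F) (leg′ 2F) g₀ g₁ g₂ []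
    (↭-trans (++⁺ˡ (k 0F) (++⁺ˡ (k 1F) (++⁺ˡ (k 2F) (++⁺ eq₀ (++⁺ eq₁ (++⁺ʳ [] eq₂))))))
      (solve 9 (λ a b c p q r s t u → a ⊕ b ⊕ c ⊕ (q ⊕ s) ⊕ (r ⊕ t) ⊕ (p ⊕ u) ⊕ ∅
                 ⊜ ((p ⊕ q ⊕ r ⊕ ∅) ⊕ (s ⊕ t ⊕ u ⊕ ∅)) ⊕ (a ⊕ b ⊕ c ⊕ ∅)) ↭-refl
        (k 0F) (k 1F) (k 2F) [ corner 0F ] [ corner 1F ] [ corner 2F ]
        (side ((v , v∈) , 0F)) (side ((v , v∈) , 1F)) (side ((v , v∈) , 2F))))
    where
    k : Fin 3 → List G.V
    k i = κ v (halfEdge J cubic v i)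
    corner : Fin 3 → G.V
    corner i = port (inj₂ ((v , v∈) , i))
    leg′ : ∀ i → Path G.Adjacent even (corner i) (terminal v (halfEdge J cubic v i)) (k i)
    leg′ i = subst (λ j → Path G.Adjacent even (corner j) (terminal v (halfEdge J cubic v i)) (k i))
      (Inverse.strictlyInverseˡ (cubic v) i) (leg (halfEdge J cubic v i))

Matched-⨄ : ∀ {A V : Set} {_∼_ : V → V → Set} (F : Finite A) (f : A → List V) →
            (∀ a → Matched _∼_ (f a)) → Matched _∼_ (⨄ F f)
Matched-⨄ {V = V} {_∼_} (n , α) f h = go (f ∘ Inverse.from α) (h ∘ Inverse.from α)
  where
  go : ∀ {n} (g : Fin n → List V) → (∀ i → Matched _∼_ (g i)) → Matched _∼_ (⨄ (n , ↔-refl) g)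
  go {zero}  g h = []
  go {suc n} g h = Matched-++ (h zero) (go (g ∘ suc) (h ∘ suc))

cycle3 : Fin 3 → Fin 3
cycle3 0F = 1F
cycle3 1F = 2F
cycle3 2F = 0F

module Parts {V : Set} {_∼_ : V → V → Set} {t : Fin 3 → V} {R : List V} where

  isTriangle : Gadget _∼_ (t 0F) (t 1F) (t 2F) R → Bool
  isTriangle (claw _ _ _ _ _)             = false
  isTriangle (triangle _ _ _ _ _ _ _ _) = true

  legs : Gadget _∼_ (t 0F) (t 1F) (t 2F) R → Fin 3 → List V
  legs (claw {k₁ = k₁} {k₂} {k₃} _ _ _ _ _) 0F = k₁
  legs (claw {k₁ = k₁} {k₂} {k₃} _ _ _ _ _) 1F = k₂
  legs (claw {k₁ = k₁} {k₂} {k₃} _ _ _ _ _) 2F = k₃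
  legs (triangle {k₁ = k₁} {k₂} {k₃} _ _ _ _ _ _ _ _) 0F = k₁
  legs (triangle {k₁ = k₁} {k₂} {k₃} _ _ _ _ _ _ _ _) 1F = k₂
  legs (triangle {k₁ = k₁} {k₂} {k₃} _ _ _ _ _ _ _ _) 2F = k₃

  extra : Gadget _∼_ (t 0F) (t 1F) (t 2F) R → List V
  extra (claw {m = m} _ _ _ _ _)           = m
  extra (triangle {m = m} _ _ _ _ _ _ _ _) = m

  extra-matched : ∀ g → Matched _∼_ (extra g)
  extra-matched (claw _ _ _ n _)           = n
  extra-matched (triangle _ _ _ _ _ _ n _) = n

  centre : ∀ g → T (not (isTriangle g)) → V
  centre (claw {q} _ _ _ _ _) _ = q

  corner : ∀ g → T (isTriangle g) → Fin 3 → V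
  corner (triangle {a} {b} {c} _ _ _ _ _ _ _ _) _ 0F = a
  corner (triangle {a} {b} {c} _ _ _ _ _ _ _ _) _ 1F = b
  corner (triangle {a} {b} {c} _ _ _ _ _ _ _ _) _ 2F = c

  centre-leg : ∀ g p i → Path _∼_ even (centre g p) (t i) (legs g i)
  centre-leg (claw f₁ f₂ f₃ _ _) _ 0F = f₁
  centre-leg (claw f₁ f₂ f₃ _ _) _ 1F = f₂
  centre-leg (claw f₁ f₂ f₃ _ _) _ 2F = f₃

  corner-leg : ∀ g p i → Path _∼_ even (corner g p i) (t i) (legs g i)
  corner-leg (triangle f₁ f₂ f₃ _ _ _ _ _) _ 0F = f₁
  corner-leg (triangle f₁ f₂ f₃ _ _ _ _ _) _ 1F = f₂
  corner-leg (triangle f₁ f₂ f₃ _ _ _ _ _) _ 2F = f₃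

  sides : ∀ g → T (isTriangle g) → Fin 3 → List V
  sides (triangle {s₁ = s₁} {s₂} {s₃} _ _ _ _ _ _ _ _) _ 0F = s₁
  sides (triangle {s₁ = s₁} {s₂} {s₃} _ _ _ _ _ _ _ _) _ 1F = s₂
  sides (triangle {s₁ = s₁} {s₂} {s₃} _ _ _ _ _ _ _ _) _ 2F = s₃

  side-path : ∀ g p i → Path _∼_ odd (corner g p i) (corner g p (cycle3 i)) (sides g p i)
  side-path (triangle _ _ _ g₁ g₂ g₃ _ _) _ 0F = g₁
  side-path (triangle _ _ _ g₁ g₂ g₃ _ _) _ 1F = g₂
  side-path (triangle _ _ _ g₁ g₂ g₃ _ _) _ 2F = g₃

  claw-cover : ∀ g p → centre g p ∷ ⨄ finite-Fin3 (legs g) ++ extra g ↭ R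
  claw-cover (claw {q} {k₁} {k₂} {k₃} {m} _ _ _ _ eq) _ = ↭-trans
    (solve 5 (λ q a b c m → q ⊕ (a ⊕ b ⊕ c ⊕ ∅) ⊕ m ⊜ q ⊕ a ⊕ b ⊕ c ⊕ m) ↭-refl [ q ] k₁ k₂ k₃ m) eq

  triangle-cover : ∀ g p → ⨄ finite-Fin3 (sides g p) ++ ⨄ finite-Fin3 (legs g) ++ extra g ↭ R
  triangle-cover (triangle {k₁ = k₁} {k₂} {k₃} {s₁} {s₂} {s₃} {m} _ _ _ _ _ _ _ eq) _ = ↭-trans
    (solve 7 (λ a b c s t u m → (s ⊕ t ⊕ u ⊕ ∅) ⊕ (a ⊕ b ⊕ c ⊕ ∅) ⊕ m ⊜ a ⊕ b ⊕ c ⊕ s ⊕ t ⊕ u ⊕ m)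
      ↭-refl k₁ k₂ k₃ s₁ s₂ s₃ m) eq

Path⇒Link : ∀ {G a b s} → Path (Graph.Adjacent G) odd a b s → Σ (Link G a b) λ k → s ↭ b ∷ Link.interior k
Path⇒Link {b = b} {s = _ ∷ _} f with unsnoc f
... | _ , k , g , (e , j) , eq = record { edge = e ; leg₁ = g ; leg₂ = [] ; joins = j } ,
  ↭-trans (↭-reflexive eq) (solve 2 (λ k b → k ⊕ b ⊜ b ⊕ k ⊕ ∅) ↭-refl k [ b ])

-- Links of edges that are not parallel use different edges of `G` anyway, by disjointness of ports
-- and interiors.
Distinct : ∀ {L G} → Expansion L G → Set
Distinct {L} X = ∀ {e f} → Parallel L e f → Link.edge (link e) ≡ Link.edge (link f) → e ≡ f
  where open Expansion X

module _ {J : Graph} {cubic : Cubic J} (X : Subset (Graph.V J)) where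
  private
    module J = Graph J
    L = (J , cubic) ^ X ⊙K₄
    module L = Graph L

  origin : L.V → J.V
  origin = [ proj₁ , proj₁ ∘ proj₁ ]′

  origin-end₁ : ∀ e → origin (L.end₁ (inj₁ e)) ≡ J.end₁ e
  origin-end₁ e with ∈⊎∉ X (J.end₁ e)
  ... | inj₁ _ = refl
  ... | inj₂ _ = refl

  origin-end₂ : ∀ e → origin (L.end₂ (inj₁ e)) ≡ J.end₂ e
  origin-end₂ e with ∈⊎∉ X (J.end₂ e)
  ... | inj₁ _ = refl
  ... | inj₂ _ = refl

  triangle-end₂ : ∀ v i → L.end₂ (inj₂ (v , i)) ≡ inj₂ (v , cycle3 i)
  triangle-end₂ v 0F = refl
  triangle-end₂ v 1F = refl
  triangle-end₂ v 2F = refl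

  -- `origin` sends both ends of a triangle side to the same vertex, while an edge of the loopless
  -- `J` keeps two different origins.
  star∦triangle : ∀ {e t} → ¬ Parallel L (inj₁ e) (inj₂ t)
  star∦triangle {e} {v , i} p = J.loopless e (trans (at (L.end₁ (inj₁ e)) (origin-end₁ e) (proj₁ ends))
    (sym (at (L.end₂ (inj₁ e)) (origin-end₂ e) (proj₂ ends))))
    where
    within : ∀ {x y} → L.end₁ (inj₁ e) ≡ x × L.end₂ (inj₁ e) ≡ y → origin x ≡ proj₁ v → origin y ≡ proj₁ v →
             origin (L.end₁ (inj₁ e)) ≡ proj₁ v × origin (L.end₂ (inj₁ e)) ≡ proj₁ v
    within (p , q) r s = trans (cong origin p) r , trans (cong origin q) s
    end₂∈ : origin (L.end₂ (inj₂ (v , i))) ≡ proj₁ v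
    end₂∈ = cong origin (triangle-end₂ v i)
    ends : origin (L.end₁ (inj₁ e)) ≡ proj₁ v × origin (L.end₂ (inj₁ e)) ≡ proj₁ v
    ends with parallel-ends {L} {inj₁ e} {inj₂ (v , i)} p
    ... | inj₁ eqs = within eqs refl end₂∈
    ... | inj₂ eqs = within eqs end₂∈ refl
    at : ∀ x {u} → origin x ≡ u → origin x ≡ proj₁ v → u ≡ proj₁ v
    at x refl eq = eq

  -- A side is determined by its first corner. With the ends exchanged, two steps round a triangle
  -- would lead back to the start.
  triangle∥triangle : ∀ {t u} → Parallel L (inj₂ t) (inj₂ u) → inj₂ {A = J.E} t ≡ inj₂ u
  triangle∥triangle {v , i} {w , j} p with parallel-ends {L} {inj₂ (v , i)} {inj₂ (w , j)} p
  ... | inj₁ (eq , _)    = cong inj₂ (inj₂-injective eq)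
  ... | inj₂ (eq₁ , eq₂) = contradiction
    (trans (cong proj₂ (inj₂-injective (trans eq₁ (triangle-end₂ w j))))
      (cong (cycle3 ∘ proj₂) (inj₂-injective (trans (sym eq₂) (triangle-end₂ v i))))) (period i)
    where
    period : ∀ i → i ≢ cycle3 (cycle3 i)
    period 0F ()
    period 1F ()
    period 2F ()

Model⇒Expansion : ∀ {J cubic G} → Model J cubic G →
                  ∃ λ X → ∃ (Distinct {(J , cubic) ^ X ⊙K₄} {G})
Model⇒Expansion {J} {cubic} {G} M = X , record
  { port    = port
  ; link    = link
  ; matched = Matched-++ (Matched-⨄ J.finite-V (λ v → At.extra v (gadget v)) (λ v → At.extra-matched v (gadget v))) matched
  ; cover   = ↭-trans (exchange (++⁺ (regroup port side κ (Link.interior ∘ link) (λ _ → refl) (λ _ → refl))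
        (↭-sym (⨄-++ J.finite-V blocks (λ v → At.extra v (gadget v)))))
      (solve 6 (λ p i c x r n → (p ⊕ i ⊕ x ⊕ r) ⊕ (c ⊕ n) ⊜ (n ⊕ r) ⊕ ((p ⊕ i) ⊕ (c ⊕ x))) ↭-refl
        (⨄ L.finite-V ([_] ∘ port)) (⨄ L.finite-E (Link.interior ∘ link)) (⨄ J.finite-V blocks)
        (⨄ J.finite-V (λ v → At.extra v (gadget v))) rest (⨄ J.finite-V (λ v → blocks v ++ At.extra v (gadget v)))))
      (↭-trans (++⁺ʳ rest (⨄-cong J.finite-V (λ v → block-cover v (∈⊎∉ X v)))) cover)
  } , distinct
  where
  open Model M
  module J = Graph J
  module G = Graph G
  -- The gadgets decide which vertices become triangles, so the member of `K₄ (J)` found may differ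
  -- from the one started with.
  X : Subset J.V
  X v = Parts.isTriangle {t = terminals v} (gadget v)
  open Triangles J cubic X
  module L = Graph L
  module At v = Parts {G.V} {G.Adjacent} {terminals v} {node v}
  h = halfEdge J cubic
  port : L.V → G.V
  port (inj₁ (v , p))       = At.centre v (gadget v) p
  port (inj₂ ((v , p) , i)) = At.corner v (gadget v) p i
  κ : ∀ v → HalfEdge J cubic v → List G.V
  κ v k = At.legs v (gadget v) (Inverse.to (cubic v) k)
  leg : ∀ {v} (s : v Defs.∈ X ⊎ v Defs.∉ X) k → Path G.Adjacent even (port (attach s k)) (terminal v k) (κ v k)
  leg {v} (inj₁ p) k = subst
    (λ k′ → Path G.Adjacent even (At.corner v (gadget v) p (Inverse.to (cubic v) k)) (terminal v k′) (κ v k))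
    (Inverse.strictlyInverseʳ (cubic v) k) (At.corner-leg v (gadget v) p (Inverse.to (cubic v) k))
  leg {v} (inj₂ p) k = subst (λ k′ → Path G.Adjacent even (At.centre v (gadget v) p) (terminal v k′) (κ v k))
    (Inverse.strictlyInverseʳ (cubic v) k) (At.centre-leg v (gadget v) p (Inverse.to (cubic v) k))
  sideLink : ∀ v p i → Σ (Link G (At.corner v (gadget v) p i) (At.corner v (gadget v) p (cycle3 i)))
    λ k → At.sides v (gadget v) p i ↭ At.corner v (gadget v) p (cycle3 i) ∷ Link.interior k
  sideLink v p i = Path⇒Link (At.side-path v (gadget v) p i)
  link : ∀ e → Link G (port (L.end₁ e)) (port (L.end₂ e))
  link (inj₁ e) = record
    { edge  = edge e
    ; leg₁  = leg (∈⊎∉ X (J.end₁ e)) (half₁ J cubic e)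
    ; leg₂  = leg (∈⊎∉ X (J.end₂ e)) (half₂ J cubic e)
    ; joins = joins e
    }
  -- Separate clauses make the cyclic successor inside the triangle replacement compute.
  link (inj₂ ((v , p) , 0F)) = proj₁ (sideLink v p 0F)
  link (inj₂ ((v , p) , 1F)) = proj₁ (sideLink v p 1F)
  link (inj₂ ((v , p) , 2F)) = proj₁ (sideLink v p 2F)
  side : Σ J.V (Defs._∈ X) × Fin 3 → List G.V
  side t = Link.interior (link (inj₂ t))
  blocks : J.V → List G.V
  blocks v = core port side κ (∈⊎∉ X v) ++ ⨄ (finite-HalfEdge J cubic v) (κ v)

  legs-κ : ∀ v → ⨄ (finite-HalfEdge J cubic v) (κ v) ↭ ⨄ finite-Fin3 (At.legs v (gadget v))
  legs-κ v = ↭-sym (⨄-↔ (finite-HalfEdge J cubic v) finite-Fin3 (cubic v) (At.legs v (gadget v)))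

  block-cover : ∀ v (s : v Defs.∈ X ⊎ v Defs.∉ X) →
    (core port side κ s ++ ⨄ (finite-HalfEdge J cubic v) (κ v)) ++ At.extra v (gadget v) ↭ node v
  block-cover v (inj₂ p) = ↭-trans (prep _ (++⁺ʳ _ (legs-κ v))) (At.claw-cover v (gadget v) p)
  block-cover v (inj₁ p) = ↭-trans
    (↭-trans (++⁺ʳ x (++⁺ˡ (core port side κ (inj₁ p)) (legs-κ v))) (exchange
      (↭-sym (++⁺ (proj₂ (sideLink v p 0F)) (++⁺ (proj₂ (sideLink v p 1F)) (proj₂ (sideLink v p 2F)))))
      (solve 11 (λ a b c p q r s t u k x →
          ((((a ⊕ b ⊕ c ⊕ ∅) ⊕ (p ⊕ q ⊕ r ⊕ ∅)) ⊕ k) ⊕ x) ⊕ (s ⊕ t ⊕ u)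
        ⊜ ((s ⊕ t ⊕ u ⊕ ∅) ⊕ k ⊕ x) ⊕ ((b ⊕ p) ⊕ (c ⊕ q) ⊕ (a ⊕ r))) ↭-refl
        [ c 0F ] [ c 1F ] [ c 2F ] (i 0F) (i 1F) (i 2F) (s 0F) (s 1F) (s 2F)
        (⨄ finite-Fin3 (At.legs v (gadget v))) x)))
    (At.triangle-cover v (gadget v) p)
    where
    x = At.extra v (gadget v)
    c = At.corner v (gadget v) p
    s = At.sides v (gadget v) p
    i : Fin 3 → List G.V
    i k = side ((v , p) , k)

  distinct : ∀ {e f} → Parallel L e f → Link.edge (link e) ≡ Link.edge (link f) → e ≡ f
  distinct {inj₁ e} {inj₁ f} _ eq = cong inj₁ (edge-injective eq)
  distinct {inj₁ e} {inj₂ t} p _  = contradiction p (star∦triangle {J} {cubic} X {e} {t})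
  distinct {inj₂ t} {inj₁ e} (u , v , j , k) _ = contradiction (u , v , k , j) (star∦triangle {J} {cubic} X {e} {t})
  distinct {inj₂ t} {inj₂ u} p _  = triangle∥triangle {J} {cubic} X {t} {u} p

-- From expansions to conformal minors

module Image {A B : Set} (F : Finite A) (_≟_ : DecidableEquality B) (f : A → B) where

  preimage? : ∀ b → Dec (∃ λ a → f a ≡ b)
  preimage? b = map′ (λ { (i , eq) → Inverse.from (proj₂ F) i , eq })
    (λ { (a , eq) → Inverse.to (proj₂ F) a , trans (cong f (Inverse.strictlyInverseʳ (proj₂ F) a)) eq })
    (any? λ i → f (Inverse.from (proj₂ F) i) ≟ b)

  image : Subset B
  image b = ⌊ preimage? b ⌋

  f∈image : ∀ a → f a Defs.∈ image
  f∈image a = fromWitness {a? = preimage? (f a)} (a , refl)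

  preimage : ∀ {b} → b Defs.∈ image → ∃ λ a → f a ≡ b
  preimage {b} = toWitness {a? = preimage? b}

  image↔ : (∀ {a a′} → f a ≡ f a′ → a ≡ a′) → Σ B (Defs._∈ image) ↔ A
  image↔ injective = mk↔ₛ′ (λ { (b , p) → proj₁ (preimage p) }) (λ a → f a , f∈image a)
    (λ a → injective (proj₂ (preimage (f∈image a))))
    (λ { (b , p) → Σ-≡ {X = image} (proj₂ (preimage p)) })

-- Unlike for Path, l lists neither end.
data Walk (G : Graph) : Graph.V G → Graph.V G → List (Graph.V G) → Set where
  single : ∀ {a b} e → Joins G e a b → Walk G a b []
  cons   : ∀ {a b v l} e → Joins G e a v → Walk G v b l → Walk G a b (v ∷ l)

module _ {G : Graph} where
  open Graph G using (V; E; Adjacent)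

  nthEdge : ∀ {a b l} → Walk G a b l → Fin (suc (length l)) → E
  nthEdge (single e _)   zero    = e
  nthEdge (cons e _ w) zero    = e
  nthEdge (cons e _ w) (suc k) = nthEdge w k

  before : V → (l : List V) → Fin (suc (length l)) → V
  before a l zero    = a
  before a l (suc k) = lookup l k

  after : V → (l : List V) → Fin (suc (length l)) → V
  after b l k with view k
  ... | ‵fromℕ     = b
  ... | ‵inject₁ j = lookup l j

  before-∷ : ∀ {a} v l k → before a (v ∷ l) (suc k) ≡ before v l k
  before-∷ v l zero    = refl
  before-∷ v l (suc k) = refl

  after-∷ : ∀ {b} v l k → after b (v ∷ l) (suc k) ≡ after b l k
  after-∷ v l k with view k
  ... | ‵fromℕ     = refl
  ... | ‵inject₁ j = refl

  nthEdge-joins : ∀ {a b l} (w : Walk G a b l) k → Joins G (nthEdge w k) (before a l k) (after b l k)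
  nthEdge-joins (single e j)                   zero    = j
  nthEdge-joins (cons e j w)                 zero    = j
  nthEdge-joins {a} (cons {v = v} {l} e j w) (suc k) =
    subst₂ (Joins G (nthEdge w k)) (sym (before-∷ {a} v l k)) (sym (after-∷ v l k)) (nthEdge-joins w k)

  Path⇒Walk : ∀ {p e x y b k} → Joins G e x y → Path Adjacent p y b k →
    ∃ λ i → y ∷ k ↭ b ∷ i × Σ (Walk G x b i) λ w → i ≡ [] → nthEdge w zero ≡ e
  Path⇒Walk j [] = [] , ↭-refl , single _ j , λ _ → refl
  Path⇒Walk {y = y} {b} j ((_ , j′) ∷ f) with Path⇒Walk j′ f
  ... | i , eq , w , _ = y ∷ i , ↭-trans (prep y eq) (swap y b ↭-refl) , cons _ j w , λ ()

  _◅◅ʷ_ : ∀ {p a x b k i} → Path Adjacent p a x k → Walk G x b i → Walk G a b (k ++ i)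
  []            ◅◅ʷ w = w
  ((e , j) ∷ f) ◅◅ʷ w = cons e j (f ◅◅ʷ w)

  -- The distinguished edge matters only if there are no inner vertices, when it is the whole walk;
  -- otherwise the inner vertices tell walks apart.
  Link⇒Walk : ∀ {a b} (k : Link G a b) → ∃ λ l → l ↭ Link.interior k ×
    Σ (Walk G a b l) λ w → l ≡ [] → nthEdge w zero ≡ Link.edge k
  Link⇒Walk {a} {b} k with reverse (Adjacent-sym {G}) (Link.leg₂ k)
  ... | j , f , rev with Path⇒Walk (Link.joins k) f
  ...   | i , eq , w , first = Link.κ₁ k ++ i , ++⁺ˡ (Link.κ₁ k) (drop-∷ (↭-trans (↭-sym eq) (↭-sym rev))) ,
    Link.leg₁ k ◅◅ʷ w , only (Link.leg₁ k)
    where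
    only : ∀ {p κ} (g : Path Adjacent p a (Link.τ₁ k) κ) → κ ++ i ≡ [] → nthEdge (g ◅◅ʷ w) zero ≡ Link.edge k
    only [] eq = first eq
    only (_ ∷ _) ()

  Path-even-length : ∀ {a x k} → Path Adjacent even a x k → 2 ∣ length k
  Path-even-length []          = 2 ∣0
  Path-even-length (_ ∷ _ ∷ f) = ∣m∣n⇒∣m+n (divides 1 refl) (Path-even-length f)

  interior-even : ∀ {a b} (k : Link G a b) → 2 ∣ length (Link.interior k)
  interior-even k = subst (2 ∣_) (sym (length-++ (Link.κ₁ k)))
    (∣m∣n⇒∣m+n (Path-even-length (Link.leg₁ k)) (Path-even-length (Link.leg₂ k)))

  matchedEdges : ∀ {m} → Matched Adjacent m → List E
  matchedEdges []               = []
  matchedEdges (pair (e , _) n) = e ∷ matchedEdges n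

  matchedEdge : ∀ {m} (n : Matched Adjacent m) {w} → w ∈ m →
                ∃₂ λ e w′ → e ∈ matchedEdges n × Joins G e w w′ × w′ ∈ m
  matchedEdge (pair (e , j) n) (here refl)         = e , _ , here refl , j , there (here refl)
  matchedEdge (pair (e , j) n) (there (here refl)) = e , _ , here refl , Joins-sym {G} j , here refl
  matchedEdge (pair _ n) (there (there w∈)) with matchedEdge n w∈
  ... | e , w′ , e∈ , j , w′∈ = e , w′ , there e∈ , j , there (there w′∈)

  matchedEdges-ends : ∀ {m} (n : Matched Adjacent m) {e w} → e ∈ matchedEdges n → Graph.Incident G w e → w ∈ m
  matchedEdges-ends (pair (e , j) n) (here refl) i = ends j i
    where
    ends : ∀ {a b l w} → Joins G e a b → Graph.Incident G w e → w ∈ a ∷ b ∷ l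
    ends (inj₁ (refl , refl)) (inj₁ refl) = here refl
    ends (inj₁ (refl , refl)) (inj₂ refl) = there (here refl)
    ends (inj₂ (refl , refl)) (inj₁ refl) = there (here refl)
    ends (inj₂ (refl , refl)) (inj₂ refl) = here refl
  matchedEdges-ends (pair _ n) (there e∈) i = there (there (matchedEdges-ends n e∈ i))

  matchedEdges-disjoint : ∀ {m} (n : Matched Adjacent m) → Unique m → ∀ {e f w} → e ∈ matchedEdges n → f ∈ matchedEdges n →
    Graph.Incident G w e → Graph.Incident G w f → e ≡ f
  matchedEdges-disjoint (pair _ n) u (here refl) (here refl) i k = refl
  matchedEdges-disjoint (pair (e , j) n) u (here refl) (there f∈) i k =
    contradiction
      (matchedEdges-ends n f∈ k) (Unique-disjoint (_ ∷ _ ∷ []) u (matchedEdges-ends (pair (e , j) []) (here refl) i))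
  matchedEdges-disjoint (pair (e , j) n) u (there e∈) (here refl) i k =
    contradiction
      (matchedEdges-ends n e∈ i) (Unique-disjoint (_ ∷ _ ∷ []) u (matchedEdges-ends (pair (e , j) []) (here refl) k))
  matchedEdges-disjoint (pair _ n) u (there e∈) (there f∈) i k =
    matchedEdges-disjoint n (Unique-tail (Unique-tail u)) e∈ f∈ i k

  Matched⇒Matchable : ∀ (X : Subset V) {m} → Matched Adjacent m → Unique m →
    (∀ {w} → w Defs.∉ X → w ∈ m) → (∀ {w} → w ∈ m → w Defs.∉ X) → Matchable (G - X)
  Matched⇒Matchable X n u ∉⇒∈ ∈⇒∉ = M , perfect
    where
    open DecMembership (finite⇒≟ (Graph.finite-E G)) using (_∈?_)
    M : Subset (Graph.E (G - X))
    M (e , _) = ⌊ e ∈? matchedEdges n ⌋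
    perfect : Graph.PerfectMatching (G - X) M
    perfect (w , w∉) with matchedEdge n (∉⇒∈ w∉)
    ... | e , w′ , e∈ , j , w′∈ =
      (e , Equivalence.from T-∧ (ends∉ j)) , (fromWitness {a? = e ∈? matchedEdges n} e∈ , up (Joins⇒Incident {G} j)) ,
      λ { {f , _} (f∈ , i) → Σ-≡ {X = λ e → ∁ X (Graph.end₁ G e) ∧ ∁ X (Graph.end₂ G e)}
        (matchedEdges-disjoint n u e∈ (toWitness {a? = f ∈? matchedEdges n} f∈) (Joins⇒Incident {G} j) (down i)) }
      where
      ends∉ : ∀ {e} → Joins G e w w′ → Graph.end₁ G e Defs.∉ X × Graph.end₂ G e Defs.∉ X
      ends∉ (inj₁ (refl , refl)) = w∉ , ∈⇒∉ w′∈
      ends∉ (inj₂ (refl , refl)) = ∈⇒∉ w′∈ , w∉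
      up : ∀ {e} → Graph.Incident G w (proj₁ e) → Graph.Incident (G - X) (w , w∉) e
      up (inj₁ eq) = inj₁ (Σ-≡ {X = ∁ X} eq)
      up (inj₂ eq) = inj₂ (Σ-≡ {X = ∁ X} eq)
      down : ∀ {e} → Graph.Incident (G - X) (w , w∉) e → Graph.Incident G w (proj₁ e)
      down (inj₁ eq) = inj₁ (cong proj₁ eq)
      down (inj₂ eq) = inj₂ (cong proj₁ eq)

-- Parallel edges in a subdivision

module _ (L : Graph) (s : Graph.E L → ℕ) where
  private
    S = subdivide L s
    module L = Graph L
    module S = Graph S

  -- Meaningful only for the vertices of the path replacing e.
  position : L.E → S.V → ℕ
  position e (inj₁ v) with finite⇒≟ L.finite-V v (L.end₁ e)
  ... | yes _ = 0
  ... | no _  = suc (s e)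
  position e (inj₂ (_ , i)) = suc (toℕ i)

  position-start : ∀ e k → position e (S.end₁ (e , k)) ≡ toℕ k
  position-start e (suc i) = refl
  position-start e zero with finite⇒≟ L.finite-V (L.end₁ e) (L.end₁ e)
  ... | yes _ = refl
  ... | no ≢  = contradiction refl ≢

  position-finish : ∀ e k → position e (S.end₂ (e , k)) ≡ suc (toℕ k)
  position-finish e k with view k
  ... | ‵inject₁ j = cong suc (sym (toℕ-inject₁ j))
  ... | ‵fromℕ with finite⇒≟ L.finite-V (L.end₂ e) (L.end₁ e)
  ...   | yes eq = contradiction (sym eq) (L.loopless e)
  ...   | no _   = cong suc (sym (toℕ-fromℕ (s e)))

  On : L.E → S.V → Set
  On e (inj₁ _)       = ⊤
  On e (inj₂ (f , _)) = f ≡ e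

  on-path : ∀ {x u} → S.Incident u x → On (proj₁ x) u
  on-path {_ , zero}  (inj₁ refl) = tt
  on-path {_ , suc _} (inj₁ refl) = refl
  on-path {e , k}     (inj₂ refl) with view k
  ... | ‵fromℕ     = tt
  ... | ‵inject₁ _ = refl

  finish-inner : ∀ e k → toℕ k < s e → ∃ λ j → S.end₂ (e , k) ≡ inj₂ (e , j)
  finish-inner e k k< with view k
  ... | ‵fromℕ     = contradiction k< (<-irrefl (toℕ-fromℕ (s e)))
  ... | ‵inject₁ j = j , refl

  finish-outer : ∀ e k → toℕ k ≡ s e → S.end₂ (e , k) ≡ inj₁ (L.end₂ e)
  finish-outer e k k≡ with view k
  ... | ‵fromℕ     = refl
  ... | ‵inject₁ j = contradiction (toℕ<n j) (<-irrefl (trans (sym (toℕ-inject₁ j)) k≡))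

  inner-end : ∀ x → (∃ λ i → S.Incident (inj₂ (proj₁ x , i)) x) ⊎ s (proj₁ x) ≡ 0
  inner-end (e , suc i) = inj₁ (i , inj₁ refl)
  inner-end (e , zero) with s e ≟ 0
  ... | yes eq = inj₂ eq
  ... | no ≢0  = let j , eq = finish-inner e zero (n≢0⇒n>0 ≢0) in inj₁ (j , inj₂ eq)

  -- Along the path of `e`, edge `k` leads from position `k` to `k + 1`; with the ends exchanged,
  -- each of the two indices would be the successor of the other.
  parallel-same : ∀ {e k k′} → Parallel S (e , k) (e , k′) → k ≡ k′
  parallel-same {e} {k} {k′} p with parallel-ends {S} p
  ... | inj₁ (eq , _)    = toℕ-injective (trans (sym (position-start e k)) (trans (cong (position e) eq) (position-start e k′)))
  ... | inj₂ (eq₁ , eq₂) = contradiction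
    (trans (cong suc (trans (sym (position-finish e k)) (trans (cong (position e) eq₂) (position-start e k′))))
      (trans (sym (position-finish e k′)) (trans (cong (position e) (sym eq₁)) (position-start e k))))
    (λ eq → <-irrefl (sym eq) (m<n⇒m<1+n (n<1+n (toℕ k))))

  short : ∀ e k → s e ≡ 0 → S.end₁ (e , k) ≡ inj₁ (L.end₁ e) × S.end₂ (e , k) ≡ inj₁ (L.end₂ e)
  short e k s≡0 = start k s≡0 , finish-outer e k (k≡s k s≡0)
    where
    start : ∀ k → s e ≡ 0 → S.end₁ (e , k) ≡ inj₁ (L.end₁ e)
    start zero    _   = refl
    start (suc i) s≡0 = contradiction (subst (toℕ i <_) s≡0 (toℕ<n i)) λ ()
    k≡s : ∀ k → s e ≡ 0 → toℕ k ≡ s e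
    k≡s zero    s≡0 = sym s≡0
    k≡s (suc i) s≡0 = contradiction (subst (toℕ i <_) s≡0 (toℕ<n i)) λ ()

  -- A subdivision vertex lies on the path of one edge of `L` only. If neither path has one, both
  -- are single edges and the parallelism descends to `L`.
  parallel-subdivide : ∀ {x y} → Parallel S x y →
    proj₁ x ≡ proj₁ y ⊎ s (proj₁ x) ≡ 0 × s (proj₁ y) ≡ 0 × Parallel L (proj₁ x) (proj₁ y)
  parallel-subdivide {x@(e , k)} {y@(f , l)} p with inner-end x | inner-end y
  ... | inj₁ (i , inc) | _ = inj₁ (on-path {y} (Parallel-incident {S} p inc))
  ... | inj₂ _ | inj₁ (i , inc) = inj₁ (sym (on-path {x} (Parallel-incident {S} (Parallel-sym {S} p) inc)))
  ... | inj₂ s≡0 | inj₂ s′≡0 with short e k s≡0 | short f l s′≡0 | parallel-ends {S} p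
  ...   | a , b | c , d | inj₁ (q , r) = inj₂ (s≡0 , s′≡0 , L.end₁ e , L.end₂ e , inj₁ (refl , refl) ,
    inj₁ (inj₁-injective (trans (sym c) (trans (sym q) a)) , inj₁-injective (trans (sym d) (trans (sym r) b))))
  ...   | a , b | c , d | inj₂ (q , r) = inj₂ (s≡0 , s′≡0 , L.end₁ e , L.end₂ e , inj₁ (refl , refl) ,
    inj₂ (inj₁-injective (trans (sym c) (trans (sym r) b)) , inj₁-injective (trans (sym d) (trans (sym q) a))))

Expansion⇒ConformalMinor : ∀ {L G} → ∃ (Distinct {L} {G}) → ConformalMinor L G
Expansion⇒ConformalMinor {L} {G} (E , distinct) =
  H , Matched⇒Matchable {G} Φ.image matched (Unique-++ʳ (⨄ S.finite-V ([_] ∘ φ)) covers!) outside⇒rest rest⇒outside ,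
  s , s-even , record { V↔ = Φ.image↔ φ-injective ; E↔ = Ψ.image↔ ψ-injective ; incident = λ v e → mk⇔ (down v e) (up v e) }
  where
  open Expansion E
  module L = Graph L
  module G = Graph G
  inner : L.E → List G.V
  inner e = proj₁ (Link⇒Walk (link e))
  inner↭ : ∀ e → inner e ↭ Link.interior (link e)
  inner↭ e = proj₁ (proj₂ (Link⇒Walk (link e)))
  walk : ∀ e → Walk G (port (L.end₁ e)) (port (L.end₂ e)) (inner e)
  walk e = proj₁ (proj₂ (proj₂ (Link⇒Walk (link e))))
  s : L.E → ℕ
  s e = length (inner e)
  s-even : ∀ e → 2 ∣ s e
  s-even e = subst (2 ∣_) (sym (↭-length (inner↭ e))) (interior-even (link e))
  S = subdivide L s
  module S = Graph S

  φ : S.V → G.V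
  φ (inj₁ v)       = port v
  φ (inj₂ (e , i)) = lookup (inner e) i
  ψ : S.E → G.E
  ψ (e , k) = nthEdge (walk e) k

  covers : ⨄ S.finite-V ([_] ∘ φ) ++ rest ↭ elements G.finite-V
  covers = ↭-trans (++⁺ʳ rest (↭-trans (⨄-⊎ L.finite-V finite-inner S.finite-V ([_] ∘ φ))
    (++⁺ˡ (⨄ L.finite-V ([_] ∘ port)) (↭-trans (⨄-Σ L.finite-E (λ e → s e , ↔-refl) finite-inner ([_] ∘ φ ∘ inj₂))
      (⨄-cong L.finite-E λ e → ↭-trans (↭-reflexive (trans (⨄-singletons (s e , ↔-refl) (lookup (inner e)))
        (tabulate-lookup (inner e)))) (inner↭ e))))))
    (↭-trans (solve 3 (λ a b c → (a ⊕ b) ⊕ c ⊜ a ⊕ b ⊕ c) ↭-refl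
      (⨄ L.finite-V ([_] ∘ port)) (⨄ L.finite-E (Link.interior ∘ link)) rest) cover)
    where finite-inner = finite-Σ L.finite-E λ e → s e , ↔-refl

  covers! : Unique (⨄ S.finite-V ([_] ∘ φ) ++ rest)
  covers! = Unique-resp-↭ (↭-sym covers) (elements-unique G.finite-V)

  φ-injective : ∀ {x y} → φ x ≡ φ y → x ≡ y
  φ-injective = ⨄-Unique⇒injective S.finite-V φ (Unique-++ˡ (⨄ S.finite-V ([_] ∘ φ)) covers!)

  ψ-joins : ∀ x → Joins G (ψ x) (φ (S.end₁ x)) (φ (S.end₂ x))
  ψ-joins x@(e , k) = subst₂ (Joins G (ψ x)) (at-start k) (at-finish k) (nthEdge-joins {G} (walk e) k)
    where
    at-start : ∀ k → before {G} (port (L.end₁ e)) (inner e) k ≡ φ (S.end₁ (e , k))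
    at-start zero    = refl
    at-start (suc i) = refl
    at-finish : ∀ k → after {G} (port (L.end₂ e)) (inner e) k ≡ φ (S.end₂ (e , k))
    at-finish k with view k
    ... | ‵fromℕ     = refl
    ... | ‵inject₁ _ = refl

  ψ-parallel : ∀ {x y} → ψ x ≡ ψ y → Parallel S x y
  ψ-parallel {x} {y} eq = S.end₁ x , S.end₂ x , inj₁ (refl , refl) ,
    compare (subst (λ e → Joins G e (φ (S.end₁ x)) (φ (S.end₂ x))) eq (ψ-joins x)) (ψ-joins y)
    where
    compare : ∀ {e a b c d} → Joins G e (φ a) (φ b) → Joins G e (φ c) (φ d) → c ≡ a × d ≡ b ⊎ c ≡ b × d ≡ a
    compare (inj₁ (p , q)) (inj₁ (r , t)) = inj₁ (φ-injective (trans (sym r) p) , φ-injective (trans (sym t) q))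
    compare (inj₁ (p , q)) (inj₂ (r , t)) = inj₂ (φ-injective (trans (sym t) q) , φ-injective (trans (sym r) p))
    compare (inj₂ (p , q)) (inj₁ (r , t)) = inj₂ (φ-injective (trans (sym r) p) , φ-injective (trans (sym t) q))
    compare (inj₂ (p , q)) (inj₂ (r , t)) = inj₁ (φ-injective (trans (sym t) q) , φ-injective (trans (sym r) p))

  ψ-short : ∀ e k → s e ≡ 0 → ψ (e , k) ≡ Link.edge (link e)
  ψ-short e zero    s≡0 = proj₂ (proj₂ (proj₂ (Link⇒Walk (link e)))) (empty (inner e) s≡0)
    where
    empty : ∀ (l : List G.V) → length l ≡ 0 → l ≡ []
    empty [] _ = refl
  ψ-short e (suc i) s≡0 = contradiction (subst (toℕ i <_) s≡0 (toℕ<n i)) λ ()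

  -- Equal images have equal ends and so come from parallel edges. On one path `parallel-same`
  -- decides; two unsubdivided edges carry their distinguished edges, which `distinct` separates.
  ψ-injective : ∀ {x y} → ψ x ≡ ψ y → x ≡ y
  ψ-injective {x} {y} eq with parallel-subdivide L s {x} {y} (ψ-parallel {x} {y} eq)
  ... | inj₁ refl = cong (proj₁ x ,_) (parallel-same L s (ψ-parallel {x} {y} eq))
  ... | inj₂ (s≡0 , s′≡0 , p) with distinct p (trans (sym (ψ-short _ (proj₂ x) s≡0)) (trans eq (ψ-short _ (proj₂ y) s′≡0)))
  ...   | refl = cong (proj₁ x ,_) (parallel-same L s (ψ-parallel {x} {y} eq))

  module Φ = Image S.finite-V (finite⇒≟ G.finite-V) φ
  module Ψ = Image S.finite-E (finite⇒≟ G.finite-E) ψ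

  ends∈ : ∀ {e u v} → Joins G e (φ u) (φ v) → G.end₁ e Defs.∈ Φ.image × G.end₂ e Defs.∈ Φ.image
  ends∈ {u = u} {v} (inj₁ (p , q)) =
    subst (Defs._∈ Φ.image) (sym p) (Φ.f∈image u) , subst (Defs._∈ Φ.image) (sym q) (Φ.f∈image v)
  ends∈ {u = u} {v} (inj₂ (p , q)) =
    subst (Defs._∈ Φ.image) (sym p) (Φ.f∈image v) , subst (Defs._∈ Φ.image) (sym q) (Φ.f∈image u)

  H : Subgraph G
  H = record { vertices = Φ.image ; edges = Ψ.image ; closed = closed }
    where
    closed : ∀ e → e Defs.∈ Ψ.image → G.end₁ e Defs.∈ Φ.image × G.end₂ e Defs.∈ Φ.image
    closed e e∈ = let x , eq = Ψ.preimage e∈ in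
      ends∈ {u = S.end₁ x} {S.end₂ x} (subst (λ f → Joins G f (φ (S.end₁ x)) (φ (S.end₂ x))) eq (ψ-joins x))

  module H = Graph (Subgraph.graph H)

  toV : H.V → S.V
  toV = Inverse.to (Φ.image↔ φ-injective)
  toE : H.E → S.E
  toE = Inverse.to (Ψ.image↔ ψ-injective)
  φ-toV : ∀ v → φ (toV v) ≡ proj₁ v
  φ-toV (v , v∈) = proj₂ (Φ.preimage v∈)
  ψ-toE : ∀ e → ψ (toE e) ≡ proj₁ e
  ψ-toE (e , e∈) = proj₂ (Ψ.preimage e∈)

  down : ∀ v e → H.Incident v e → S.Incident (toV v) (toE e)
  down v e inc = pick (subst (λ f → Joins G f (φ (S.end₁ (toE e))) (φ (S.end₂ (toE e)))) (ψ-toE e) (ψ-joins (toE e)))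
    (lower inc)
    where
    lower : H.Incident v e → G.Incident (φ (toV v)) (proj₁ e)
    lower (inj₁ p) = inj₁ (trans (cong proj₁ p) (sym (φ-toV v)))
    lower (inj₂ p) = inj₂ (trans (cong proj₁ p) (sym (φ-toV v)))
    pick : ∀ {f a b c} → Joins G f (φ a) (φ b) → G.Incident (φ c) f → a ≡ c ⊎ b ≡ c
    pick (inj₁ (p , q)) (inj₁ r) = inj₁ (φ-injective (trans (sym p) r))
    pick (inj₁ (p , q)) (inj₂ r) = inj₂ (φ-injective (trans (sym q) r))
    pick (inj₂ (p , q)) (inj₁ r) = inj₂ (φ-injective (trans (sym p) r))
    pick (inj₂ (p , q)) (inj₂ r) = inj₁ (φ-injective (trans (sym q) r))

  up : ∀ v e → S.Incident (toV v) (toE e) → H.Incident v e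
  up v e inc = raise (subst₂ G.Incident (φ-toV v) (ψ-toE e) (image inc))
    where
    image : S.Incident (toV v) (toE e) → G.Incident (φ (toV v)) (ψ (toE e))
    image (inj₁ p) = subst (λ u → G.Incident (φ u) (ψ (toE e))) p (Joins⇒Incident {G} (ψ-joins (toE e)))
    image (inj₂ p) = subst (λ u → G.Incident (φ u) (ψ (toE e))) p (Joins⇒Incident {G} (Joins-sym {G} (ψ-joins (toE e))))
    raise : G.Incident (proj₁ v) (proj₁ e) → H.Incident v e
    raise (inj₁ p) = inj₁ (Σ-≡ {X = Φ.image} p)
    raise (inj₂ p) = inj₂ (Σ-≡ {X = Φ.image} p)

  outside⇒rest : ∀ {w} → w Defs.∉ Φ.image → w ∈ rest
  outside⇒rest {w} w∉ = [ (λ w∈ → contradiction (inside (∈-⨄⁻ S.finite-V ([_] ∘ φ) w∈)) (toWitnessFalse {a? = Φ.preimage? w} w∉))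
    , (λ w∈ → w∈) ]′
    (∈-++⁻ (⨄ S.finite-V ([_] ∘ φ)) (∈-resp-↭ (↭-sym covers) (elements-complete G.finite-V w)))
    where
    inside : (∃ λ x → w ∈ [ φ x ]) → ∃ λ x → φ x ≡ w
    inside (x , here eq) = x , sym eq

  rest⇒outside : ∀ {w} → w ∈ rest → w Defs.∉ Φ.image
  rest⇒outside {w} w∈ = fromWitnessFalse {a? = Φ.preimage? w} λ { (x , refl) →
    Unique-disjoint (⨄ S.finite-V ([_] ∘ φ)) covers! (∈-⨄ S.finite-V ([_] ∘ φ) x (here refl)) w∈ }

-- Undoing a contraction

module _ {V W : Set} {_∼_ : V → V → Set} {_≈_ : W → W → Set} (f : V → W) (h : ∀ {a b} → a ∼ b → f a ≈ f b) where

  mapPath : ∀ {p x y l} → Path _∼_ p x y l → Path _≈_ p (f x) (f y) (map f l)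
  mapPath []      = []
  mapPath (e ∷ g) = h e ∷ mapPath g

  mapGadget : ∀ {x y z R} → Gadget _∼_ x y z R → Gadget _≈_ (f x) (f y) (f z) (map f R)
  mapGadget (claw {q} {k₁} {k₂} {k₃} {m} f₁ f₂ f₃ n eq) =
    claw (mapPath f₁) (mapPath f₂) (mapPath f₃) (mapMatched f h n)
      (↭-trans (↭-reflexive (sym (cong (f q ∷_) (trans (map-++ f k₁ (k₂ ++ k₃ ++ m)) (cong (map f k₁ ++_)
        (trans (map-++ f k₂ (k₃ ++ m)) (cong (map f k₂ ++_) (map-++ f k₃ m)))))))) (map⁺ f eq))
  mapGadget (triangle {k₁ = k₁} {k₂} {k₃} {s₁} {s₂} {s₃} {m} f₁ f₂ f₃ g₁ g₂ g₃ n eq) =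
    triangle (mapPath f₁) (mapPath f₂) (mapPath f₃) (mapPath g₁) (mapPath g₂) (mapPath g₃) (mapMatched f h n)
      (↭-trans (↭-reflexive (sym (trans (map-++ f k₁ _) (cong (map f k₁ ++_)
        (trans (map-++ f k₂ _) (cong (map f k₂ ++_)
        (trans (map-++ f k₃ _) (cong (map f k₃ ++_) (trans (map-++ f s₁ _) (cong (map f s₁ ++_)
        (trans (map-++ f s₂ _) (cong (map f s₂ ++_) (map-++ f s₃ m))))))))))))) (map⁺ f eq))

  mapGood : ∀ {U R} → Good _∼_ U R → Good _≈_ (λ w → ∃ λ v → U v × f v ≡ w) (map f R)
  mapGood good (_ , u , refl) (_ , v , refl) (_ , w , refl) = mapGadget (good u v w)

-- Gadgets on a shore from the perfect matchings of a contraction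

exposed-good : ∀ {V I : Set} {_∼_ : V → V → Set} → Symmetric _∼_ → (F : Finite V) (FI : Finite I)
  (t : I → V) → (∀ i → NearMatching _∼_ (t i)) → I → ∃ λ U → Good _∼_ U (elements F) × (∀ i → U (t i))
exposed-good ∼-sym F FI t near i₀ with Blossom.terminals-good ∼-sym (finite⇒≟ F) (proj₂ F) (near i₀)
  (elements-unique F) (elements-complete F) {map t (elements FI)} (All.map⁺ (All.tabulate λ {i} _ → near i))
... | U , good , all = U , good , λ i → All.lookup all (∈-map⁺ t (elements-complete FI i))

module _ (G : Graph) (Y : Subset (Graph.V G)) where
  private
    module G = Graph G
    K = G / Y
    module K = Graph K

  Outside : Set
  Outside = Σ G.V (Defs._∉ Y)

  _∼ᵒ_ : Outside → Outside → Set
  u ∼ᵒ v = G.Adjacent (proj₁ u) (proj₁ v)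

  end₁-outside : ∀ {e w} → K.end₁ e ≡ inj₂ w → G.end₁ (proj₁ e) ≡ proj₁ w
  end₁-outside {e , _} eq with ∈⊎∉ Y (G.end₁ e)
  end₁-outside refl | inj₂ _ = refl

  end₂-outside : ∀ {e w} → K.end₂ e ≡ inj₂ w → G.end₂ (proj₁ e) ≡ proj₁ w
  end₂-outside {e , _} eq with ∈⊎∉ Y (G.end₂ e)
  end₂-outside refl | inj₂ _ = refl

  end₁-at : ∀ e → G.end₁ (proj₁ e) Defs.∈ Y → K.end₁ e ≡ inj₁ tt
  end₁-at (e , _) e∈ rewrite ∈⊎∉-∈ Y e∈ = refl

  end₂-at : ∀ e → G.end₂ (proj₁ e) Defs.∈ Y → K.end₂ e ≡ inj₁ tt
  end₂-at (e , _) e∈ rewrite ∈⊎∉-∈ Y e∈ = refl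

  end₁-off : ∀ e (e∉ : G.end₁ (proj₁ e) Defs.∉ Y) → K.end₁ e ≡ inj₂ (_ , e∉)
  end₁-off (e , _) e∉ rewrite ∈⊎∉-∉ Y e∉ = refl

  end₂-off : ∀ e (e∉ : G.end₂ (proj₁ e) Defs.∉ Y) → K.end₂ e ≡ inj₂ (_ , e∉)
  end₂-off (e , _) e∉ rewrite ∈⊎∉-∉ Y e∉ = refl

  outside-joins : ∀ {e u v} → Joins K e (inj₂ u) (inj₂ v) → Joins G (proj₁ e) (proj₁ u) (proj₁ v)
  outside-joins {e} (inj₁ (p , q)) = inj₁ (end₁-outside {e} p , end₂-outside {e} q)
  outside-joins {e} (inj₂ (p , q)) = inj₂ (end₁-outside {e} p , end₂-outside {e} q)

  PerfectMatching⇒NearMatching : ∀ {M} (pm : K.PerfectMatching M) →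
    ∃ λ r → Mates.mate {K} pm (inj₁ tt) ≡ inj₂ r × NearMatching _∼ᵒ_ r
  PerfectMatching⇒NearMatching pm with Mates.mate {K} pm (inj₁ tt) in eq
  ... | inj₁ tt = contradiction eq (Mates.irreflexive {K} pm (inj₁ tt))
  ... | inj₂ r = r , refl , record
    { mate       = mate₀
    ; involutive = involutive₀
    ; exposed    = exposed₀
    ; covered    = covered₀
    ; adjacent   = adjacent₀
    }
    where
    open Mates {K} pm
    -- A vertex whose mate is the contracted vertex becomes its own mate, that is, exposed.
    mate₀ : Outside → Outside
    mate₀ w = [ const w , id ]′ (mate (inj₂ w))
    involutive₀ : ∀ w → mate₀ (mate₀ w) ≡ w
    involutive₀ w with mate (inj₂ w) in eq′
    ... | inj₁ tt = cong [ const w , id ]′ eq′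
    ... | inj₂ w′ = cong [ const w′ , id ]′ (trans (cong mate (sym eq′)) (involutive (inj₂ w)))
    exposed₀ : mate₀ r ≡ r
    exposed₀ = cong [ const r , id ]′ (trans (cong mate (sym eq)) (involutive (inj₁ tt)))
    at-r : ∀ {w} → mate (inj₂ w) ≡ inj₁ tt → w ≡ r
    at-r {w} eq′ = inj₂-injective (trans (sym (involutive (inj₂ w))) (trans (cong mate eq′) eq))
    covered₀ : ∀ {w} → mate₀ w ≡ w → w ≡ r
    covered₀ {w} fixed with mate (inj₂ w) in eq′
    ... | inj₁ tt = at-r eq′
    ... | inj₂ w′ = contradiction (trans eq′ (cong inj₂ fixed)) (irreflexive (inj₂ w))
    adjacent₀ : ∀ {w} → w ≢ r → w ∼ᵒ mate₀ w
    adjacent₀ {w} w≢r with mate (inj₂ w) in eq′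
    ... | inj₁ tt = contradiction (at-r eq′) w≢r
    ... | inj₂ w′ = proj₁ (edgeAt (inj₂ w)) ,
      outside-joins {edgeAt (inj₂ w)} (subst (Joins K (edgeAt (inj₂ w)) (inj₂ w)) eq′ (joins (inj₂ w)))

  finite-Outside : Finite Outside
  finite-Outside = finite-∉ G.finite-V Y

  outside : List G.V
  outside = ⨄ finite-Outside ([_] ∘ proj₁)

  module _ (matching : ∀ e → ∃ λ M → K.PerfectMatching M × e Defs.∈ M) where

    -- The mate of the contracted vertex in a matching through `e`. It is defined for every edge, so
    -- that all of them can index the terminals; for an edge of the cut it is the outer end, by
    -- `partner-unique`.
    partner : K.E → Outside
    partner e = proj₁ (PerfectMatching⇒NearMatching (proj₁ (proj₂ (matching e))))

    near : ∀ e → NearMatching _∼ᵒ_ (partner e)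
    near e = proj₂ (proj₂ (PerfectMatching⇒NearMatching (proj₁ (proj₂ (matching e)))))

    partner-unique : ∀ {e w} → Joins K e (inj₁ tt) (inj₂ w) → partner e ≡ w
    partner-unique {e} j = inj₂-injective (trans
      (sym (proj₁ (proj₂ (PerfectMatching⇒NearMatching (proj₁ (proj₂ (matching e)))))))
      (Mates.mate-unique {K} (proj₁ (proj₂ (matching e))) (proj₂ (proj₂ (matching e))) j))

    partners-good : K.E → ∃ λ U → Good _∼ᵒ_ U (elements finite-Outside) × (∀ e → U (partner e))
    partners-good = exposed-good {_∼_ = _∼ᵒ_} (λ {a} {b} → Adjacent-sym {G} {proj₁ a} {proj₁ b})
      finite-Outside K.finite-E partner near

    Touched : K.E → G.V → Set
    Touched e₀ v = ∃ λ w → proj₁ (partners-good e₀) w × proj₁ w ≡ v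

    outside-good : ∀ e₀ → Good G.Adjacent (Touched e₀) outside
    outside-good e₀ = subst (Good G.Adjacent (Touched e₀)) (map-⨄ proj₁ finite-Outside id)
      (mapGood {_∼_ = _∼ᵒ_} {G.Adjacent} proj₁ (λ e → e) {U = proj₁ (partners-good e₀)} (proj₁ (proj₂ (partners-good e₀))))

    outside-touched : ∀ e₀ {e w} → Joins K e (inj₁ tt) (inj₂ w) → Touched e₀ (proj₁ w)
    outside-touched e₀ {e} {w} j = w ,
      subst (proj₁ (partners-good e₀)) (partner-unique {e} j) (proj₂ (proj₂ (partners-good e₀)) e) , refl

  some-edge : ∀ {u v} → u ≢ v → Star K.Adjacent u v → K.E
  some-edge u≢v ε             = contradiction refl u≢v
  some-edge u≢v ((e , _) ◅ _) = e

  shore-good : MatchingCovered K → ∃ λ U → Good G.Adjacent U outside ×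
    (∀ {e w} → Joins K e (inj₁ tt) (inj₂ w) → U (proj₁ w))
  shore-good (connected , (u , v , u≢v) , matching) =
    Touched matching e₀ , outside-good matching e₀ , λ {e} {w} → outside-touched matching e₀ {e} {w}
    -- Any edge will do: a perfect matching through it, without the contracted vertex, is the one
    -- from which the growth starts.
    where e₀ = some-edge u≢v (connected u v)

not-both : ∀ a b → T (not (a ∧ b)) → T a → T (not b)
not-both true false _ _ = tt

-- Replacing the contracted vertex by the shore

module _ {J : Graph} {cubic : Cubic J} {G : Graph} (Z : Subset (Graph.V G)) where
  private
    module J = Graph J
    module G = Graph G
    K = G / Z
    module K = Graph K

  -- How the model uses the contracted vertex is never asked: `liftGadget` and `liftMatched`
  -- substitute the shore wherever it occurs. The edges representing `J` stay; their terminals move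
  -- to their actual ends in `G`.
  Model-uncontract : ∀ {U R} → Good G.Adjacent U R → R ↭ ⨄ (finite-∈ G.finite-V Z) ([_] ∘ proj₁) →
    (∀ (e : K.E) → G.end₁ (proj₁ e) Defs.∈ Z → U (G.end₁ (proj₁ e))) →
    (∀ (e : K.E) → G.end₂ (proj₁ e) Defs.∈ Z → U (G.end₂ (proj₁ e))) →
    Model J cubic K → Model J cubic G
  Model-uncontract {U} {R} good R↭ usable₁ usable₂ M = record
    { edge           = proj₁ ∘ edge
    ; edge-injective = edge-injective ∘ Σ-≡ {X = λ e → not (Z (G.end₁ e) ∧ Z (G.end₂ e))}
    ; terminal       = terminal′
    ; joins          = λ e → proj₂ (proj₂ (proj₂ (proj₂ (lifted e))))
    ; node           = expand ∘ node
    ; gadget         = λ v → liftGadget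
        (subst (Gadget _≈_ _ _ _) (map-id (node v)) (mapGadget id adjacent (gadget v))) (exits v _) (exits v _) (exits v _)
    ; matched        = proj₁ (proj₂ rest′)
    ; cover          = ↭-trans (++⁺ (↭-reflexive (sym (concatMap-⨄ fibre J.finite-V node)))
        (proj₂ (proj₂ rest′)))
        (↭-trans (↭-sym (expand-++ (⨄ J.finite-V node) rest))
        (↭-trans (concatMap-↭ fibre cover) expand-elements))
    }
    where
    open Model M
    fibre : K.V → List G.V
    fibre (inj₁ tt)      = R
    fibre (inj₂ (v , _)) = [ v ]
    Exit : K.V → G.V → Set
    Exit (inj₁ tt)      u = U u
    Exit (inj₂ (v , _)) u = u ≡ v
    fibre-good : ∀ w → Good G.Adjacent (Exit w) (fibre w)
    fibre-good (inj₁ tt) = good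
    fibre-good (inj₂ _) refl refl refl = claw [] [] [] [] ↭-refl
    open Contraction (Adjacent-sym {G}) fibre Exit (λ w → fibre-good w)

    exit₁ : ∀ e → Exit (K.end₁ e) (G.end₁ (proj₁ e))
    exit₁ e = [ (λ e∈ → subst (λ w → Exit w (G.end₁ (proj₁ e))) (sym (end₁-at G Z e e∈)) (usable₁ e e∈))
              , (λ e∉ → subst (λ w → Exit w (G.end₁ (proj₁ e))) (sym (end₁-off G Z e e∉)) refl) ]′
      (∈⊎∉ Z (G.end₁ (proj₁ e)))
    exit₂ : ∀ e → Exit (K.end₂ e) (G.end₂ (proj₁ e))
    exit₂ e = [ (λ e∈ → subst (λ w → Exit w (G.end₂ (proj₁ e))) (sym (end₂-at G Z e e∈)) (usable₂ e e∈))
              , (λ e∉ → subst (λ w → Exit w (G.end₂ (proj₁ e))) (sym (end₂-off G Z e e∉)) refl) ]′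
      (∈⊎∉ Z (G.end₂ (proj₁ e)))

    lift : ∀ {e a b} → Joins K e a b → ∃₂ λ x y → Exit a x × Exit b y × Joins G (proj₁ e) x y
    lift {e} (inj₁ (refl , refl)) = _ , _ , exit₁ e , exit₂ e , inj₁ (refl , refl)
    lift {e} (inj₂ (refl , refl)) = _ , _ , exit₂ e , exit₁ e , inj₂ (refl , refl)

    lifted : ∀ e → ∃₂ λ x y →
      Exit (terminal _ (half₁ J cubic e)) x × Exit (terminal _ (half₂ J cubic e)) y × Joins G (proj₁ (edge e)) x y
    lifted e = lift {edge e} (joins e)

    adjacent : ∀ {a b} → K.Adjacent a b → a ≈ b
    adjacent (e , j) = let x , y , u , v , j′ = lift {e} j in via u v (proj₁ e , j′)

    terminal′ : ∀ v → HalfEdge J cubic v → G.V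
    terminal′ _ (e , inj₁ refl) = proj₁ (lifted e)
    terminal′ _ (e , inj₂ refl) = proj₁ (proj₂ (lifted e))

    exits : ∀ v h → Exit (terminal v h) (terminal′ v h)
    exits _ (e , inj₁ refl) = proj₁ (proj₂ (proj₂ (lifted e)))
    exits _ (e , inj₂ refl) = proj₁ (proj₂ (proj₂ (proj₂ (lifted e))))

    rest′ = liftMatched (subst (Matched _≈_) (map-id rest) (mapMatched id adjacent matched))

    expand-elements : expand (elements K.finite-V) ↭ elements G.finite-V
    expand-elements = ↭-trans (↭-reflexive (concatMap-⨄ fibre K.finite-V [_]))
      (↭-trans (⨄-cong K.finite-V (λ w → ↭-reflexive (++-identityʳ (fibre w))))
      (↭-trans (⨄-⊎ finite-⊤ (finite-∉ G.finite-V Z) K.finite-V fibre)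
      (↭-trans (++⁺ʳ _ (↭-trans (↭-reflexive (++-identityʳ R)) R↭))
      (↭-sym (⨄-split G.finite-V Z [_])))))

  -- The shores are complementary only up to a pointwise equation, because one of the two
  -- applications makes `Z` the double complement of itself.
  uncontract-along : ∀ {Y U} → (∀ v → Z v ≡ not (Y v)) → Good G.Adjacent U (outside G Y) →
    (∀ {e w} → Joins (G / Y) e (inj₁ tt) (inj₂ w) → U (proj₁ w)) → Model J cubic K → Model J cubic G
  uncontract-along {Y} {U} Z≡∁Y good touched = Model-uncontract {U} good R↭ usable₁ usable₂
    where
    Z⇒∉Y : ∀ {v} → v Defs.∈ Z → v Defs.∉ Y
    Z⇒∉Y {v} = subst T (Z≡∁Y v)
    ∉Y⇒Z : ∀ {v} → v Defs.∉ Y → v Defs.∈ Z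
    ∉Y⇒Z {v} = subst T (sym (Z≡∁Y v))
    ∉Z⇒Y : ∀ {v} → v Defs.∉ Z → v Defs.∈ Y
    ∉Z⇒Y {v} = subst T (trans (cong not (Z≡∁Y v)) (not-involutive (Y v)))
    not-both′ : ∀ a b → T (not (a ∧ b)) → T b → T (not a)
    not-both′ false true _ _ = tt
    shores : Σ G.V (Defs._∈ Z) ↔ Σ G.V (Defs._∉ Y)
    shores = mk↔ₛ′ (λ { (v , p) → v , Z⇒∉Y p }) (λ { (v , p) → v , ∉Y⇒Z p })
      (λ _ → Σ-≡ {X = ∁ Y} refl) (λ _ → Σ-≡ {X = Z} refl)
    avoids : ∀ e → G.end₁ e Defs.∈ Z ⊎ G.end₂ e Defs.∈ Z → T (not (Y (G.end₁ e) ∧ Y (G.end₂ e)))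
    avoids e (inj₁ p) = first _ _ (Z⇒∉Y p)
      where
      first : ∀ a b → T (not a) → T (not (a ∧ b))
      first false _ _ = tt
    avoids e (inj₂ p) = second _ _ (Z⇒∉Y p)
      where
      second : ∀ a b → T (not b) → T (not (a ∧ b))
      second false false _ = tt
      second true  false _ = tt

    R↭ : outside G Y ↭ ⨄ (finite-∈ G.finite-V Z) ([_] ∘ proj₁)
    R↭ = ⨄-↔ (finite-∈ G.finite-V Z) (finite-∉ G.finite-V Y) shores ([_] ∘ proj₁)
    usable₁ : ∀ (e : K.E) → G.end₁ (proj₁ e) Defs.∈ Z → U (G.end₁ (proj₁ e))
    usable₁ (e , e∉) e∈ = touched {f} {_ , Z⇒∉Y e∈}
      (inj₂ (end₁-off G Y f (Z⇒∉Y e∈) , end₂-at G Y f (∉Z⇒Y (not-both _ _ e∉ e∈))))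
      where
      f : Graph.E (G / Y)
      f = e , avoids e (inj₁ e∈)
    usable₂ : ∀ (e : K.E) → G.end₂ (proj₁ e) Defs.∈ Z → U (G.end₂ (proj₁ e))
    usable₂ (e , e∉) e∈ = touched {f} {_ , Z⇒∉Y e∈}
      (inj₁ (end₁-at G Y f (∉Z⇒Y (not-both′ _ _ e∉ e∈)) , end₂-off G Y f (Z⇒∉Y e∈)))
      where
      f : Graph.E (G / Y)
      f = e , avoids e (inj₂ e∈)

  uncontract : ∀ {Y} → (∀ v → Z v ≡ not (Y v)) → MatchingCovered (G / Y) → Model J cubic K → Model J cubic G
  uncontract {Y} Z≡∁Y mc = by-cases (shore-good G Y mc)
    where
    by-cases : (∃ λ U → Good G.Adjacent U (outside G Y) × (∀ {e w} → Joins (G / Y) e (inj₁ tt) (inj₂ w) → U (proj₁ w))) →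
               Model J cubic K → Model J cubic G
    by-cases (_ , good , touched) = uncontract-along Z≡∁Y good (λ {e} → touched {e})

ConformalMinor⇒Model : ∀ {J cubic L G} → K₄ (J , cubic) L → ConformalMinor L G → Model J cubic G
ConformalMinor⇒Model {J} {cubic} {L} {G} (X , iso) minor =
  Expansion⇒Model {J} {cubic} {X} {G} (transport {L} iso (ConformalMinor⇒Expansion {L} {G} minor))

≅-refl : ∀ {L} → L ≅ L
≅-refl = record { V↔ = ↔-refl ; E↔ = ↔-refl ; incident = λ _ _ → ⇔-refl }

Expansion⇒¬Free : ∀ {J cubic X G} → ∃ (Distinct {(J , cubic) ^ X ⊙K₄} {G}) → ¬ Free (K₄ (J , cubic)) G
Expansion⇒¬Free {J} {cubic} {X} {G} E free = free L (X , ≅-refl {L}) (Expansion⇒ConformalMinor {L} {G} E)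
  where L = (J , cubic) ^ X ⊙K₄

Model⇒¬Free : ∀ {J cubic G} → Model J cubic G → ¬ Free (K₄ (J , cubic)) G
Model⇒¬Free {J} {cubic} {G} M = by-cases (Model⇒Expansion M)
  where
  by-cases : (∃ λ X → ∃ (Distinct {(J , cubic) ^ X ⊙K₄} {G})) → ¬ Free (K₄ (J , cubic)) G
  by-cases (X , E) = Expansion⇒¬Free {J} {cubic} {X} {G} E

contraction-free : ∀ {J cubic G} (Z : Subset (Graph.V G)) {Y} → (∀ v → Z v ≡ not (Y v)) →
  MatchingCovered (G / Y) → Free (K₄ (J , cubic)) G → Free (K₄ (J , cubic)) (G / Z)
contraction-free {J} {cubic} {G} Z {Y} Z≡∁Y mc free L L∈ minor = Model⇒¬Free {J} {cubic} {G}
  (uncontract {J} {cubic} {G} Z {Y} Z≡∁Y mc (ConformalMinor⇒Model {J} {cubic} {L} {G / Z} L∈ minor)) free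

theorem1p17 :
    ∀ (J : Graph) → TwoConnected J → (cubic : Cubic J) →
    ∀ (G : Graph) → MatchingCovered G →
    ∀ (C : Cut G) → Cut.Separating C →
    Free (K₄ (J , cubic)) G →
    Free (K₄ (J , cubic)) (Cut.contraction₁ C) × Free (K₄ (J , cubic)) (Cut.contraction₂ C)
theorem1p17 J _ cubic G _ C (mc₁ , mc₂) free =
  -- Each contraction draws on the perfect matchings of the other one.
  subst (Free (K₄ (J , cubic))) {G / shore} {contraction₁} refl
    (contraction-free {J} {cubic} {G} shore {∁ shore} (λ v → sym (not-involutive (shore v))) mc₂ free) ,
  subst (Free (K₄ (J , cubic))) {G / ∁ shore} {contraction₂} refl
    (contraction-free {J} {cubic} {G} (∁ shore) {shore} (λ _ → refl) mc₁ free)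
  where open Cut C
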